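{- Let $q$ be a prime power, $D\ge3$, and $e\in\{0,1,2\}$ or $e\in\{1/2,3/2\}$ with $q$ a square. With $\mathfrak L$, $\langle\cdot,\cdot\rangle_{\mathfrak L}$ and $\ell_i^\pm$ as in the context, for all $0\le i,j\le D-1$ and $\mu,\nu\in\{+,-\}$, $$\langle\ell_i^\mu,\ell_j^\nu\rangle_{\mathfrak L}=\delta_{i,j}\delta_{\mu,\nu}N_i^\mu,\quad\text{where } N_i^-=q^{ie}\prod_{n=1}^i\frac{q^D-q^n}{q^n-1},\ \ N_i^+=q^{(i+1)e}\prod_{n=1}^i\frac{q^D-q^n}{q^n-1}.$$
   Context: Notation: $(r;q)_n=\prod_{k=0}^{n-1}(1-rq^k)$; $\tau=\sqrt{ -1}\,q^{ -(D+e)/2}$. For nonzero $s$, $d\ge0$, $0\le i\le d$: $h_i(\eta;s,d;q)=\frac{(q^{ -d};q)_i}{s^i}\sum_{n=0}^{i}\frac{(q^{ -i};q)_n(s\eta^{ -1};q)_n(s\eta;q)_n}{(q^{ -d};q)_n(q;q)_n}q^n$. Let $h_i=h_i(\eta;\tau,D;q)$, $h_i^\perp=h_i(\eta;\tau q,D-2;q)$ for $0\le i\le D-2$, $h_{ -1}^\perp=0$, $h_{D-1}^\perp=\eta^{1-D}\prod_{n=1}^{D-1}(\eta-\tau q^n)(\eta-\tau^{ -1}q^{ -n})$, $p^\perp=\eta^{ -1}(\eta-\tau)(\eta-\tau^{ -1}q^{ -D})$, and for $0\le i\le D-1$: $\ell_i^+=\frac{h_{i+1}-p^\perp h_i^\perp}{\tau^{i+1}(1-q^D)(q;q)_i}$,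 $\ell_i^-=\frac{q^D-q^i}{\tau^i(q^D-1)(q;q)_i}\big(h_i-\frac{1-q^i}{q^D-q^i}p^\perp h_{i-1}^\perp\big)$. Let $\mathfrak L=\operatorname{span}_{\mathbb C}\{\eta^k:-D\le k\le D-1\}\subset\mathbb C[\eta,\eta^{ -1}]$ (it contains all $\ell_i^\pm$). Let $\lambda_i=\tau q^i$ ($0\le i\le D-1$) and $\lambda_{ -i}=\tau^{ -1}q^{ -i}$ ($1\le i\le D$). Define weights: $w_0=1/(-q^e;q)_D$, $w_{ -D}=1/(-q^{ -e};q)_D$, and for $1\le i\le D-1$: $w_i=(-1)^iq^{i(D+e-i)}\dfrac{(q^{1-D};q)_i(1+q^D+q^{D+e-i}-q^{D-i})}{(q;q)_i(-q^{e-i};q)_D(1+q^{D+e-2i})}$, $w_{ -i}=(-1)^{i-1}q^{i(D+e-i-2)+D+e}\dfrac{(q^{1-D};q)_{i-1}(1+q^D+q^{i-e}-q^i)}{(q;q)_{i-1}(-q^{e-i+1};q)_D(1+q^{D+e-2i})}$, $c_i=(-1)^iq^{i(D+e-i-1)+D}\dfrac{(q^{1-D};q)_i}{(q;q)_{i-1}(-q^{e-i+1};q)_{D-1}(1+q^{D+e-2i})}$. For $f,g\in\mathfrak L$ define $$\langle f,g\rangle_{\mathfrak L}=\sum_{i=-D}^{D-1}f(\lambda_i)\overline{g(\lambda_i)}\,w_i+\sum_{i=1}^{D-1}\big(f(\lambda_i)\overline{g(\lambda_{ -i})}+f(\lambda_{ -i})\overline{g(\lambda_i)}\big)c_i.$$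 (In the paper, $w_i$, $c_i$ arise as $\|\mathbf y_i\|^2$, $\langle\mathbf y_i,\mathbf y_{ -i}\rangle$ for an eigenbasis $\mathbf y_i$ in a module attached to a dual polar graph with parameters $q,D,e$, and $N_i^\pm$ are the sizes of certain vertex sets $C_i^\pm$.) -}

module Defs where

open import Data.Bool using (Bool; true; false; if_then_else_)
open import Data.Nat as ℕ using (ℕ; zero; suc)
open import Data.Nat.Primality using (Prime)
open import Data.Integer as ℤ using (ℤ; +_; -[1+_])
open import Data.Rational as ℚ using (ℚ; mkℚ; 0ℚ; 1ℚ)
open import Data.Product using (Σ; _×_)
open import Relation.Binary.PropositionalEquality using (_≡_)

IsPrimePower : ℕ → Set
IsPrimePower q = Σ ℕ λ p → Σ ℕ λ k → Prime p × q ≡ p ℕ.^ suc k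

ℕ→ℚ : ℕ → ℚ
ℕ→ℚ n = (+ n) ℚ./ 1

-- multiplicative inverse; the value at 0 is an (unused) junk value
inv : ℚ → ℚ
inv (mkℚ (+ zero) _ _) = 0ℚ
inv p@(mkℚ (+ (suc n)) _ _) = ℚ.1/ p
inv p@(mkℚ -[1+ n ] _ _) = ℚ.1/ p

powQ : ℚ → ℕ → ℚ
powQ x zero = 1ℚ
powQ x (suc n) = x ℚ.* powQ x n

data EData (q : ℕ) : Set where
  e0 e1 e2 : EData q
  eHalf eThreeHalf : (r : ℕ) → r ℕ.* r ≡ q → EData q

qᵉ : {q : ℕ} → EData q → ℚ
qᵉ e0 = 1ℚ
qᵉ {q} e1 = ℕ→ℚ q
qᵉ {q} e2 = ℕ→ℚ (q ℕ.* q)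
qᵉ (eHalf r _) = ℕ→ℚ r
qᵉ (eThreeHalf r _) = ℕ→ℚ (r ℕ.* r ℕ.* r)

record ℚi : Set where
  constructor _+i_
  field re im : ℚ
open ℚi public

_+ᶜ_ : ℚi → ℚi → ℚi
(a +i b) +ᶜ (c +i d) = (a ℚ.+ c) +i (b ℚ.+ d)

_*ᶜ_ : ℚi → ℚi → ℚi
(a +i b) *ᶜ (c +i d) = (a ℚ.* c ℚ.- b ℚ.* d) +i (a ℚ.* d ℚ.+ b ℚ.* c)

-ᶜ_ : ℚi → ℚi
-ᶜ (a +i b) = (ℚ.- a) +i (ℚ.- b)

conjᶜ : ℚi → ℚi
conjᶜ (a +i b) = a +i (ℚ.- b)

-- The ring ℚ(i)[ρ] with ρ² = M (M a positive rational), modelling the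
-- subring of ℂ generated by i, ρ = √M (positive real root) and ℚ.
-- ⟨ a , b ⟩ represents a + b ρ.  Complex conjugation conjugates a, b
-- and fixes ρ (ρ is real).

record ℂρ : Set where
  constructor ⟨_,_⟩
  field fst snd : ℚi

data Sign : Set where
  plus minus : Sign

δℕ : ℕ → ℕ → ℚ
δℕ i j = if i ℕ.≡ᵇ j then 1ℚ else 0ℚ

δS : Sign → Sign → ℚ
δS plus plus = 1ℚ
δS minus minus = 1ℚ
δS plus minus = 0ℚ
δS minus plus = 0ℚ

-- Everything depending on q, D and E = q^e.

module Dual (q D : ℕ) (E : ℚ) where

  qQ : ℚ
  qQ = ℕ→ℚ q

  qpow : ℤ → ℚ
  qpow (+ n) = powQ qQ n
  qpow -[1+ n ] = inv (powQ qQ (suc n))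

  -- M = q^(D+e) = ρ², ρ = q^((D+e)/2) > 0
  M : ℚ
  M = powQ qQ D ℚ.* E

  infixl 6 _+_ _-_
  infixl 7 _*_

  _+_ : ℂρ → ℂρ → ℂρ
  ⟨ a , b ⟩ + ⟨ c , d ⟩ = ⟨ a +ᶜ c , b +ᶜ d ⟩

  _*_ : ℂρ → ℂρ → ℂρ
  ⟨ a , b ⟩ * ⟨ c , d ⟩ =
    ⟨ (a *ᶜ c) +ᶜ ((b *ᶜ d) *ᶜ (M +i 0ℚ)) , (a *ᶜ d) +ᶜ (b *ᶜ c) ⟩

  -_ : ℂρ → ℂρ
  - ⟨ a , b ⟩ = ⟨ -ᶜ a , -ᶜ b ⟩

  _-_ : ℂρ → ℂρ → ℂρ
  x - y = x + (- y)

  conj : ℂρ → ℂρ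
  conj ⟨ a , b ⟩ = ⟨ conjᶜ a , conjᶜ b ⟩

  emb : ℚ → ℂρ
  emb r = ⟨ r +i 0ℚ , 0ℚ +i 0ℚ ⟩

  0R 1R iR ρR : ℂρ
  0R = emb 0ℚ
  1R = emb 1ℚ
  iR = ⟨ 0ℚ +i 1ℚ , 0ℚ +i 0ℚ ⟩
  ρR = ⟨ 0ℚ +i 0ℚ , 1ℚ +i 0ℚ ⟩

  pow : ℂρ → ℕ → ℂρ
  pow x zero = 1R
  pow x (suc n) = x * pow x n

  sumR : ℕ → (ℕ → ℂρ) → ℂρ
  sumR zero f = 0R
  sumR (suc n) f = sumR n f + f n

  prodR : ℕ → (ℕ → ℂρ) → ℂρ
  prodR zero f = 1R
  prodR (suc n) f = prodR n f * f n

  prodQ : ℕ → (ℕ → ℚ) → ℚ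
  prodQ zero f = 1ℚ
  prodQ (suc n) f = prodQ n f ℚ.* f n

  poch : ℂρ → ℕ → ℂρ
  poch r n = prodR n (λ k → 1R - r * emb (powQ qQ k))

  pochQ : ℚ → ℕ → ℚ
  pochQ r n = prodQ n (λ k → 1ℚ ℚ.- r ℚ.* powQ qQ k)

  -- τ = √-1 · q^(-(D+e)/2) = i ρ / M,   τ⁻¹ = -i ρ
  τ τ⁻¹ : ℂρ
  τ = iR * ρR * emb (inv M)
  τ⁻¹ = - (iR * ρR)

  -- h_i(η; s, d; q), evaluated at η (with η' = η⁻¹), s' = s⁻¹
  h : (η η' s s' : ℂρ) (d i : ℕ) → ℂρ
  h η η' s s' d i =
    emb (pochQ (qpow (ℤ.- (+ d))) i) * pow s' i *
    sumR (suc i) (λ n →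
      emb (pochQ (qpow (ℤ.- (+ i))) n) * poch (s * η') n * poch (s * η) n *
      emb (inv (pochQ (qpow (ℤ.- (+ d))) n ℚ.* pochQ qQ n) ℚ.* powQ qQ n))

  hD : (η η' : ℂρ) → ℕ → ℂρ
  hD η η' i = h η η' τ τ⁻¹ D i

  hperp : (η η' : ℂρ) → ℕ → ℂρ
  hperp η η' i =
    if suc i ℕ.≡ᵇ D
    then pow η' (D ℕ.∸ 1) *
         prodR (D ℕ.∸ 1) (λ k →
           (η - τ * emb (powQ qQ (suc k))) *
           (η - τ⁻¹ * emb (qpow (ℤ.- (+ suc k)))))
    else h η η' (τ * emb qQ) (τ⁻¹ * emb (inv qQ)) (D ℕ.∸ 2) i

  hperp₋₁ : (η η' : ℂρ) → ℕ → ℂρ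
  hperp₋₁ η η' zero = 0R
  hperp₋₁ η η' (suc k) = hperp η η' k

  pperp : (η η' : ℂρ) → ℂρ
  pperp η η' = η' * (η - τ) * (η - τ⁻¹ * emb (qpow (ℤ.- (+ D))))

  ℓ : Sign → ℕ → (η η' : ℂρ) → ℂρ
  ℓ plus i η η' =
    (hD η η' (suc i) - pperp η η' * hperp η η' i) * pow τ⁻¹ (suc i) *
    emb (inv ((1ℚ ℚ.- powQ qQ D) ℚ.* pochQ qQ i))
  ℓ minus i η η' =
    emb ((powQ qQ D ℚ.- powQ qQ i) ℚ.*
         inv ((powQ qQ D ℚ.- 1ℚ) ℚ.* pochQ qQ i)) *
    pow τ⁻¹ i *
    (hD η η' i -
      emb ((1ℚ ℚ.- powQ qQ i) ℚ.* inv (powQ qQ D ℚ.- powQ qQ i)) *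
      pperp η η' * hperp₋₁ η η' i)

  -- the points λ_i (0 ≤ i ≤ D-1) and λ_{-i} (1 ≤ i ≤ D), with inverses
  λ⁺ λ⁺' λ⁻ λ⁻' : ℕ → ℂρ
  λ⁺ i = τ * emb (powQ qQ i)
  λ⁺' i = τ⁻¹ * emb (qpow (ℤ.- (+ i)))
  λ⁻ i = τ⁻¹ * emb (qpow (ℤ.- (+ i)))
  λ⁻' i = τ * emb (powQ qQ i)

  sgn : ℕ → ℚ
  sgn i = powQ (ℚ.- 1ℚ) i

  negPoch : ℤ → ℕ → ℚ
  negPoch m n = pochQ (ℚ.- (E ℚ.* qpow m)) n

  w⁺ : ℕ → ℚ
  w⁺ zero = inv (negPoch (+ 0) D)
  w⁺ i@(suc _) =
    sgn i ℚ.* qpow (+ i ℤ.* (+ D ℤ.- + i)) ℚ.* powQ E i ℚ.*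
    pochQ (qpow (+ 1 ℤ.- + D)) i ℚ.*
    (1ℚ ℚ.+ powQ qQ D ℚ.+ qpow (+ D ℤ.- + i) ℚ.* E ℚ.- qpow (+ D ℤ.- + i)) ℚ.*
    inv (pochQ qQ i ℚ.* negPoch (ℤ.- (+ i)) D ℚ.*
         (1ℚ ℚ.+ qpow (+ D ℤ.- + 2 ℤ.* + i) ℚ.* E))

  w⁻ : ℕ → ℚ
  w⁻ i =
    if i ℕ.≡ᵇ D
    then inv (pochQ (ℚ.- inv E) D)
    else
      sgn (i ℕ.∸ 1) ℚ.*
      qpow (+ i ℤ.* (+ D ℤ.- + i ℤ.- + 2) ℤ.+ + D) ℚ.* powQ E (suc i) ℚ.*
      pochQ (qpow (+ 1 ℤ.- + D)) (i ℕ.∸ 1) ℚ.*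
      (1ℚ ℚ.+ powQ qQ D ℚ.+ powQ qQ i ℚ.* inv E ℚ.- powQ qQ i) ℚ.*
      inv (pochQ qQ (i ℕ.∸ 1) ℚ.* negPoch (+ 1 ℤ.- + i) D ℚ.*
           (1ℚ ℚ.+ qpow (+ D ℤ.- + 2 ℤ.* + i) ℚ.* E))

  c : ℕ → ℚ
  c i =
    sgn i ℚ.* qpow (+ i ℤ.* (+ D ℤ.- + i ℤ.- + 1) ℤ.+ + D) ℚ.* powQ E i ℚ.*
    pochQ (qpow (+ 1 ℤ.- + D)) i ℚ.*
    inv (pochQ qQ (i ℕ.∸ 1) ℚ.* negPoch (+ 1 ℤ.- + i) (D ℕ.∸ 1) ℚ.*
         (1ℚ ℚ.+ qpow (+ D ℤ.- + 2 ℤ.* + i) ℚ.* E))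

  -- ⟨f, g⟩_𝔏 for f, g given by their evaluation maps (η, η⁻¹) ↦ f(η)
  inner : (f g : ℂρ → ℂρ → ℂρ) → ℂρ
  inner f g =
    sumR D (λ i → f (λ⁺ i) (λ⁺' i) * conj (g (λ⁺ i) (λ⁺' i)) * emb (w⁺ i)) +
    sumR D (λ k → f (λ⁻ (suc k)) (λ⁻' (suc k)) *
                  conj (g (λ⁻ (suc k)) (λ⁻' (suc k))) * emb (w⁻ (suc k))) +
    sumR (D ℕ.∸ 1) (λ k →
      (f (λ⁺ (suc k)) (λ⁺' (suc k)) * conj (g (λ⁻ (suc k)) (λ⁻' (suc k))) +
       f (λ⁻ (suc k)) (λ⁻' (suc k)) * conj (g (λ⁺ (suc k)) (λ⁺' (suc k)))) *
      emb (c (suc k)))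

  Nfac : ℕ → ℚ
  Nfac i = prodQ i (λ k → (powQ qQ D ℚ.- powQ qQ (suc k)) ℚ.*
                           inv (powQ qQ (suc k) ℚ.- 1ℚ))

  N : Sign → ℕ → ℚ
  N minus i = powQ E i ℚ.* Nfac i
  N plus i = powQ E (suc i) ℚ.* Nfac i

{-# OPTIONS --safe #-}
module Submission where

-- Write p = 1/q and c = -1/q^e.  At λ_k and λ_{-k} = 1/λ_k the value of h_i is
-- the same, namely a dual q-Krawtchouk polynomial of degree i at k ∈ {0,…,D};
-- h_i^⊥ gives in the same way the polynomials with parameter D - 2 at k - 1,
-- and p^⊥ h_{D-1}^⊥ vanishes at all the points.  The 2×2 block of weights at
-- λ_{±k} makes every symmetric f orthogonal to every p^⊥ g with g symmetric,
-- and induces on the f, respectively the g, the weight for which the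
-- corresponding dual q-Krawtchouk polynomials are orthogonal.  Since ℓ_i^+ and
-- ℓ_{i+1}^- are combinations of the same two vectors h_{i+1} and p^⊥ h_i^⊥,
-- only their norms remain to be compared.

open import Defs
open import Data.Nat using (ℕ; _≤_; _<_)
open import Data.Rational using (_*_)
open import Relation.Binary.PropositionalEquality using (_≡_)

open import Algebra.Bundles using (CommutativeRing)
open import Data.Bool using (Bool; true; false; if_then_else_)
open import Data.Integer as ℤ using (+_; -[1+_])
import Data.Integer.Properties as ℤ
import Data.Integer.Tactic.RingSolver as ℤ
open import Data.Maybe using (just; nothing)
open import Data.Nat as ℕ using (zero; suc)
import Data.Nat.Properties as ℕ
open import Data.Nat.Primality using (prime⇒nonTrivial)
open import Data.Product using (_,_)
open import Data.Rational as ℚ using (ℚ; mkℚ; 0ℚ; 1ℚ; _+_; _-_; -_; positive)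
import Data.Rational.Properties as ℚ
import Data.Rational.Unnormalised as ℚᵘ
import Data.Rational.Unnormalised.Properties as ℚᵘ
open import Data.Sum using (_⊎_; inj₁; inj₂)
open import Level using (0ℓ)
open import Relation.Binary using (Tri; tri<; tri≈; tri>)
open import Relation.Binary.PropositionalEquality
  using (_≢_; refl; sym; trans; cong; cong₂; subst; subst₂; isEquivalence; module ≡-Reasoning)
open import Relation.Nullary using (Dec; yes; no; contradiction)
open import Algebra.Definitions {A = ℂρ} _≡_
  using (Associative; Commutative; LeftIdentity; LeftInverse; _DistributesOverˡ_)
open import Tactic.RingSolver using (solve-∀)
open import Tactic.RingSolver.Core.AlmostCommutativeRing using (AlmostCommutativeRing; fromCommutativeRing)


-- Rational numbers and finite sums

ℚ-ring : AlmostCommutativeRing _ _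
ℚ-ring = fromCommutativeRing ℚ.+-*-commutativeRing isZero?
  where
  isZero? : ∀ x → _
  isZero? x with 0ℚ ℚ.≟ x
  ... | yes p = just p
  ... | no _ = nothing

-- Identities modulo a relation u ≡ v are stated as l ≡ r + (u - v) * c and
-- closed with this lemma.
modulo : ∀ {u v} r c → u ≡ v → r + (u - v) * c ≡ r
modulo {u} r c refl = lemma r c u
  where
  lemma : ∀ r c u → r + (u - u) * c ≡ r
  lemma = solve-∀ ℚ-ring

modulo₂ : ∀ {u v u′ v′} r c c′ → u ≡ v → u′ ≡ v′ → r + (u - v) * c + (u′ - v′) * c′ ≡ r
modulo₂ {u} {v} r c c′ eq eq′ = trans (modulo (r + (u - v) * c) c′ eq′) (modulo r c eq)

*-zero-fst : ∀ {x} y → x ≡ 0ℚ → x * y ≡ 0ℚ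
*-zero-fst y refl = ℚ.*-zeroˡ y

*-zero-snd : ∀ x {y} → y ≡ 0ℚ → x * y ≡ 0ℚ
*-zero-snd x refl = ℚ.*-zeroʳ x

*-inv : ∀ {x} → x ≢ 0ℚ → x * inv x ≡ 1ℚ
*-inv {mkℚ (+ zero) _ _} x≢0 with () ← x≢0 (ℚ.↥p≡0⇒p≡0 _ refl)
*-inv {x@(mkℚ (+ suc _) _ _)} _ = ℚ.*-inverseʳ x
*-inv {x@(mkℚ -[1+ _ ] _ _)} _ = ℚ.*-inverseʳ x

*-cancelˡ : ∀ {x y z} → x ≢ 0ℚ → x * y ≡ x * z → y ≡ z
*-cancelˡ {x} {y} {z} x≢0 eq = begin
  y               ≡⟨ sym (lemma y) ⟩
  inv x * (x * y) ≡⟨ cong (inv x *_) eq ⟩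
  inv x * (x * z) ≡⟨ lemma z ⟩
  z               ∎
  where
  open ≡-Reasoning
  identity : ∀ x i y → i * (x * y) ≡ y + (x * i - 1ℚ) * y
  identity = solve-∀ ℚ-ring
  lemma : ∀ y → inv x * (x * y) ≡ y
  lemma y = trans (identity x (inv x) y) (modulo y y (*-inv x≢0))

*-≢0 : ∀ {x y} → x ≢ 0ℚ → y ≢ 0ℚ → x * y ≢ 0ℚ
*-≢0 {x} x≢0 y≢0 eq = y≢0 (*-cancelˡ x≢0 (trans eq (sym (ℚ.*-zeroʳ x))))

inv-unique : ∀ x y → x * y ≡ 1ℚ → inv x ≡ y
inv-unique x y eq = *-cancelˡ x≢0 (trans (*-inv x≢0) (sym eq))
  where
  x≢0 : x ≢ 0ℚ
  x≢0 refl with () ← trans (sym eq) (ℚ.*-zeroˡ y)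

inv-* : ∀ {x y} → x ≢ 0ℚ → y ≢ 0ℚ → inv (x * y) ≡ inv x * inv y
inv-* {x} {y} x≢0 y≢0 = inv-unique (x * y) (inv x * inv y) (trans (identity x y (inv x) (inv y))
  (trans (modulo _ _ (*-inv y≢0)) (modulo _ _ (*-inv x≢0))))
  where
  identity : ∀ x y i j → (x * y) * (i * j) ≡ 1ℚ + (x * i - 1ℚ) * 1ℚ + (y * j - 1ℚ) * (x * i)
  identity = solve-∀ ℚ-ring

pos⇒≢0 : ∀ {x} → 0ℚ ℚ.< x → x ≢ 0ℚ
pos⇒≢0 0<x eq = ℚ.<⇒≢ 0<x (sym eq)

*-pos : ∀ {x y} → 0ℚ ℚ.< x → 0ℚ ℚ.< y → 0ℚ ℚ.< x * y
*-pos {x} {y} 0<x 0<y =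
  ℚ.positive⁻¹ (x * y) {{ℚ.pos*pos⇒pos x {{positive 0<x}} y {{positive 0<y}}}}

+-pos : ∀ {x y} → 0ℚ ℚ.< x → 0ℚ ℚ.< y → 0ℚ ℚ.< x + y
+-pos 0<x 0<y = ℚ.+-mono-< 0<x 0<y

0<1 : 0ℚ ℚ.< 1ℚ
0<1 = ℚ.positive⁻¹ 1ℚ

inv-pos : ∀ {x} → 0ℚ ℚ.< x → 0ℚ ℚ.< inv x
inv-pos {mkℚ (+ suc _) _ _} _ = ℚ.positive⁻¹ _
inv-pos {mkℚ (+ zero) _ _} 0<x with () ← positive 0<x
inv-pos {mkℚ -[1+ _ ] _ _} 0<x with () ← positive 0<x

ℕ→ℚ-mono-< : ∀ {m n} → m ℕ.< n → ℕ→ℚ m ℚ.< ℕ→ℚ n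
ℕ→ℚ-mono-< {m} {n} m<n = ℚ.toℚᵘ-cancel-<
  (ℚᵘ.<-respˡ-≃ (ℚᵘ.≃-sym (ℚ.toℚᵘ-fromℚᵘ (ℚᵘ.mkℚᵘ (+ m) 0)))
  (ℚᵘ.<-respʳ-≃ (ℚᵘ.≃-sym (ℚ.toℚᵘ-fromℚᵘ (ℚᵘ.mkℚᵘ (+ n) 0)))
  (ℚᵘ.*<* (subst₂ ℤ._<_ (sym (ℤ.*-identityʳ (+ m))) (sym (ℤ.*-identityʳ (+ n))) (ℤ.+<+ m<n)))))

powQ-+ : ∀ x m n → powQ x (m ℕ.+ n) ≡ powQ x m * powQ x n
powQ-+ x zero n = sym (ℚ.*-identityˡ _)
powQ-+ x (suc m) n = trans (cong (x *_) (powQ-+ x m n)) (sym (ℚ.*-assoc x _ _))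

powQ-* : ∀ x y n → powQ (x * y) n ≡ powQ x n * powQ y n
powQ-* x y zero = refl
powQ-* x y (suc n) = trans (cong ((x * y) *_) (powQ-* x y n)) (identity x y (powQ x n) (powQ y n))
  where
  identity : ∀ x y a b → x * y * (a * b) ≡ x * a * (y * b)
  identity = solve-∀ ℚ-ring

powQ-1 : ∀ n → powQ 1ℚ n ≡ 1ℚ
powQ-1 zero = refl
powQ-1 (suc n) = trans (ℚ.*-identityˡ _) (powQ-1 n)

powQ-inverse : ∀ {x y} n → x * y ≡ 1ℚ → powQ x n * powQ y n ≡ 1ℚ
powQ-inverse {x} {y} n eq = trans (sym (powQ-* x y n)) (trans (cong (λ z → powQ z n) eq) (powQ-1 n))

powQ-pos : ∀ {x} n → 0ℚ ℚ.< x → 0ℚ ℚ.< powQ x n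
powQ-pos zero _ = 0<1
powQ-pos (suc n) 0<x = *-pos 0<x (powQ-pos n 0<x)

powQ>1 : ∀ {x} n → 1ℚ ℚ.< x → 1ℚ ℚ.< powQ x (suc n)
powQ>1 {x} zero 1<x = subst (1ℚ ℚ.<_) (sym (ℚ.*-identityʳ x)) 1<x
powQ>1 {x} (suc n) 1<x = ℚ.<-trans 1<x (subst (ℚ._< x * powQ x (suc n)) (ℚ.*-identityʳ x)
  (ℚ.*-monoʳ-<-pos x {{positive (ℚ.<-trans 0<1 1<x)}} (powQ>1 n 1<x)))

sumQ : ℕ → (ℕ → ℚ) → ℚ
sumQ zero f = 0ℚ
sumQ (suc n) f = sumQ n f + f n

sumQ-cong : ∀ n {f g} → (∀ k → k ℕ.< n → f k ≡ g k) → sumQ n f ≡ sumQ n g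
sumQ-cong zero eq = refl
sumQ-cong (suc n) eq =
  cong₂ _+_ (sumQ-cong n (λ k k<n → eq k (ℕ.m<n⇒m<1+n k<n))) (eq n ℕ.≤-refl)

sumQ-+ : ∀ n f g → sumQ n (λ k → f k + g k) ≡ sumQ n f + sumQ n g
sumQ-+ zero f g = refl
sumQ-+ (suc n) f g = trans (cong (_+ (f n + g n)) (sumQ-+ n f g)) (identity (sumQ n f) (sumQ n g) (f n) (g n))
  where
  identity : ∀ s t a b → s + t + (a + b) ≡ s + a + (t + b)
  identity = solve-∀ ℚ-ring

sumQ-*ˡ : ∀ n x f → sumQ n (λ k → x * f k) ≡ x * sumQ n f
sumQ-*ˡ zero x f = sym (ℚ.*-zeroʳ x)
sumQ-*ˡ (suc n) x f = trans (cong (_+ x * f n) (sumQ-*ˡ n x f)) (sym (ℚ.*-distribˡ-+ x _ _))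

sumQ-linear₃ : ∀ n a f b g c h →
  sumQ n (λ k → a * f k + b * g k + c * h k) ≡ a * sumQ n f + b * sumQ n g + c * sumQ n h
sumQ-linear₃ n a f b g c h = trans (sumQ-+ n (λ k → a * f k + b * g k) (λ k → c * h k))
  (cong₂ _+_
    (trans (sumQ-+ n (λ k → a * f k) (λ k → b * g k)) (cong₂ _+_ (sumQ-*ˡ n a f) (sumQ-*ˡ n b g)))
    (sumQ-*ˡ n c h))

sumQ-zero : ∀ n {f} → (∀ k → k ℕ.< n → f k ≡ 0ℚ) → sumQ n f ≡ 0ℚ
sumQ-zero zero _ = refl
sumQ-zero (suc n) eq =
  cong₂ _+_ (sumQ-zero n (λ k k<n → eq k (ℕ.m<n⇒m<1+n k<n))) (eq n ℕ.≤-refl)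

sumQ-swap : ∀ m n (f : ℕ → ℕ → ℚ) → sumQ m (λ i → sumQ n (f i)) ≡ sumQ n (λ j → sumQ m (λ i → f i j))
sumQ-swap zero n f = sym (sumQ-zero n (λ _ _ → refl))
sumQ-swap (suc m) n f = trans (cong (_+ sumQ n (f m)) (sumQ-swap m n f)) (sym (sumQ-+ n _ _))

sumQ-telescope : ∀ n (f g : ℕ → ℚ) → (∀ k → k ℕ.< n → f k ≡ g (suc k) - g k) → sumQ n f ≡ g n - g 0
sumQ-telescope zero f g _ = sym (ℚ.+-inverseʳ (g 0))
sumQ-telescope (suc n) f g eq =
  trans (cong₂ _+_ (sumQ-telescope n f g (λ k k<n → eq k (ℕ.m<n⇒m<1+n k<n))) (eq n ℕ.≤-refl))
    (identity (g n) (g 0) (g (suc n)))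
  where
  identity : ∀ a b c → a - b + (c - a) ≡ c - b
  identity = solve-∀ ℚ-ring

sumQ-truncate : ∀ m n {f} → (∀ k → m ℕ.≤ k → f k ≡ 0ℚ) → m ℕ.≤ n → sumQ n f ≡ sumQ m f
sumQ-truncate m n {f} zeros m≤n = go n m≤n
  where
  go : ∀ n → m ℕ.≤ n → sumQ n f ≡ sumQ m f
  go n m≤n with ℕ.m≤n⇒m<n∨m≡n m≤n
  go n m≤n | inj₂ refl = refl
  go (suc n) _ | inj₁ (ℕ.s≤s m≤n) =
    trans (cong₂ _+_ (go n m≤n) (zeros n m≤n)) (ℚ.+-identityʳ _)

sumQ-head : ∀ n f → sumQ (suc n) f ≡ f 0 + sumQ n (λ k → f (suc k))
sumQ-head zero f = ℚ.+-comm 0ℚ (f 0)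
sumQ-head (suc n) f = trans (cong (_+ f (suc n)) (sumQ-head n f)) (ℚ.+-assoc (f 0) _ _)

δℕ-refl : ∀ i → δℕ i i ≡ 1ℚ
δℕ-refl zero = refl
δℕ-refl (suc i) = δℕ-refl i

δℕ-≢ : ∀ i j → i ≢ j → δℕ i j ≡ 0ℚ
δℕ-≢ zero zero i≢j with () ← i≢j refl
δℕ-≢ zero (suc j) _ = refl
δℕ-≢ (suc i) zero _ = refl
δℕ-≢ (suc i) (suc j) i≢j = δℕ-≢ i j (λ eq → i≢j (cong suc eq))

-- Orthogonality of the dual q-Krawtchouk polynomials

module Krawtchouk (q D : ℕ) (E : ℚ) (1<q : 1 ℕ.< q) where

  open Dual q D E using (pochQ) renaming (qQ to Q)

  p : ℚ
  p = inv Q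

  1<Q : 1ℚ ℚ.< Q
  1<Q = ℕ→ℚ-mono-< 1<q

  0<Q : 0ℚ ℚ.< Q
  0<Q = ℚ.<-trans 0<1 1<Q

  0<p : 0ℚ ℚ.< p
  0<p = inv-pos 0<Q

  Q*p : Q * p ≡ 1ℚ
  Q*p = *-inv (pos⇒≢0 0<Q)

  Qⁿ*pⁿ : ∀ n → powQ Q n * powQ p n ≡ 1ℚ
  Qⁿ*pⁿ n = powQ-inverse n Q*p

  -- The complement l of n in m occurs throughout as p^m q^n = p^l.
  p^m*Qⁿ : ∀ {m} l n → n ℕ.+ l ≡ m → powQ p m * powQ Q n ≡ powQ p l
  p^m*Qⁿ l n refl = trans (cong (_* powQ Q n) (powQ-+ p n l))
    (trans (identity (powQ p n) (powQ p l) (powQ Q n)) (modulo _ _ (Qⁿ*pⁿ n)))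
    where
    identity : ∀ a b c → a * b * c ≡ b + (c * a - 1ℚ) * b
    identity = solve-∀ ℚ-ring

  1-Qⁿ≢0 : ∀ n → 1ℚ - powQ Q (suc n) ≢ 0ℚ
  1-Qⁿ≢0 n eq = ℚ.<⇒≢ (powQ>1 n 1<Q) (sym (trans (identity (powQ Q (suc n))) (cong (λ z → 1ℚ - z) eq)))
    where
    identity : ∀ x → x ≡ 1ℚ - (1ℚ - x)
    identity = solve-∀ ℚ-ring

  1-pⁿ≢0 : ∀ n → 1ℚ - powQ p (suc n) ≢ 0ℚ
  1-pⁿ≢0 n eq = 1-Qⁿ≢0 n (trans (identity (powQ p (suc n)) (powQ Q (suc n)))
    (trans (modulo _ _ (Qⁿ*pⁿ (suc n))) (trans (cong (λ z → - (z * powQ Q (suc n))) eq)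
      (cong -_ (ℚ.*-zeroˡ (powQ Q (suc n)))))))
    where
    identity : ∀ x y → 1ℚ - y ≡ - ((1ℚ - x) * y) + (y * x - 1ℚ) * - 1ℚ
    identity = solve-∀ ℚ-ring

  pochQ-shift : ∀ a n → pochQ a (suc n) ≡ (1ℚ - a) * pochQ (a * Q) n
  pochQ-shift a zero = identity a
    where
    identity : ∀ a → 1ℚ * (1ℚ - a * 1ℚ) ≡ (1ℚ - a) * 1ℚ
    identity = solve-∀ ℚ-ring
  pochQ-shift a (suc n) = trans (cong (_* (1ℚ - a * powQ Q (suc n))) (pochQ-shift a n))
    (identity a Q (powQ Q n) (pochQ (a * Q) n))
    where
    identity : ∀ a q y z → (1ℚ - a) * z * (1ℚ - a * (q * y)) ≡ (1ℚ - a) * (z * (1ℚ - a * q * y))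
    identity = solve-∀ ℚ-ring

  pochQ-p : ∀ a n → pochQ (p * a) (suc n) ≡ (1ℚ - p * a) * pochQ a n
  pochQ-p a n = trans (pochQ-shift (p * a) n) (cong (λ z → (1ℚ - p * a) * pochQ z n)
    (trans (identity p a Q) (modulo a a Q*p)))
    where
    identity : ∀ p a q → p * a * q ≡ a + (q * p - 1ℚ) * a
    identity = solve-∀ ℚ-ring

  pochQ-pred : ∀ i n → (1ℚ - powQ p i) * pochQ (powQ p (ℕ.pred i)) n
                     ≡ pochQ (powQ p i) n * (1ℚ - powQ p i * powQ Q n)
  pochQ-pred zero n = trans (ℚ.*-zeroˡ (pochQ 1ℚ n)) (sym (trans (pochQ-shift 1ℚ n) (ℚ.*-zeroˡ (pochQ (1ℚ * Q) n))))
  pochQ-pred (suc i) n = sym (pochQ-p (powQ p i) n)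

  pochQ-vanish : ∀ k n → k ℕ.< n → pochQ (powQ p k) n ≡ 0ℚ
  pochQ-vanish zero (suc n) _ = trans (pochQ-shift 1ℚ n) (ℚ.*-zeroˡ (pochQ (1ℚ * Q) n))
  pochQ-vanish (suc k) (suc n) (ℕ.s≤s k<n) =
    trans (pochQ-p (powQ p k) n) (*-zero-snd (1ℚ - powQ p (suc k)) (pochQ-vanish k n k<n))

  pochQ-≢0 : ∀ {d} n → n ℕ.≤ d → pochQ (powQ p d) n ≢ 0ℚ
  pochQ-≢0 zero _ = λ ()
  pochQ-≢0 {suc d} (suc n) (ℕ.s≤s n≤d) eq =
    *-≢0 (1-pⁿ≢0 d) (pochQ-≢0 n n≤d) (trans (sym (pochQ-p (powQ p d) n)) eq)

  pochQ-Q≢0 : ∀ n → pochQ Q n ≢ 0ℚ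
  pochQ-Q≢0 zero = λ ()
  pochQ-Q≢0 (suc n) = *-≢0 (pochQ-Q≢0 n) (1-Qⁿ≢0 n)

  pochQ-neg-pos : ∀ a n → 0ℚ ℚ.< a → 0ℚ ℚ.< pochQ (- a) n
  pochQ-neg-pos a zero _ = 0<1
  pochQ-neg-pos a (suc n) 0<a = *-pos (pochQ-neg-pos a n 0<a)
    (subst (0ℚ ℚ.<_) (identity a (powQ Q n)) (+-pos 0<1 (*-pos 0<a (powQ-pos n 0<Q))))
    where
    identity : ∀ a y → 1ℚ + a * y ≡ 1ℚ - - a * y
    identity = solve-∀ ℚ-ring

  -- Dual q-Krawtchouk polynomials: in the notation of basic hypergeometric
  -- series, K i k j = ₃φ₂(q⁻ⁱ, q⁻ᵏ, c q⁻ʲ; q⁻ᵈ, 0; q, q) at the point k of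
  -- {0,…,d}, whose complement d - k is passed as j to avoid subtraction.
  module _ (c : ℚ) (d : ℕ) where

    basis : ℕ → ℕ → ℕ → ℚ
    basis n k j = pochQ (powQ p k) n * pochQ (c * powQ p j) n

    coeff : ℕ → ℕ → ℚ
    coeff i n = pochQ (powQ p i) n * (inv (pochQ (powQ p d) n * pochQ Q n) * powQ Q n)

    K : ℕ → ℕ → ℕ → ℚ
    K i k j = sumQ (suc d) (λ n → coeff i n * basis n k j)

    private
      P : ℚ
      P = powQ p d

      weight : ℕ → ℚ
      weight n = inv (pochQ P n * pochQ Q n) * powQ Q n

    weight-suc : ∀ n → n ℕ.< d →
      weight n ≡ p * ((1ℚ - P * powQ Q n) * (1ℚ - Q * powQ Q n)) * weight (suc n)
    weight-suc n n<d = *-cancelˡ (*-≢0 (pochQ-≢0 (suc n) n<d) (pochQ-Q≢0 (suc n)))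
      (trans (identity₁ (pochQ P n) (pochQ Q n) (1ℚ - P * powQ Q n) (1ℚ - Q * powQ Q n)
               (inv (pochQ P n * pochQ Q n)) (powQ Q n))
        (trans (modulo (u * powQ Q n) (u * powQ Q n) (*-inv (*-≢0 (pochQ-≢0 n (ℕ.<⇒≤ n<d)) (pochQ-Q≢0 n))))
          (sym (trans (identity₂ (pochQ P (suc n)) (pochQ Q (suc n))
                         u
                         (inv (pochQ P (suc n) * pochQ Q (suc n))) (powQ Q n) p Q)
            (trans (modulo (u * powQ Q n + (Q * p - 1ℚ) * (u * powQ Q n)) (p * Q * u * powQ Q n) (*-inv (*-≢0 (pochQ-≢0 (suc n) n<d) (pochQ-Q≢0 (suc n)))))
              (modulo (u * powQ Q n) (u * powQ Q n) Q*p))))))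
      where
      u : ℚ
      u = (1ℚ - P * powQ Q n) * (1ℚ - Q * powQ Q n)
      identity₁ : ∀ x y u v i z → x * u * (y * v) * (i * z) ≡
        u * v * z + (x * y * i - 1ℚ) * (u * v * z)
      identity₁ = solve-∀ ℚ-ring
      identity₂ : ∀ x y w i z p q → x * y * (p * w * (i * (q * z))) ≡
        w * z + (q * p - 1ℚ) * (w * z) + (x * y * i - 1ℚ) * (p * q * w * z)
      identity₂ = solve-∀ ℚ-ring

    coeff-recurrence : ∀ i l m → i ℕ.+ l ≡ d → m ℕ.< d →
      coeff i (suc m) * (powQ p (suc m) + c * (Q * powQ Q m) * P) - powQ p m * coeff i m
      ≡ (1ℚ - powQ p l) * coeff (suc i) (suc m) + (c + 1ℚ) * powQ p l * coeff i (suc m)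
        + c * (P - powQ p l) * coeff (ℕ.pred i) (suc m)
    coeff-recurrence i l m i+l≡d m<d = begin
      coeff i (suc m) * (powQ p (suc m) + c * (Q * Y) * P) - Y′ * (N * weight m)
        ≡⟨ cong₂ (λ v z → N * (1ℚ - a * Y) * w * (p * Y′ + c * (Q * Y) * z) - Y′ * (N * v))
             (trans (weight-suc m m<d) (cong (λ z → p * ((1ℚ - z * Y) * (1ℚ - Q * Y)) * w) P≡)) P≡ ⟩
      N * (1ℚ - a * Y) * w * (p * Y′ + c * (Q * Y) * (a * L))
        - Y′ * (N * (p * ((1ℚ - a * L * Y) * (1ℚ - Q * Y)) * w))
        ≡⟨ identity N w a L Y Y′ p Q c ⟩
      r + (Q * p - 1ℚ) * c₁ + (Y * Y′ - 1ℚ) * c₂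
        ≡⟨ trans (modulo (r + (Q * p - 1ℚ) * c₁) c₂ (Qⁿ*pⁿ m)) (modulo r c₁ Q*p) ⟩
      r
        ≡⟨ sym (cong₂ (λ x y → (1ℚ - L) * (x * w) + (c + 1ℚ) * L * (N * (1ℚ - a * Y) * w) + y)
             (pochQ-p a m) last) ⟩
      (1ℚ - L) * coeff (suc i) (suc m) + (c + 1ℚ) * L * coeff i (suc m)
        + c * (P - L) * coeff (ℕ.pred i) (suc m) ∎
      where
      open ≡-Reasoning
      a L Y Y′ N w r c₁ c₂ : ℚ
      a = powQ p i
      L = powQ p l
      Y = powQ Q m
      Y′ = powQ p m
      N = pochQ a m
      w = weight (suc m)
      r = (1ℚ - L) * ((1ℚ - p * a) * N * w) + (c + 1ℚ) * L * (N * (1ℚ - a * Y) * w)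
            + - (c * L * w * (N * (1ℚ - a * Y) * (1ℚ - a * (Q * Y))))
      c₁ = N * w * (1ℚ - a * L * Y)
      c₂ = N * w * (p * a * L - p * a + Q * p * (1ℚ - a * L * Y))
      P≡ : P ≡ a * L
      P≡ = trans (cong (powQ p) (sym i+l≡d)) (powQ-+ p i l)
      last : c * (P - L) * coeff (ℕ.pred i) (suc m)
           ≡ - (c * L * w * (N * (1ℚ - a * Y) * (1ℚ - a * (Q * Y))))
      last = trans (cong (λ z → c * (z - L) * coeff (ℕ.pred i) (suc m)) P≡)
        (trans (reorder c a L (pochQ (powQ p (ℕ.pred i)) (suc m)) w)
          (cong (λ z → - (c * L * w * z)) (pochQ-pred i (suc m))))
        where
        reorder : ∀ c a L x w → c * (a * L - L) * (x * w) ≡ - (c * L * w * ((1ℚ - a) * x))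
        reorder = solve-∀ ℚ-ring
      identity : ∀ N w a L Y Y′ p q c →
        N * (1ℚ - a * Y) * w * (p * Y′ + c * (q * Y) * (a * L))
          - Y′ * (N * (p * ((1ℚ - a * L * Y) * (1ℚ - q * Y)) * w))
        ≡ (1ℚ - L) * ((1ℚ - p * a) * N * w) + (c + 1ℚ) * L * (N * (1ℚ - a * Y) * w)
            + - (c * L * w * (N * (1ℚ - a * Y) * (1ℚ - a * (q * Y))))
          + (q * p - 1ℚ) * (N * w * (1ℚ - a * L * Y))
          + (Y * Y′ - 1ℚ) * (N * w * (p * a * L - p * a + q * p * (1ℚ - a * L * Y)))
      identity = solve-∀ ℚ-ring

  module _ (c : ℚ) (d : ℕ) where
    private
      P : ℚ
      P = powQ p d

    K-recurrence : ∀ i l k j → i ℕ.+ l ≡ d → k ℕ.+ j ≡ d →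
      (powQ p k + c * powQ p j) * K c d i k j ≡
      (1ℚ - powQ p l) * K c d (suc i) k j + (c + 1ℚ) * powQ p l * K c d i k j
        + c * (P - powQ p l) * K c d (ℕ.pred i) k j
    K-recurrence i l k j i+l≡d k+j≡d = begin
      θ * K c d i k j
        ≡⟨ sym (sumQ-*ˡ (suc d) θ (term i)) ⟩
      sumQ (suc d) (λ n → θ * term i n)
        ≡⟨ sumQ-cong (suc d) {λ n → θ * term i n} {λ n → rhs n + (g (suc n) - g n)} step ⟩
      sumQ (suc d) (λ n → rhs n + (g (suc n) - g n))
        ≡⟨ sumQ-+ (suc d) rhs (λ n → g (suc n) - g n) ⟩
      sumQ (suc d) rhs + sumQ (suc d) (λ n → g (suc n) - g n)
        ≡⟨ cong₂ _+_ sum-rhs (trans (sumQ-telescope (suc d) (λ n → g (suc n) - g n) g (λ _ _ → refl)) g-end) ⟩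
      (b * K c d (suc i) k j + a * K c d i k j + e * K c d (ℕ.pred i) k j) + 0ℚ
        ≡⟨ ℚ.+-identityʳ (b * K c d (suc i) k j + a * K c d i k j + e * K c d (ℕ.pred i) k j) ⟩
      b * K c d (suc i) k j + a * K c d i k j + e * K c d (ℕ.pred i) k j ∎
      where
      open ≡-Reasoning
      x y L θ b a e : ℚ
      x = powQ p k
      y = powQ p j
      L = powQ p l
      θ = x + c * y
      b = 1ℚ - L
      a = (c + 1ℚ) * L
      e = c * (P - L)
      B : ℕ → ℚ
      B n = basis c d n k j
      term : ℕ → ℕ → ℚ
      term i n = coeff c d i n * B n
      rhs g : ℕ → ℚ
      rhs n = b * term (suc i) n + a * term i n + e * term (ℕ.pred i) n
      g zero = 0ℚ
      g (suc n) = - (powQ p n * coeff c d i n * B (suc n))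
      P≡ : P ≡ x * y
      P≡ = trans (cong (powQ p) (sym k+j≡d)) (powQ-+ p k j)
      identity₀ : ∀ c x y L → (x + c * y) * 1ℚ ≡
        ((1ℚ - L) * 1ℚ + (c + 1ℚ) * L * 1ℚ + c * (x * y - L) * 1ℚ)
          + (- (1ℚ * 1ℚ * ((1ℚ * (1ℚ - x * 1ℚ)) * (1ℚ * (1ℚ - c * y * 1ℚ)))) - 0ℚ)
      identity₀ = solve-∀ ℚ-ring
      identity : ∀ c x y b a e A A⁺ A⁻ A₀ X Z Y Y′ Y₀′ →
        (x + c * y) * (A * (X * Z)) ≡
          (b * (A⁺ * (X * Z)) + a * (A * (X * Z)) + e * (A⁻ * (X * Z)))
          + (- (Y′ * A * (X * (1ℚ - x * Y) * (Z * (1ℚ - c * y * Y)))) - - (Y₀′ * A₀ * (X * Z)))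
          + (Y * Y′ - 1ℚ) * (A * (X * Z) * (c * (x * y) * Y - (x + c * y)))
          + ((A * (Y′ + c * Y * (x * y)) - Y₀′ * A₀) - (b * A⁺ + a * A + e * A⁻)) * (X * Z)
      identity = solve-∀ ℚ-ring
      step : ∀ n → n ℕ.< suc d → θ * term i n ≡ rhs n + (g (suc n) - g n)
      step zero _ = trans (identity₀ c x y L)
        (cong (λ z → (b * 1ℚ + a * 1ℚ + c * (z - L) * 1ℚ) + (g 1 - 0ℚ)) (sym P≡))
      step (suc m) (ℕ.s≤s m<d) = trans
        (identity c x y b a e (coeff c d i (suc m)) (coeff c d (suc i) (suc m)) (coeff c d (ℕ.pred i) (suc m))
          (coeff c d i m) (pochQ x (suc m)) (pochQ (c * y) (suc m)) (powQ Q (suc m)) (powQ p (suc m)) (powQ p m))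
        (modulo₂ (rhs (suc m) + (g (suc (suc m)) - g (suc m))) cof (B (suc m)) (Qⁿ*pⁿ (suc m))
          (trans (cong (λ z → coeff c d i (suc m) * (powQ p (suc m) + c * powQ Q (suc m) * z) - powQ p m * coeff c d i m)
            (sym P≡)) (coeff-recurrence c d i l m i+l≡d m<d)))
        where
        cof : ℚ
        cof = coeff c d i (suc m) * B (suc m) * (c * (x * y) * powQ Q (suc m) - (x + c * y))
      g-end : g (suc d) - g 0 ≡ 0ℚ
      g-end = cong (λ z → - z - 0ℚ) (*-zero-snd (powQ p d * coeff c d i d)
        (*-zero-fst (pochQ (c * y) (suc d)) (pochQ-vanish k (suc d)
          (ℕ.s≤s (subst (k ℕ.≤_) k+j≡d (ℕ.m≤m+n k j))))))
      sum-rhs : sumQ (suc d) rhs ≡ b * K c d (suc i) k j + a * K c d i k j + e * K c d (ℕ.pred i) k j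
      sum-rhs = sumQ-linear₃ (suc d) b (term (suc i)) a (term i) e (term (ℕ.pred i))

    module Orthogonality
      (ω : ℕ → ℚ)
      (ω-recurrence : ∀ k j → k ℕ.+ suc j ≡ d →
        ω (suc k) * (c * (powQ p j * powQ p j) * (powQ p (suc k) - c) * (1ℚ - powQ p (suc k))) ≡
        - (ω k * (powQ p k * powQ p k * (1ℚ - powQ p (suc j)) * (1ℚ - c * powQ p (suc j)))))
      where

      W : ℕ → ℕ → ℚ
      W k j = (powQ p k - c * powQ p j) * ω k

      pairing : (f g : ℕ → ℕ → ℚ) → ℚ
      pairing f g = sumQ (suc d) (λ k → W k (d ℕ.∸ k) * (f k (d ℕ.∸ k) * g k (d ℕ.∸ k)))

      moment : ℕ → ℚ
      moment m = sumQ (suc d) (λ k → W k (d ℕ.∸ k) * basis c d m k (d ℕ.∸ k))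

      private
        G : ℕ → ℕ → ℕ → ℚ
        G m k j = powQ Q m * ω k * (c * (powQ p j * powQ p j) * (powQ p k - c))
                  * ((1ℚ - powQ p k * powQ Q m) * basis c d m k j)

        moment-step : ∀ m k j → k ℕ.+ suc j ≡ d →
          W k (suc j) * basis c d (suc m) k (suc j) ≡
          (1ℚ - P * powQ Q m) * (W k (suc j) * basis c d m k (suc j)) + (G m (suc k) j - G m k (suc j))
        moment-step m k j k+j≡d = trans (identity c (powQ p k) (powQ p (suc j)) (powQ Q m) (ω k) (pochQ (powQ p k) m) (pochQ (c * powQ p (suc j)) m))
          (cong₂ (λ P g → (1ℚ - P * powQ Q m) * (W k (suc j) * basis c d m k (suc j)) + (g - G m k (suc j)))
             (sym (trans (cong (powQ p) (sym k+j≡d)) (powQ-+ p k (suc j)))) (sym G-suc))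
          where
          open ≡-Reasoning
          x x′ y y′ Y X X′ Z Z′ : ℚ
          x = powQ p k
          x′ = powQ p (suc k)
          y = powQ p (suc j)
          y′ = powQ p j
          Y = powQ Q m
          X = pochQ x m
          X′ = pochQ x′ m
          Z = pochQ (c * y) m
          Z′ = pochQ (c * y′) m
          Z-shift : Z * (1ℚ - c * y * Y) ≡ (1ℚ - c * y) * Z′
          Z-shift = subst (λ z → pochQ z (suc m) ≡ (1ℚ - z) * Z′) (swap p c y′) (pochQ-p (c * y′) m)
            where
            swap : ∀ p c y → p * (c * y) ≡ c * (p * y)
            swap = solve-∀ ℚ-ring
          regroup₁ : ∀ Y ω c y x Y′ X Z → Y * ω * (c * (y * y) * (x - c)) * ((1ℚ - x * Y′) * (X * Z)) ≡
            Y * Z * (ω * (c * (y * y) * (x - c))) * (X * (1ℚ - x * Y′))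
          regroup₁ = solve-∀ ℚ-ring
          regroup₂ : ∀ Y Z t u X → Y * Z * t * (u * X) ≡ Y * X * Z * (t * u)
          regroup₂ = solve-∀ ℚ-ring
          regroup₃ : ∀ ω c y x → ω * (c * (y * y) * (x - c)) * (1ℚ - x) ≡ ω * (c * (y * y) * (x - c) * (1ℚ - x))
          regroup₃ = solve-∀ ℚ-ring
          regroup₄ : ∀ Y X Z ω x y c → Y * X * Z * - (ω * (x * x * (1ℚ - y) * (1ℚ - c * y))) ≡
            - (Y * ω * (x * x * (1ℚ - y)) * X * ((1ℚ - c * y) * Z))
          regroup₄ = solve-∀ ℚ-ring
          G-suc : G m (suc k) j ≡ - (Y * ω k * (x * x * (1ℚ - y)) * X * (Z * (1ℚ - c * y * Y)))
          G-suc = begin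
            G m (suc k) j
              ≡⟨ regroup₁ Y (ω (suc k)) c y′ x′ Y X′ Z′ ⟩
            Y * Z′ * (ω (suc k) * (c * (y′ * y′) * (x′ - c))) * (X′ * (1ℚ - x′ * Y))
              ≡⟨ cong (Y * Z′ * (ω (suc k) * (c * (y′ * y′) * (x′ - c))) *_) (pochQ-p x m) ⟩
            Y * Z′ * (ω (suc k) * (c * (y′ * y′) * (x′ - c))) * ((1ℚ - x′) * X)
              ≡⟨ regroup₂ Y Z′ (ω (suc k) * (c * (y′ * y′) * (x′ - c))) (1ℚ - x′) X ⟩
            Y * X * Z′ * (ω (suc k) * (c * (y′ * y′) * (x′ - c)) * (1ℚ - x′))
              ≡⟨ cong (Y * X * Z′ *_) (trans (regroup₃ (ω (suc k)) c y′ x′) (ω-recurrence k j k+j≡d)) ⟩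
            Y * X * Z′ * - (ω k * (x * x * (1ℚ - y) * (1ℚ - c * y)))
              ≡⟨ regroup₄ Y X Z′ (ω k) x y c ⟩
            - (Y * ω k * (x * x * (1ℚ - y)) * X * ((1ℚ - c * y) * Z′))
              ≡⟨ cong (λ z → - (Y * ω k * (x * x * (1ℚ - y)) * X * z)) (sym Z-shift) ⟩
            - (Y * ω k * (x * x * (1ℚ - y)) * X * (Z * (1ℚ - c * y * Y))) ∎
          identity : ∀ c x y Y ω X Z →
            (x - c * y) * ω * (X * (1ℚ - x * Y) * (Z * (1ℚ - c * y * Y))) ≡
            (1ℚ - x * y * Y) * ((x - c * y) * ω * (X * Z))
              + (- (Y * ω * (x * x * (1ℚ - y)) * X * (Z * (1ℚ - c * y * Y)))
                 - Y * ω * (c * (y * y) * (x - c)) * ((1ℚ - x * Y) * (X * Z)))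
          identity = solve-∀ ℚ-ring

        moment-last : ∀ m →
          W d 0 * basis c d (suc m) d 0 ≡
          (1ℚ - P * powQ Q m) * (W d 0 * basis c d m d 0) + - G m d 0
        moment-last m = identity c P (powQ Q m) (ω d) (pochQ P m) (pochQ (c * 1ℚ) m)
          where
          identity : ∀ c x Y ω X Z →
            (x - c * 1ℚ) * ω * (X * (1ℚ - x * Y) * (Z * (1ℚ - c * 1ℚ * Y))) ≡
            (1ℚ - x * Y) * ((x - c * 1ℚ) * ω * (X * Z))
              + - (Y * ω * (c * (1ℚ * 1ℚ) * (x - c)) * ((1ℚ - x * Y) * (X * Z)))
          identity = solve-∀ ℚ-ring

      complement : ∀ {k} → k ℕ.< d → d ℕ.∸ k ≡ suc (d ℕ.∸ suc k)
      complement {k} k<d = ℕ.+-∸-assoc 1 k<d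

      moment-suc : ∀ m → moment (suc m) ≡ (1ℚ - P * powQ Q m) * moment m
      moment-suc m = begin
        sumQ d t′ + t′ d
          ≡⟨ cong₂ _+_ (sumQ-cong d {t′} {λ k → u * t k + (g (suc k) - g k)} step)
               (subst (λ j → W d j * basis c d (suc m) d j ≡ u * (W d j * basis c d m d j) + - G m d j)
                 (sym (ℕ.n∸n≡0 d)) (moment-last m)) ⟩
        sumQ d (λ k → u * t k + (g (suc k) - g k)) + (u * t d + - g d)
          ≡⟨ cong (_+ (u * t d + - g d)) (trans (sumQ-+ d (λ k → u * t k) (λ k → g (suc k) - g k))
               (cong₂ _+_ (sumQ-*ˡ d u t) (sumQ-telescope d (λ k → g (suc k) - g k) g (λ _ _ → refl)))) ⟩
        (u * sumQ d t + (g d - g 0)) + (u * t d + - g d)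
          ≡⟨ cong (λ z → (u * sumQ d t + (g d - z)) + (u * t d + - g d)) g-start ⟩
        (u * sumQ d t + (g d - 0ℚ)) + (u * t d + - g d)
          ≡⟨ identity u (sumQ d t) (g d) (t d) ⟩
        u * (sumQ d t + t d) ∎
        where
        open ≡-Reasoning
        u : ℚ
        u = 1ℚ - P * powQ Q m
        t t′ g : ℕ → ℚ
        t k = W k (d ℕ.∸ k) * basis c d m k (d ℕ.∸ k)
        t′ k = W k (d ℕ.∸ k) * basis c d (suc m) k (d ℕ.∸ k)
        g k = G m k (d ℕ.∸ k)
        step : ∀ k → k ℕ.< d → t′ k ≡ u * t k + (g (suc k) - g k)
        step k k<d = subst (λ j → W k j * basis c d (suc m) k j ≡
            u * (W k j * basis c d m k j) + (g (suc k) - G m k j)) (sym (complement k<d))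
          (moment-step m k (d ℕ.∸ suc k) (trans (ℕ.+-suc k _) (ℕ.m+[n∸m]≡n k<d)))
        g-start : g 0 ≡ 0ℚ
        g-start = *-zero-snd (powQ Q m * ω 0 * (c * (powQ p d * powQ p d) * (1ℚ - c)))
          (trans (regroup (powQ Q m) (pochQ 1ℚ m) (pochQ (c * powQ p d) m))
            (*-zero-fst (pochQ (c * powQ p d) m) (pochQ-vanish 0 (suc m) (ℕ.s≤s ℕ.z≤n))))
          where
          regroup : ∀ Y X Z → (1ℚ - 1ℚ * Y) * (X * Z) ≡ X * (1ℚ - 1ℚ * Y) * Z
          regroup = solve-∀ ℚ-ring
        identity : ∀ u s g t → (u * s + (g - 0ℚ)) + (u * t + - g) ≡ u * (s + t)
        identity = solve-∀ ℚ-ring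

      total : ℚ
      total = W d 0 * pochQ c d

      moment-total : ∀ m → moment m ≡ pochQ P m * moment 0
      moment-total zero = sym (ℚ.*-identityˡ (moment 0))
      moment-total (suc m) = trans (moment-suc m) (trans (cong ((1ℚ - P * powQ Q m) *_) (moment-total m))
        (regroup (1ℚ - P * powQ Q m) (pochQ P m) (moment 0)))
        where
        regroup : ∀ u x y → u * (x * y) ≡ x * u * y
        regroup = solve-∀ ℚ-ring

      -- Only the point k = d contributes to the d-th moment.
      moment₀ : moment 0 ≡ total
      moment₀ = *-cancelˡ (pochQ-≢0 d ℕ.≤-refl) (trans (sym (moment-total d)) (begin
        sumQ d t + t d
          ≡⟨ cong₂ _+_ (sumQ-zero d {t} (λ k k<d → *-zero-snd (W k (d ℕ.∸ k))
               (*-zero-fst (pochQ (c * powQ p (d ℕ.∸ k)) d) (pochQ-vanish k d k<d))))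
             (cong (λ j → W d j * basis c d d d j) (ℕ.n∸n≡0 d)) ⟩
        0ℚ + W d 0 * (pochQ P d * pochQ (c * 1ℚ) d)
          ≡⟨ cong (λ z → 0ℚ + W d 0 * (pochQ P d * pochQ z d)) (ℚ.*-identityʳ c) ⟩
        0ℚ + W d 0 * (pochQ P d * pochQ c d)
          ≡⟨ regroup (W d 0) (pochQ P d) (pochQ c d) ⟩
        pochQ P d * (W d 0 * pochQ c d) ∎))
        where
        open ≡-Reasoning
        t : ℕ → ℚ
        t k = W k (d ℕ.∸ k) * basis c d d k (d ℕ.∸ k)
        regroup : ∀ w x y → 0ℚ + w * (x * y) ≡ x * (w * y)
        regroup = solve-∀ ℚ-ring

      private
        summand : (f g : ℕ → ℕ → ℚ) → ℕ → ℚ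
        summand f g k = W k (d ℕ.∸ k) * (f k (d ℕ.∸ k) * g k (d ℕ.∸ k))

      S : ℕ → ℕ → ℚ
      S i j = pairing (K c d i) (K c d j)

      S-comm : ∀ i j → S i j ≡ S j i
      S-comm i j = sumQ-cong (suc d) {summand (K c d i) (K c d j)} {summand (K c d j) (K c d i)} (λ k _ → cong (W k (d ℕ.∸ k) *_)
        (ℚ.*-comm (K c d i k (d ℕ.∸ k)) (K c d j k (d ℕ.∸ k))))

      private
        up mid down : ℕ → ℚ
        up l = 1ℚ - powQ p l
        mid l = (c + 1ℚ) * powQ p l
        down l = c * (P - powQ p l)

      -- Multiplication by p^k + c p^j is symmetric for the pairing.
      S-recurrence : ∀ i l j l′ → i ℕ.+ l ≡ d → j ℕ.+ l′ ≡ d →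
        up l * S (suc i) j + mid l * S i j + down l * S (ℕ.pred i) j ≡
        up l′ * S i (suc j) + mid l′ * S i j + down l′ * S i (ℕ.pred j)
      S-recurrence i l j l′ i+l≡d j+l′≡d = trans (sym (expand i l j i+l≡d)) (trans
        (sumQ-cong (suc d) {summand (θK i) (K c d j)} {summand (θK j) (K c d i)} (λ k _ → swap (W k (d ℕ.∸ k)) (powQ p k + c * powQ p (d ℕ.∸ k))
          (K c d i k (d ℕ.∸ k)) (K c d j k (d ℕ.∸ k))))
        (trans (expand j l′ i j+l′≡d)
          (cong₂ _+_ (cong₂ _+_ (cong (up l′ *_) (S-comm (suc j) i)) (cong (mid l′ *_) (S-comm j i)))
            (cong (down l′ *_) (S-comm (ℕ.pred j) i)))))
        where
        θK : ℕ → ℕ → ℕ → ℚ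
        θK i k j = (powQ p k + c * powQ p j) * K c d i k j
        swap : ∀ w θ x y → w * (θ * x * y) ≡ w * (θ * y * x)
        swap = solve-∀ ℚ-ring
        expand : ∀ i l j → i ℕ.+ l ≡ d →
          pairing (θK i) (K c d j) ≡
          up l * S (suc i) j + mid l * S i j + down l * S (ℕ.pred i) j
        expand i l j i+l≡d = trans
          (sumQ-cong (suc d) {summand (θK i) (K c d j)}
            {λ k → up l * s (suc i) k + mid l * s i k + down l * s (ℕ.pred i) k} (λ k k<1+d → trans
            (cong (λ z → W k (d ℕ.∸ k) * (z * K c d j k (d ℕ.∸ k)))
              (K-recurrence i l k (d ℕ.∸ k) i+l≡d (ℕ.m+[n∸m]≡n (ℕ.s≤s⁻¹ k<1+d))))
            (distribute (W k (d ℕ.∸ k)) (up l) (mid l) (down l) (K c d (suc i) k (d ℕ.∸ k))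
              (K c d i k (d ℕ.∸ k)) (K c d (ℕ.pred i) k (d ℕ.∸ k)) (K c d j k (d ℕ.∸ k)))))
          (sumQ-linear₃ (suc d) (up l) (s (suc i)) (mid l) (s i) (down l) (s (ℕ.pred i)))
          where
          s : ℕ → ℕ → ℚ
          s i = summand (K c d i) (K c d j)
          distribute : ∀ w b a e x y z t → w * ((b * x + a * y + e * z) * t) ≡
            b * (w * (x * t)) + a * (w * (y * t)) + e * (w * (z * t))
          distribute = solve-∀ ℚ-ring

      K-zero : ∀ k j → K c d 0 k j ≡ 1ℚ
      K-zero k j = sumQ-truncate 1 (suc d) {λ n → coeff c d 0 n * basis c d n k j}
        (λ n 1≤n → *-zero-fst (basis c d n k j)
          (*-zero-fst (inv (pochQ P n * pochQ Q n) * powQ Q n) (pochQ-vanish 0 n 1≤n)))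
        (ℕ.s≤s ℕ.z≤n)

      S-right-zero : ∀ i → S i 0 ≡ sumQ (suc d) (λ n → coeff c d i n * moment n)
      S-right-zero i = begin
        S i 0
          ≡⟨ sumQ-cong (suc d) {summand (K c d i) (K c d 0)} {λ k → sumQ (suc d) (λ n → w k * t k n)} (λ k _ → trans
               (cong (λ z → w k * (K c d i k (d ℕ.∸ k) * z)) (K-zero k (d ℕ.∸ k)))
               (trans (cong (w k *_) (ℚ.*-identityʳ (K c d i k (d ℕ.∸ k))))
                 (sym (sumQ-*ˡ (suc d) (w k) (t k))))) ⟩
        sumQ (suc d) (λ k → sumQ (suc d) (λ n → w k * t k n))
          ≡⟨ sumQ-swap (suc d) (suc d) (λ k n → w k * t k n) ⟩
        sumQ (suc d) (λ n → sumQ (suc d) (λ k → w k * t k n))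
          ≡⟨ sumQ-cong (suc d) {λ n → sumQ (suc d) (λ k → w k * t k n)} {λ n → coeff c d i n * moment n} (λ n _ → trans
               (sumQ-cong (suc d) {λ k → w k * t k n} {λ k → coeff c d i n * (w k * basis c d n k (d ℕ.∸ k))}
                 (λ k _ → swap (w k) (coeff c d i n) (basis c d n k (d ℕ.∸ k))))
               (sumQ-*ˡ (suc d) (coeff c d i n) (λ k → w k * basis c d n k (d ℕ.∸ k)))) ⟩
        sumQ (suc d) (λ n → coeff c d i n * moment n) ∎
        where
        open ≡-Reasoning
        w : ℕ → ℚ
        w k = W k (d ℕ.∸ k)
        t : ℕ → ℕ → ℚ
        t k n = coeff c d i n * basis c d n k (d ℕ.∸ k)
        swap : ∀ w a b → w * (a * b) ≡ a * (w * b)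
        swap = solve-∀ ℚ-ring

      -- A terminating case of the q-binomial theorem.
      S-suc-zero : ∀ i → suc i ℕ.≤ d → S (suc i) 0 ≡ 0ℚ
      S-suc-zero i i<d = *-cancelˡ (1-pⁿ≢0 i) (begin
        (1ℚ - a) * S (suc i) 0
          ≡⟨ cong ((1ℚ - a) *_) (S-right-zero (suc i)) ⟩
        (1ℚ - a) * sumQ (suc d) (λ n → coeff c d (suc i) n * moment n)
          ≡⟨ sym (sumQ-*ˡ (suc d) (1ℚ - a) (λ n → coeff c d (suc i) n * moment n)) ⟩
        sumQ (suc d) (λ n → (1ℚ - a) * (coeff c d (suc i) n * moment n))
          ≡⟨ sumQ-telescope (suc d) (λ n → (1ℚ - a) * (coeff c d (suc i) n * moment n)) g step ⟩
        g (suc d) - g 0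
          ≡⟨ cong₂ _-_
               (*-zero-snd (moment 0) (*-zero-fst (inv (pochQ Q (suc d)))
                 (*-zero-fst (1ℚ - powQ Q (suc d)) (pochQ-vanish (suc i) (suc d) (ℕ.s≤s i<d)))))
               (ℚ.*-zeroʳ (moment 0)) ⟩
        0ℚ
          ≡⟨ sym (ℚ.*-zeroʳ (1ℚ - a)) ⟩
        (1ℚ - a) * 0ℚ ∎)
        where
        open ≡-Reasoning
        a : ℚ
        a = powQ p (suc i)
        g : ℕ → ℚ
        g n = moment 0 * (pochQ a n * (1ℚ - powQ Q n) * inv (pochQ Q n))
        identity : ∀ a N X Y x w u μ Q →
          (1ℚ - a) * (N * (x * w * Y) * (X * μ)) ≡
          (μ * (N * (1ℚ - a * Y) * (1ℚ - Q * Y) * (w * u)) - μ * (N * (1ℚ - Y) * w))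
            + (X * x - 1ℚ) * ((1ℚ - a) * N * w * Y * μ)
            + ((1ℚ - Q * Y) * u - 1ℚ) * - (μ * N * w * (1ℚ - a * Y))
        identity = solve-∀ ℚ-ring
        step : ∀ n → n ℕ.< suc d → (1ℚ - a) * (coeff c d (suc i) n * moment n) ≡ g (suc n) - g n
        step n (ℕ.s≤s n≤d) = begin
          (1ℚ - a) * (coeff c d (suc i) n * moment n)
            ≡⟨ cong₂ (λ v m → (1ℚ - a) * (N * (v * powQ Q n) * m)) (inv-* (pochQ-≢0 n n≤d) (pochQ-Q≢0 n)) (moment-total n) ⟩
          (1ℚ - a) * (N * (inv X * w * powQ Q n) * (X * moment 0))
            ≡⟨ identity a N X (powQ Q n) (inv X) w (inv v) (moment 0) Q ⟩
          rhs + (X * inv X - 1ℚ) * c₁ + (v * inv v - 1ℚ) * c₂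
            ≡⟨ modulo₂ rhs c₁ c₂ (*-inv (pochQ-≢0 n n≤d)) (*-inv (1-Qⁿ≢0 n)) ⟩
          rhs
            ≡⟨ cong (λ z → moment 0 * (N * (1ℚ - a * powQ Q n) * v * z) - g n) (sym (inv-* (pochQ-Q≢0 n) (1-Qⁿ≢0 n))) ⟩
          g (suc n) - g n ∎
          where
          N X w v rhs c₁ c₂ : ℚ
          N = pochQ a n
          X = pochQ P n
          w = inv (pochQ Q n)
          v = 1ℚ - Q * powQ Q n
          rhs = moment 0 * (N * (1ℚ - a * powQ Q n) * v * (w * inv v)) - g n
          c₁ = (1ℚ - a) * N * w * powQ Q n * moment 0
          c₂ = - (moment 0 * N * w * (1ℚ - a * powQ Q n))

      S-zero-zero : S 0 0 ≡ total
      S-zero-zero = trans (S-right-zero 0) (trans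
        (sumQ-truncate 1 (suc d) {λ n → coeff c d 0 n * moment n}
          (λ n 1≤n → *-zero-fst (moment n)
            (*-zero-fst (inv (pochQ P n * pochQ Q n) * powQ Q n) (pochQ-vanish 0 n 1≤n)))
          (ℕ.s≤s ℕ.z≤n))
        (trans (ℚ.+-identityˡ (1ℚ * moment 0)) (trans (ℚ.*-identityˡ (moment 0)) moment₀)))

      S-below : ∀ n i j → j ℕ.≤ n → j ℕ.< i → i ℕ.≤ d → S i j ≡ 0ℚ
      S-below n (suc i) zero _ _ i≤d = S-suc-zero i i≤d
      S-below (suc n) i (suc j) (ℕ.s≤s j≤n) 1+j<i i≤d =
        *-cancelˡ (1-pⁿ≢0 (d ℕ.∸ suc j)) (trans (isolate recurrence) (sym (ℚ.*-zeroʳ (up l′))))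
        where
        l l′ : ℕ
        l = d ℕ.∸ i
        l′ = suc (d ℕ.∸ suc j)
        j<i : j ℕ.< i
        j<i = ℕ.<-trans (ℕ.n<1+n j) 1+j<i
        recurrence = S-recurrence i l j l′ (ℕ.m+[n∸m]≡n i≤d)
          (trans (ℕ.+-suc j (d ℕ.∸ suc j)) (ℕ.m+[n∸m]≡n (ℕ.≤-trans j<i i≤d)))
        first-case : i ℕ.< d ⊎ i ≡ d → up l * S (suc i) j ≡ 0ℚ
        first-case (inj₁ i<d) = *-zero-snd (up l) (S-below n (suc i) j j≤n (ℕ.m<n⇒m<1+n j<i) i<d)
        first-case (inj₂ i≡d) = *-zero-fst (S (suc i) j)
          (cong (λ z → 1ℚ - powQ p z) (trans (cong (d ℕ.∸_) i≡d) (ℕ.n∸n≡0 d)))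
        Sij : S i j ≡ 0ℚ
        Sij = S-below n i j j≤n j<i i≤d
        S-pred : S (ℕ.pred i) j ≡ 0ℚ
        S-pred = S-below n (ℕ.pred i) j j≤n (ℕ.pred-mono-≤ 1+j<i) (ℕ.≤-trans ℕ.pred[n]≤n i≤d)
        S-pred′ : S i (ℕ.pred j) ≡ 0ℚ
        S-pred′ = S-below n i (ℕ.pred j) (ℕ.≤-trans ℕ.pred[n]≤n j≤n) (ℕ.≤-<-trans ℕ.pred[n]≤n j<i) i≤d
        isolate : up l * S (suc i) j + mid l * S i j + down l * S (ℕ.pred i) j ≡
          up l′ * S i (suc j) + mid l′ * S i j + down l′ * S i (ℕ.pred j) → up l′ * S i (suc j) ≡ 0ℚ
        isolate eq = begin
          up l′ * S i (suc j)
            ≡⟨ identity (up l′ * S i (suc j)) (mid l′) (down l′) ⟩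
          up l′ * S i (suc j) + mid l′ * 0ℚ + down l′ * 0ℚ
            ≡⟨ cong₂ (λ x y → up l′ * S i (suc j) + mid l′ * x + down l′ * y) (sym Sij) (sym S-pred′) ⟩
          up l′ * S i (suc j) + mid l′ * S i j + down l′ * S i (ℕ.pred j)
            ≡⟨ sym eq ⟩
          up l * S (suc i) j + mid l * S i j + down l * S (ℕ.pred i) j
            ≡⟨ cong₂ _+_ (cong₂ _+_ (first-case (ℕ.m≤n⇒m<n∨m≡n i≤d)) (*-zero-snd (mid l) Sij)) (*-zero-snd (down l) S-pred) ⟩
          0ℚ ∎
          where
          open ≡-Reasoning
          identity : ∀ x a b → x ≡ x + a * 0ℚ + b * 0ℚ
          identity = solve-∀ ℚ-ring

      S-diagonal-suc : ∀ j l → j ℕ.+ suc l ≡ d →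
        up (suc l) * S (suc j) (suc j) ≡ down l * S j j
      S-diagonal-suc j l j+l≡d = begin
        up (suc l) * S (suc j) (suc j)
          ≡⟨ identity (up (suc l) * S (suc j) (suc j)) (mid (suc l)) (down (suc l)) ⟩
        up (suc l) * S (suc j) (suc j) + mid (suc l) * 0ℚ + down (suc l) * 0ℚ
          ≡⟨ cong₂ (λ x y → up (suc l) * S (suc j) (suc j) + mid (suc l) * x + down (suc l) * y)
               (sym S-off) (sym (S-below d (suc j) (ℕ.pred j) (ℕ.≤-trans ℕ.pred[n]≤n (ℕ.<⇒≤ j<d))
                 (ℕ.s≤s ℕ.pred[n]≤n) j<d)) ⟩
        up (suc l) * S (suc j) (suc j) + mid (suc l) * S (suc j) j + down (suc l) * S (suc j) (ℕ.pred j)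
          ≡⟨ sym (S-recurrence (suc j) l j (suc l) (trans (sym (ℕ.+-suc j l)) j+l≡d) j+l≡d) ⟩
        up l * S (suc (suc j)) j + mid l * S (suc j) j + down l * S j j
          ≡⟨ cong₂ (λ x y → x + mid l * y + down l * S j j) first S-off ⟩
        0ℚ + mid l * 0ℚ + down l * S j j
          ≡⟨ identity′ (mid l) (down l * S j j) ⟩
        down l * S j j ∎
        where
        open ≡-Reasoning
        j<d : j ℕ.< d
        j<d = subst (suc j ℕ.≤_) (trans (sym (ℕ.+-suc j l)) j+l≡d) (ℕ.m≤m+n (suc j) l)
        S-off : S (suc j) j ≡ 0ℚ
        S-off = S-below d (suc j) j (ℕ.<⇒≤ j<d) ℕ.≤-refl j<d
        first-case : ∀ l → j ℕ.+ suc l ≡ d → up l * S (suc (suc j)) j ≡ 0ℚ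
        first-case zero _ = ℚ.*-zeroˡ (S (suc (suc j)) j)
        first-case (suc l) eq = *-zero-snd (up (suc l)) (S-below d (suc (suc j)) j (ℕ.<⇒≤ j<d)
          (ℕ.m<n⇒m<1+n ℕ.≤-refl) (subst (suc (suc j) ℕ.≤_)
            (trans (sym (trans (ℕ.+-suc j (suc l)) (cong suc (ℕ.+-suc j l)))) eq) (ℕ.m≤m+n (suc (suc j)) l)))
        first : up l * S (suc (suc j)) j ≡ 0ℚ
        first = first-case l j+l≡d
        identity : ∀ x a b → x ≡ x + a * 0ℚ + b * 0ℚ
        identity = solve-∀ ℚ-ring
        identity′ : ∀ a x → 0ℚ + a * 0ℚ + x ≡ x
        identity′ = solve-∀ ℚ-ring

      S-diagonal : ∀ i → i ℕ.≤ d → pochQ P i * S i i ≡ pochQ Q i * powQ (c * P) i * total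
      S-diagonal zero _ = trans (ℚ.*-identityˡ (S 0 0)) (trans S-zero-zero (sym (ℚ.*-identityˡ total)))
      S-diagonal (suc i) i<d = begin
        pochQ P i * (1ℚ - P * powQ Q i) * S (suc i) (suc i)
          ≡⟨ cong (λ z → pochQ P i * (1ℚ - z) * S (suc i) (suc i)) (p^m*Qⁿ (suc l) i i+l≡d) ⟩
        pochQ P i * up (suc l) * S (suc i) (suc i)
          ≡⟨ ℚ.*-assoc (pochQ P i) (up (suc l)) (S (suc i) (suc i)) ⟩
        pochQ P i * (up (suc l) * S (suc i) (suc i))
          ≡⟨ cong (pochQ P i *_) (S-diagonal-suc i l i+l≡d) ⟩
        pochQ P i * (c * (P - powQ p l) * S i i)
          ≡⟨ cong (λ z → pochQ P i * (c * (P - z) * S i i)) (sym (p^m*Qⁿ l (suc i) (trans (sym (ℕ.+-suc i l)) i+l≡d))) ⟩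
        pochQ P i * (c * (P - P * (Q * powQ Q i)) * S i i)
          ≡⟨ regroup (pochQ P i) c P (Q * powQ Q i) (S i i) ⟩
        (1ℚ - Q * powQ Q i) * (c * P) * (pochQ P i * S i i)
          ≡⟨ cong ((1ℚ - Q * powQ Q i) * (c * P) *_) (S-diagonal i (ℕ.<⇒≤ i<d)) ⟩
        (1ℚ - Q * powQ Q i) * (c * P) * (pochQ Q i * powQ (c * P) i * total)
          ≡⟨ regroup′ (1ℚ - Q * powQ Q i) (c * P) (pochQ Q i) (powQ (c * P) i) total ⟩
        pochQ Q i * (1ℚ - Q * powQ Q i) * (c * P * powQ (c * P) i) * total ∎
        where
        open ≡-Reasoning
        l : ℕ
        l = d ℕ.∸ suc i
        i+l≡d : i ℕ.+ suc l ≡ d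
        i+l≡d = trans (ℕ.+-suc i l) (ℕ.m+[n∸m]≡n i<d)
        regroup : ∀ x c P y s → x * (c * (P - P * y) * s) ≡ (1ℚ - y) * (c * P) * (x * s)
        regroup = solve-∀ ℚ-ring
        regroup′ : ∀ u v x y t → u * v * (x * y * t) ≡ x * u * (v * y) * t
        regroup′ = solve-∀ ℚ-ring

      norm : ℕ → ℚ
      norm i = pochQ P i * (pochQ Q i * powQ (c * P) i * total)

      private
        normalized-zero : ∀ i j → i ≢ j → pochQ P i * (pochQ P j * S i j) ≡ 0ℚ
        normalized-zero i j i≢j = cases (ℕ.≤-<-connex i d) (ℕ.≤-<-connex j d)
          where
          S≡0 : Tri (i ℕ.< j) (i ≡ j) (j ℕ.< i) → i ℕ.≤ d → j ℕ.≤ d → S i j ≡ 0ℚ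
          S≡0 (tri< i<j _ _) i≤d j≤d = trans (S-comm i j) (S-below d j i i≤d i<j j≤d)
          S≡0 (tri≈ _ i≡j _) _ _ = contradiction i≡j i≢j
          S≡0 (tri> _ _ j<i) i≤d j≤d = S-below d i j j≤d j<i i≤d
          cases : i ℕ.≤ d ⊎ d ℕ.< i → j ℕ.≤ d ⊎ d ℕ.< j → pochQ P i * (pochQ P j * S i j) ≡ 0ℚ
          cases (inj₂ d<i) _ = *-zero-fst (pochQ P j * S i j) (pochQ-vanish d i d<i)
          cases (inj₁ _) (inj₂ d<j) = *-zero-snd (pochQ P i) (*-zero-fst (S i j) (pochQ-vanish d j d<j))
          cases (inj₁ i≤d) (inj₁ j≤d) =
            *-zero-snd (pochQ P i) (*-zero-snd (pochQ P j) (S≡0 (ℕ.<-cmp i j) i≤d j≤d))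

      orthogonality : ∀ i j →
        pairing (λ k l → pochQ P i * K c d i k l) (λ k l → pochQ P j * K c d j k l) ≡ δℕ i j * norm i
      orthogonality i j = trans
        (sumQ-cong (suc d) {summand (λ k l → pochQ P i * K c d i k l) (λ k l → pochQ P j * K c d j k l)}
          {λ k → pochQ P i * pochQ P j * summand (K c d i) (K c d j) k} (λ k _ → regroup (W k (d ℕ.∸ k)) (pochQ P i) (K c d i k (d ℕ.∸ k))
          (pochQ P j) (K c d j k (d ℕ.∸ k))))
        (trans (sumQ-*ˡ (suc d) (pochQ P i * pochQ P j) (summand (K c d i) (K c d j)))
          (trans (ℚ.*-assoc (pochQ P i) (pochQ P j) (S i j)) (cases (i ℕ.≟ j))))
        where
        regroup : ∀ w a x b y → w * (a * x * (b * y)) ≡ a * b * (w * (x * y))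
        regroup = solve-∀ ℚ-ring
        diagonal : i ℕ.≤ d ⊎ d ℕ.< i → pochQ P i * (pochQ P i * S i i) ≡ norm i
        diagonal (inj₁ i≤d) = cong (pochQ P i *_) (S-diagonal i i≤d)
        diagonal (inj₂ d<i) = trans (*-zero-fst (pochQ P i * S i i) (pochQ-vanish d i d<i))
          (sym (*-zero-fst (pochQ Q i * powQ (c * P) i * total) (pochQ-vanish d i d<i)))
        cases : Dec (i ≡ j) → pochQ P i * (pochQ P j * S i j) ≡ δℕ i j * norm i
        cases (yes i≡j) = trans
          (subst (λ z → pochQ P i * (pochQ P z * S i z) ≡ norm i) i≡j (diagonal (ℕ.≤-<-connex i d)))
          (sym (trans (cong (_* norm i) (trans (cong (δℕ i) (sym i≡j)) (δℕ-refl i))) (ℚ.*-identityˡ (norm i))))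
        cases (no i≢j) = trans (normalized-zero i j i≢j)
          (sym (*-zero-fst (norm i) (δℕ-≢ i j i≢j)))

-- The weights w_{±i} and c_i

inv-factor : ∀ x y z → x * y ≡ z → z ≢ 0ℚ → inv x ≡ y * inv z
inv-factor x y z eq z≢0 = inv-unique x (y * inv z)
  (trans (sym (ℚ.*-assoc x y (inv z))) (trans (cong (_* inv z) eq) (*-inv z≢0)))

≡ᵇ-refl : ∀ n → (n ℕ.≡ᵇ n) ≡ true
≡ᵇ-refl zero = refl
≡ᵇ-refl (suc n) = ≡ᵇ-refl n

≡ᵇ-+-suc : ∀ m n → (m ℕ.≡ᵇ m ℕ.+ suc n) ≡ false
≡ᵇ-+-suc zero n = refl
≡ᵇ-+-suc (suc m) n = ≡ᵇ-+-suc m n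

if-true : ∀ {A : Set} {b} {x y : A} → b ≡ true → (if b then x else y) ≡ x
if-true refl = refl

if-false : ∀ {A : Set} {b} {x y : A} → b ≡ false → (if b then x else y) ≡ y
if-false refl = refl

module Weights (q D : ℕ) (E : ℚ) (1<q : 1 ℕ.< q) (0<E : 0ℚ ℚ.< E) where

  open Dual q D E using (pochQ; qpow; negPoch; w⁺; w⁻; sgn; M) renaming (qQ to Q; c to w±)
  open Krawtchouk q D E 1<q

  e c : ℚ
  e = inv E
  c = - e

  E*e : E * e ≡ 1ℚ
  E*e = *-inv (pos⇒≢0 0<E)

  qpow-neg : ∀ n → qpow (ℤ.- + n) ≡ powQ p n
  qpow-neg zero = refl
  qpow-neg (suc n) = inv-unique (powQ Q (suc n)) (powQ p (suc n)) (Qⁿ*pⁿ (suc n))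

  qpow-⊖ : ∀ m n → qpow (m ℤ.⊖ n) ≡ powQ Q m * powQ p n
  qpow-⊖ m zero = sym (ℚ.*-identityʳ (powQ Q m))
  qpow-⊖ zero (suc n) = trans (qpow-neg (suc n)) (sym (ℚ.*-identityˡ (powQ p (suc n))))
  qpow-⊖ (suc m) (suc n) = trans (cong qpow (ℤ.[1+m]⊖[1+n]≡m⊖n m n)) (trans (qpow-⊖ m n)
    (sym (trans (identity Q p (powQ Q m) (powQ p n)) (modulo (powQ Q m * powQ p n) (powQ Q m * powQ p n) Q*p))))
    where
    identity : ∀ q p x y → q * x * (p * y) ≡ x * y + (q * p - 1ℚ) * (x * y)
    identity = solve-∀ ℚ-ring

  qpow-difference : ∀ m n → qpow (+ m ℤ.- + n) ≡ powQ Q m * powQ p n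
  qpow-difference m n = trans (cong qpow (ℤ.m-n≡m⊖n m n)) (qpow-⊖ m n)

  qpow-1- : ∀ n → qpow (+ 1 ℤ.- + suc n) ≡ powQ p n
  qpow-1- n = trans (cong qpow (ℤ.[1+m]⊖[1+n]≡m⊖n 0 n)) (trans (qpow-⊖ 0 n) (ℚ.*-identityˡ (powQ p n)))

  module _ (k j : ℕ) (k+j≡D : k ℕ.+ j ≡ D) where

    +D : + D ≡ + k ℤ.+ + j
    +D = trans (cong +_ (sym k+j≡D)) (ℤ.pos-+ k j)

    D-k : + D ℤ.- + k ≡ + j
    D-k = trans (cong (ℤ._- + k) +D) (identity (+ k) (+ j))
      where
      identity : ∀ k j → k ℤ.+ j ℤ.- k ≡ j
      identity = ℤ.solve-∀

    qpow-complement : qpow (+ D ℤ.- + k) ≡ powQ Q j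
    qpow-complement = cong qpow D-k

    qpow-w⁺ : qpow (+ k ℤ.* (+ D ℤ.- + k)) ≡ powQ Q (k ℕ.* j)
    qpow-w⁺ = cong qpow (trans (cong (+ k ℤ.*_) D-k) (sym (ℤ.pos-* k j)))

    qpow-w± : qpow (+ k ℤ.* (+ D ℤ.- + k ℤ.- + 1) ℤ.+ + D) ≡ powQ Q (k ℕ.* j) * powQ Q j
    qpow-w± = trans (cong qpow (trans
        (cong₂ (λ u v → + k ℤ.* (u ℤ.- + 1) ℤ.+ v) D-k +D)
        (trans (identity (+ k) (+ j)) (trans (cong (ℤ._+ + j) (sym (ℤ.pos-* k j))) (sym (ℤ.pos-+ (k ℕ.* j) j))))))
      (powQ-+ Q (k ℕ.* j) j)
      where
      identity : ∀ k j → k ℤ.* (j ℤ.- + 1) ℤ.+ (k ℤ.+ j) ≡ k ℤ.* j ℤ.+ j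
      identity = ℤ.solve-∀

    qpow-w⁻ : qpow (+ k ℤ.* (+ D ℤ.- + k ℤ.- + 2) ℤ.+ + D) ≡ powQ Q (k ℕ.* j) * powQ Q j * powQ p k
    qpow-w⁻ = trans (cong qpow (trans
        (cong₂ (λ u v → + k ℤ.* (u ℤ.- + 2) ℤ.+ v) D-k +D)
        (trans (identity (+ k) (+ j)) (cong (ℤ._- + k)
          (trans (cong (ℤ._+ + j) (sym (ℤ.pos-* k j))) (sym (ℤ.pos-+ (k ℕ.* j) j)))))))
      (trans (qpow-difference (k ℕ.* j ℕ.+ j) k) (cong (_* powQ p k) (powQ-+ Q (k ℕ.* j) j)))
      where
      identity : ∀ k j → k ℤ.* (j ℤ.- + 2) ℤ.+ (k ℤ.+ j) ≡ k ℤ.* j ℤ.+ j ℤ.- k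
      identity = ℤ.solve-∀

    qpow-denominator : qpow (+ D ℤ.- + 2 ℤ.* + k) ≡ powQ Q j * powQ p k
    qpow-denominator = trans (cong qpow (trans (cong (ℤ._- + 2 ℤ.* + k) +D) (identity (+ k) (+ j))))
      (qpow-difference j k)
      where
      identity : ∀ k j → k ℤ.+ j ℤ.- + 2 ℤ.* k ≡ j ℤ.- k
      identity = ℤ.solve-∀

    Q^D : powQ Q D ≡ powQ Q k * powQ Q j
    Q^D = trans (cong (powQ Q) (sym k+j≡D)) (powQ-+ Q k j)

    p^D : powQ p D ≡ powQ p k * powQ p j
    p^D = trans (cong (powQ p) (sym k+j≡D)) (powQ-+ p k j)

  ω : ℕ → ℚ
  ω k = M * sgn k * powQ Q (k ℕ.* (D ℕ.∸ k)) * powQ E k * pochQ (powQ p D) k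
        * inv (pochQ Q k * pochQ (- (E * powQ p k)) (suc D))

  E*powQ-pos : ∀ {x} n → 0ℚ ℚ.< x → 0ℚ ℚ.< E * powQ x n
  E*powQ-pos n 0<x = *-pos 0<E (powQ-pos n 0<x)

  ω-denominator≢0 : ∀ k → pochQ Q k * pochQ (- (E * powQ p k)) (suc D) ≢ 0ℚ
  ω-denominator≢0 k = *-≢0 (pochQ-Q≢0 k) (pos⇒≢0 (pochQ-neg-pos (E * powQ p k) (suc D) (E*powQ-pos k 0<p)))

  ω-recurrence : ∀ k j → k ℕ.+ suc j ≡ D →
    ω (suc k) * (c * (powQ p j * powQ p j) * (powQ p (suc k) - c) * (1ℚ - powQ p (suc k))) ≡
    - (ω k * (powQ p k * powQ p k * (1ℚ - powQ p (suc j)) * (1ℚ - c * powQ p (suc j))))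
  ω-recurrence k j k+j≡D = begin
    ω (suc k) * (c * (y * y) * (p * x - c) * (1ℚ - p * x))
      ≡⟨ cong (_* (c * (y * y) * (p * x - c) * (1ℚ - p * x))) ω-suc ⟩
    M * (- 1ℚ * s) * (r * b) * (E * ε) * (T * (1ℚ - p * y)) * ((1ℚ - - (E * (Q * b))) * J)
      * (c * (y * y) * (p * x - c) * (1ℚ - p * x))
      ≡⟨ identity X x b y Q p E e M s r ε T J ⟩
    rhs + (X * x - 1ℚ) * c₁ + (b * y - 1ℚ) * c₂ + (Q * p - 1ℚ) * c₃ + (E * e - 1ℚ) * c₄
      ≡⟨ trans (modulo₂ (rhs + (X * x - 1ℚ) * c₁ + (b * y - 1ℚ) * c₂) c₃ c₄ Q*p E*e)
           (modulo₂ rhs c₁ c₂ (Qⁿ*pⁿ k) (Qⁿ*pⁿ j)) ⟩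
    rhs
      ≡⟨ cong (λ z → - (z * (x * x * (1ℚ - p * y) * (1ℚ - c * (p * y))))) (sym ω-k) ⟩
    - (ω k * (x * x * (1ℚ - p * y) * (1ℚ - c * (p * y)))) ∎
    where
    open ≡-Reasoning
    x X y b s r ε T Z J a z rhs Γ U κ c₁ c₂ c₃ c₄ : ℚ
    x = powQ p k
    X = powQ Q k
    y = powQ p j
    b = powQ Q j
    s = sgn k
    r = powQ Q (k ℕ.* j)
    ε = powQ E k
    T = pochQ (powQ p D) k
    a = - (E * x)
    Z = pochQ a D
    z = pochQ Q k * (1ℚ - Q * X) * ((1ℚ - p * a) * Z) * (1ℚ - a * powQ Q D)
    J = inv z
    rhs = - (M * s * (r * X) * ε * T * ((1ℚ - Q * X) * (1ℚ - p * a) * J) * (x * x * (1ℚ - p * y) * (1ℚ - c * (p * y))))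
    Γ = M * s * r * ε * T * J * (1ℚ - p * y)
    U = (1ℚ + E * (p * x)) * (1ℚ + e * (p * y))
    κ = (p * x + e) * (1ℚ - p * x)
    c₁ = - (Γ * (U * (Q * (X * x + 1ℚ) - x)))
    c₂ = Γ * (κ * (y + E * Q * (b * y) + E * Q))
    c₃ = - (Γ * (U * x + κ * y * (E * e)))
    c₄ = Γ * (κ * (b * y) * (y + E * Q * (b * y)) - κ * y + (1ℚ - p * x) * Q * (1ℚ + e * (p * y)))
    D∸k : D ℕ.∸ k ≡ suc j
    D∸k = trans (cong (ℕ._∸ k) (sym k+j≡D)) (ℕ.m+n∸m≡n k (suc j))
    k+1+j≡D : suc k ℕ.+ j ≡ D
    k+1+j≡D = trans (sym (ℕ.+-suc k j)) k+j≡D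
    D∸k+1 : D ℕ.∸ suc k ≡ j
    D∸k+1 = trans (cong (ℕ._∸ suc k) (sym k+1+j≡D)) (ℕ.m+n∸m≡n (suc k) j)
    a-suc : - (E * powQ p (suc k)) ≡ p * a
    a-suc = lemma E p x
      where
      lemma : ∀ E p x → - (E * (p * x)) ≡ p * - (E * x)
      lemma = solve-∀ ℚ-ring
    aQ^D : a * powQ Q D ≡ - (E * (Q * b))
    aQ^D = trans (cong (a *_) (Q^D k (suc j) k+j≡D)) (trans (lemma E x X (Q * b)) (modulo (- (E * (Q * b))) (- (E * (Q * b))) (Qⁿ*pⁿ k)))
      where
      lemma : ∀ E x X b → - (E * x) * (X * b) ≡ - (E * b) + (X * x - 1ℚ) * - (E * b)
      lemma = solve-∀ ℚ-ring
    z≢0 : z ≢ 0ℚ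
    z≢0 = subst (_≢ 0ℚ) (regroup (pochQ Q k) (1ℚ - Q * X) Z (1ℚ - a * powQ Q D) (1ℚ - p * a))
      (*-≢0 (*-≢0 (ω-denominator≢0 k) (1-Qⁿ≢0 k))
        (subst (λ t → 1ℚ - t ≢ 0ℚ) a-suc (pos⇒≢0 (subst (0ℚ ℚ.<_) (neg (E * powQ p (suc k)))
          (+-pos 0<1 (E*powQ-pos (suc k) 0<p))))))
      where
      regroup : ∀ A u Z h f → A * (Z * h) * u * f ≡ A * u * (f * Z) * h
      regroup = solve-∀ ℚ-ring
      neg : ∀ x → 1ℚ + x ≡ 1ℚ - - x
      neg = solve-∀ ℚ-ring
    ω-k : ω k ≡ M * s * (r * X) * ε * T * ((1ℚ - Q * X) * (1ℚ - p * a) * J)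
    ω-k = cong₂ (λ u v → M * s * u * ε * T * v)
      (trans (cong (λ t → powQ Q (k ℕ.* t)) D∸k) (trans (cong (powQ Q) (trans (ℕ.*-suc k j) (ℕ.+-comm k (k ℕ.* j))))
        (powQ-+ Q (k ℕ.* j) k)))
      (inv-factor (pochQ Q k * (Z * (1ℚ - a * powQ Q D))) ((1ℚ - Q * X) * (1ℚ - p * a)) z
        (regroup (pochQ Q k) Z (1ℚ - a * powQ Q D) (1ℚ - Q * X) (1ℚ - p * a)) z≢0)
      where
      regroup : ∀ A Z h u f → A * (Z * h) * (u * f) ≡ A * u * (f * Z) * h
      regroup = solve-∀ ℚ-ring
    ω-suc : ω (suc k) ≡
      M * (- 1ℚ * s) * (r * b) * (E * ε) * (T * (1ℚ - p * y)) * ((1ℚ - - (E * (Q * b))) * J)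
    ω-suc = trans
      (cong₂ (λ u v → M * (- 1ℚ * s) * u * (E * ε) * (T * (1ℚ - powQ p D * X)) * v)
        (trans (cong (λ t → powQ Q (suc k ℕ.* t)) D∸k+1) (trans (cong (powQ Q) (ℕ.+-comm j (k ℕ.* j)))
          (powQ-+ Q (k ℕ.* j) j)))
        (inv-factor (pochQ Q (suc k) * pochQ (- (E * powQ p (suc k))) (suc D)) (1ℚ - a * powQ Q D) z
          (cong (λ t → pochQ Q (suc k) * t * (1ℚ - a * powQ Q D))
            (trans (cong (λ t → pochQ t (suc D)) a-suc) (pochQ-p a D))) z≢0))
      (cong₂ (λ u v → M * (- 1ℚ * s) * (r * b) * (E * ε) * (T * (1ℚ - u)) * ((1ℚ - v) * J))
        (p^m*Qⁿ (suc j) k k+j≡D) aQ^D)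
    identity : ∀ X x b y q p E e M s r ε T J →
      M * (- 1ℚ * s) * (r * b) * (E * ε) * (T * (1ℚ - p * y)) * ((1ℚ - - (E * (q * b))) * J)
        * (- e * (y * y) * (p * x - - e) * (1ℚ - p * x)) ≡
      - (M * s * (r * X) * ε * T * ((1ℚ - q * X) * (1ℚ - p * - (E * x)) * J) * (x * x * (1ℚ - p * y) * (1ℚ - - e * (p * y))))
        + (X * x - 1ℚ) * - (M * s * r * ε * T * J * (1ℚ - p * y) * (((1ℚ + E * (p * x)) * (1ℚ + e * (p * y))) * (q * (X * x + 1ℚ) - x)))
        + (b * y - 1ℚ) * (M * s * r * ε * T * J * (1ℚ - p * y) * ((p * x + e) * (1ℚ - p * x) * (y + E * q * (b * y) + E * q)))
        + (q * p - 1ℚ) * - (M * s * r * ε * T * J * (1ℚ - p * y) * (((1ℚ + E * (p * x)) * (1ℚ + e * (p * y))) * x + (p * x + e) * (1ℚ - p * x) * y * (E * e)))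
        + (E * e - 1ℚ) * (M * s * r * ε * T * J * (1ℚ - p * y) * ((p * x + e) * (1ℚ - p * x) * (b * y) * (y + E * q * (b * y)) - (p * x + e) * (1ℚ - p * x) * y + (1ℚ - p * x) * q * (1ℚ + e * (p * y))))
    identity = solve-∀ ℚ-ring

  total-weight : (powQ p D - c * 1ℚ) * ω D * pochQ c D ≡ 1ℚ
  total-weight = *-cancelˡ (ω-denominator≢0 D) (begin
    den * ((x - c * 1ℚ) * ω D * pochQ c D)
      ≡⟨ cong (λ t → den * ((x - c * 1ℚ) * (M * sgn D * powQ Q t * powQ E D * pochQ x D * inv den) * pochQ c D))
           (trans (cong (D ℕ.*_) (ℕ.n∸n≡0 D)) (ℕ.*-zeroʳ D)) ⟩
    den * ((x - c * 1ℚ) * (X * E * sgn D * 1ℚ * powQ E D * pochQ x D * inv den) * pochQ c D)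
      ≡⟨ identity den (inv den) x X c E (sgn D) (powQ E D) (pochQ x D) (pochQ c D) ⟩
    sgn D * pochQ x D * (powQ E D * E) * (pochQ c D * (1ℚ - c * X))
      + (X * x - 1ℚ) * c₁ + (den * inv den - 1ℚ) * c₂
      ≡⟨ modulo₂ (sgn D * pochQ x D * (powQ E D * E) * (pochQ c D * (1ℚ - c * X))) c₁ c₂ (Qⁿ*pⁿ D) (*-inv (ω-denominator≢0 D)) ⟩
    sgn D * pochQ x D * (powQ E D * E) * (pochQ c D * (1ℚ - c * X))
      ≡⟨ reversal D ⟩
    den
      ≡⟨ sym (ℚ.*-identityʳ den) ⟩
    den * 1ℚ ∎)
    where
    open ≡-Reasoning
    x X den c₁ c₂ : ℚ
    x = powQ p D
    X = powQ Q D
    den = pochQ Q D * pochQ (- (E * x)) (suc D)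
    c₁ = sgn D * pochQ x D * (powQ E D * E) * pochQ c D
    c₂ = (x - c * 1ℚ) * X * (sgn D * pochQ x D * (powQ E D * E) * pochQ c D)
    identity : ∀ d i x X c E s ε T C →
      d * ((x - c * 1ℚ) * (X * E * s * 1ℚ * ε * T * i) * C) ≡
      s * T * (ε * E) * (C * (1ℚ - c * X))
        + (X * x - 1ℚ) * (s * T * (ε * E) * C)
        + (d * i - 1ℚ) * ((x - c * 1ℚ) * X * (s * T * (ε * E) * C))
    identity = solve-∀ ℚ-ring
    -- Reversing the order of the factors of (q⁻ⁿ; q)ₙ and (-E q⁻ⁿ; q)ₙ₊₁.
    reversal : ∀ n → sgn n * pochQ (powQ p n) n * (powQ E n * E) * pochQ c (suc n) ≡
      pochQ Q n * pochQ (- (E * powQ p n)) (suc n)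
    reversal zero = trans (identity₀ e E) (modulo rhs₀ 1ℚ E*e)
      where
      rhs₀ : ℚ
      rhs₀ = 1ℚ * (1ℚ * (1ℚ - - (E * 1ℚ) * 1ℚ))
      identity₀ : ∀ e E → 1ℚ * 1ℚ * (1ℚ * E) * (1ℚ * (1ℚ - - e * 1ℚ)) ≡
        1ℚ * (1ℚ * (1ℚ - - (E * 1ℚ) * 1ℚ)) + (E * e - 1ℚ) * 1ℚ
      identity₀ = solve-∀ ℚ-ring
    reversal (suc n) = begin
      - 1ℚ * sgn n * pochQ (p * y) (suc n) * (E * powQ E n * E) * (C * (1ℚ - c * (Q * Y)))
        ≡⟨ cong (λ t → - 1ℚ * sgn n * t * (E * powQ E n * E) * (C * (1ℚ - c * (Q * Y)))) (pochQ-p y n) ⟩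
      - 1ℚ * sgn n * ((1ℚ - p * y) * pochQ y n) * (E * powQ E n * E) * (C * (1ℚ - c * (Q * Y)))
        ≡⟨ regroup (sgn n) p y (pochQ y n) E (powQ E n) C e Q Y ⟩
      sgn n * pochQ y n * (powQ E n * E) * C * - ((1ℚ - p * y) * E * (1ℚ - - e * (Q * Y)))
        ≡⟨ cong (_* - ((1ℚ - p * y) * E * (1ℚ - - e * (Q * Y)))) (reversal n) ⟩
      pochQ Q n * B * - ((1ℚ - p * y) * E * (1ℚ - - e * (Q * Y)))
        ≡⟨ cong (pochQ Q n * B *_) (trans (identity₁ p y E e Q Y)
             (trans (modulo (rhs + (Y * y - 1ℚ) * (1ℚ + E) + (Q * p - 1ℚ) * (y * Y * (1ℚ + E))) (- ((1ℚ - p * y) * (Q * Y))) E*e)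
               (modulo₂ rhs (1ℚ + E) (y * Y * (1ℚ + E)) (Qⁿ*pⁿ n) Q*p))) ⟩
      pochQ Q n * B * ((1ℚ - Q * Y) * (1ℚ - p * a))
        ≡⟨ regroup′ (pochQ Q n) B (1ℚ - Q * Y) (1ℚ - p * a) ⟩
      pochQ Q n * (1ℚ - Q * Y) * ((1ℚ - p * a) * B)
        ≡⟨ cong (pochQ Q n * (1ℚ - Q * Y) *_) (sym (trans (cong (λ t → pochQ t (suc (suc n))) (a-suc E p y)) (pochQ-p a (suc n)))) ⟩
      pochQ Q (suc n) * pochQ (- (E * powQ p (suc n))) (suc (suc n)) ∎
      where
      y Y a B C rhs : ℚ
      y = powQ p n
      Y = powQ Q n
      a = - (E * y)
      B = pochQ a (suc n)
      C = pochQ c (suc n)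
      rhs = (1ℚ - Q * Y) * (1ℚ - p * a)
      a-suc : ∀ E p x → - (E * (p * x)) ≡ p * - (E * x)
      a-suc = solve-∀ ℚ-ring
      regroup : ∀ s p y T E ε C e Q Y → - 1ℚ * s * ((1ℚ - p * y) * T) * (E * ε * E) * (C * (1ℚ - - e * (Q * Y))) ≡
        s * T * (ε * E) * C * - ((1ℚ - p * y) * E * (1ℚ - - e * (Q * Y)))
      regroup = solve-∀ ℚ-ring
      regroup′ : ∀ A B u v → A * B * (u * v) ≡ A * u * (v * B)
      regroup′ = solve-∀ ℚ-ring
      identity₁ : ∀ p y E e Q Y → - ((1ℚ - p * y) * E * (1ℚ - - e * (Q * Y))) ≡
        (1ℚ - Q * Y) * (1ℚ - p * - (E * y)) + (Y * y - 1ℚ) * (1ℚ + E) + (Q * p - 1ℚ) * (y * Y * (1ℚ + E))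
          + (E * e - 1ℚ) * - ((1ℚ - p * y) * (Q * Y))
      identity₁ = solve-∀ ℚ-ring

  weight-first : (1ℚ - c * powQ p D) * ω 0 ≡ w⁺ 0
  weight-first = begin
    (1ℚ - c * x) * (X * E * 1ℚ * 1ℚ * 1ℚ * 1ℚ * inv (1ℚ * (Z * h)))
      ≡⟨ cong (λ t → (1ℚ - c * x) * (X * E * 1ℚ * 1ℚ * 1ℚ * 1ℚ * t))
           (trans (cong inv (ℚ.*-identityˡ (Z * h))) (inv-* Z≢0 h≢0)) ⟩
    (1ℚ - c * x) * (X * E * 1ℚ * 1ℚ * 1ℚ * 1ℚ * (inv Z * inv h))
      ≡⟨ identity e x X E (inv Z) (inv h) ⟩
    inv Z + (X * x - 1ℚ) * (inv Z * inv h * (E * e)) + (E * e - 1ℚ) * (inv Z * inv h) + (h * inv h - 1ℚ) * inv Z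
      ≡⟨ trans (modulo (inv Z + (X * x - 1ℚ) * (inv Z * inv h * (E * e)) + (E * e - 1ℚ) * (inv Z * inv h)) (inv Z) (*-inv h≢0))
           (modulo₂ (inv Z) (inv Z * inv h * (E * e)) (inv Z * inv h) (Qⁿ*pⁿ D) E*e) ⟩
    inv Z ∎
    where
    open ≡-Reasoning
    x X Z h : ℚ
    x = powQ p D
    X = powQ Q D
    Z = pochQ (- (E * 1ℚ)) D
    h = 1ℚ - - (E * 1ℚ) * X
    Z≢0 : Z ≢ 0ℚ
    Z≢0 = pos⇒≢0 (pochQ-neg-pos (E * 1ℚ) D (*-pos 0<E 0<1))
    h≢0 : h ≢ 0ℚ
    h≢0 = pos⇒≢0 (subst (0ℚ ℚ.<_) (neg E X) (+-pos 0<1 (E*powQ-pos D 0<Q)))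
      where
      neg : ∀ E X → 1ℚ + E * X ≡ 1ℚ - - (E * 1ℚ) * X
      neg = solve-∀ ℚ-ring
    identity : ∀ e x X E z i →
      (1ℚ - - e * x) * (X * E * 1ℚ * 1ℚ * 1ℚ * 1ℚ * (z * i)) ≡
      z + (X * x - 1ℚ) * (z * i * (E * e)) + (E * e - 1ℚ) * (z * i) + ((1ℚ - - (E * 1ℚ) * X) * i - 1ℚ) * z
    identity = solve-∀ ℚ-ring

  weight-last : (powQ p D - c * 1ℚ) * ω D ≡ w⁻ D
  weight-last = trans (sym (inv-unique (pochQ c D) ((powQ p D - c * 1ℚ) * ω D)
      (trans (ℚ.*-comm (pochQ c D) ((powQ p D - c * 1ℚ) * ω D)) total-weight)))
    (sym (if-true (≡ᵇ-refl D)))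

  -- The Gram matrix of the two points λ_k, λ_{-k} for k = k′ + 1 ≠ D.  With
  -- a = q^k, b = q^(D-k) all its entries have a common factor, times a
  -- polynomial in a, b, E.
  module Middle (k′ j′ : ℕ) (k+j≡D : suc k′ ℕ.+ suc j′ ≡ D) where

    private
      k j D′ : ℕ
      k = suc k′
      j = suc j′
      D′ = k′ ℕ.+ j

      D≡ : suc D′ ≡ D
      D≡ = k+j≡D

    x y a b : ℚ
    x = powQ p k
    y = powQ p j
    a = powQ Q k
    b = powQ Q j

    a*x : a * x ≡ 1ℚ
    a*x = Qⁿ*pⁿ k

    b*y : b * y ≡ 1ℚ
    b*y = Qⁿ*pⁿ j

    private
      s r ε T J den F Z H V Γ α : ℚ
      s = sgn k′
      r = powQ Q (k ℕ.* j)
      ε = powQ E k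
      T = pochQ (powQ p D′) k′
      α = - (E * powQ p k′)
      F = 1ℚ - p * α
      Z = pochQ α D′
      H = 1ℚ - α * powQ Q D′
      V = 1ℚ + b * x * E
      den = pochQ Q k′ * (1ℚ - a) * (F * (Z * H)) * V
      J = inv den
      Γ = s * r * ε * T * J

      1+pos : ∀ {u v} → 0ℚ ℚ.< u → 1ℚ + u ≡ v → 0ℚ ℚ.< v
      1+pos 0<u eq = subst (0ℚ ℚ.<_) eq (+-pos 0<1 0<u)

      F≡ : 1ℚ + E * x ≡ F
      F≡ = lemma E p (powQ p k′)
        where
        lemma : ∀ E p x → 1ℚ + E * (p * x) ≡ 1ℚ - p * - (E * x)
        lemma = solve-∀ ℚ-ring

      H≡ : 1ℚ + E * b ≡ H
      H≡ = sym (trans (lemma E (powQ p k′) (powQ Q D′))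
        (cong (λ t → 1ℚ + E * t) (trans (cong (powQ p k′ *_) (powQ-+ Q k′ j))
          (trans (lemma′ (powQ p k′) (powQ Q k′) b) (modulo b b (Qⁿ*pⁿ k′))))))
        where
        lemma : ∀ E x y → 1ℚ - - (E * x) * y ≡ 1ℚ + E * (x * y)
        lemma = solve-∀ ℚ-ring
        lemma′ : ∀ x X b → x * (X * b) ≡ b + (X * x - 1ℚ) * b
        lemma′ = solve-∀ ℚ-ring

      den≢0 : den ≢ 0ℚ
      den≢0 = *-≢0 (*-≢0 (*-≢0 (pochQ-Q≢0 k′) (1-Qⁿ≢0 k′))
        (*-≢0 (pos⇒≢0 (1+pos (E*powQ-pos k 0<p) F≡))
          (*-≢0 (pos⇒≢0 (pochQ-neg-pos (E * powQ p k′) D′ (E*powQ-pos k′ 0<p)))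
            (pos⇒≢0 (1+pos (E*powQ-pos j 0<Q) H≡)))))
        (pos⇒≢0 (+-pos 0<1 (*-pos (*-pos (powQ-pos j 0<Q) (powQ-pos k 0<p)) 0<E)))

      negPoch-neg : ∀ n → negPoch (ℤ.- + k) n ≡ pochQ (p * α) n
      negPoch-neg n = cong (λ t → pochQ t n) (trans (cong (λ t → - (E * t)) (qpow-neg k)) (lemma E p (powQ p k′)))
        where
        lemma : ∀ E p x → - (E * (p * x)) ≡ p * - (E * x)
        lemma = solve-∀ ℚ-ring

      negPoch-1- : ∀ n → negPoch (+ 1 ℤ.- + k) n ≡ pochQ α n
      negPoch-1- n = cong (λ t → pochQ (- (E * t)) n) (qpow-1- k′)

      poch-1-D : ∀ n → pochQ (qpow (+ 1 ℤ.- + D)) n ≡ pochQ (powQ p D′) n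
      poch-1-D n = cong (λ t → pochQ t n) (trans (cong (λ t → qpow (+ 1 ℤ.- + t)) (sym D≡)) (qpow-1- D′))

      p^D′*Q^k′ : powQ p D′ * powQ Q k′ ≡ y
      p^D′*Q^k′ = p^m*Qⁿ j k′ refl

      poch-front : ∀ u → pochQ (p * u) D ≡ (1ℚ - p * u) * pochQ u D′
      poch-front u = trans (cong (pochQ (p * u)) (sym D≡)) (pochQ-p u D′)

      α-D : pochQ α D ≡ Z * H
      α-D = cong (pochQ α) (sym D≡)

    β : ℚ
    β = - (Γ * y * x * x)

    g⁺ g⁻ g± : ℚ
    g⁺ = a * a * (b - 1ℚ) * (1ℚ + a * b + b * E - b) * (1ℚ + E * b)
    g⁻ = - (b * b * (1ℚ - a) * (E + a * b * E + a - a * E) * (a + E))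
    g± = a * b * (b - 1ℚ) * (1ℚ - a) * (a + E) * (1ℚ + E * b)

    w⁺-middle : w⁺ k ≡ β * g⁺
    w⁺-middle = begin
      w⁺ k
        ≡⟨ cong₂ (λ u v → - 1ℚ * s * u * ε * pochQ (qpow (+ 1 ℤ.- + D)) k * (1ℚ + powQ Q D + qpow (+ D ℤ.- + k) * E - qpow (+ D ℤ.- + k)) * v)
             (qpow-w⁺ k j k+j≡D) inverse ⟩
      - 1ℚ * s * r * ε * pochQ (qpow (+ 1 ℤ.- + D)) k * (1ℚ + powQ Q D + qpow (+ D ℤ.- + k) * E - qpow (+ D ℤ.- + k)) * (H * J)
        ≡⟨ cong₂ (λ u v → - 1ℚ * s * r * ε * u * v * (H * J))
             (trans (poch-1-D k) (cong (λ t → T * (1ℚ - t)) p^D′*Q^k′))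
             (cong₂ (λ u v → 1ℚ + u + v * E - v) (Q^D k j k+j≡D) (qpow-complement k j k+j≡D)) ⟩
      - 1ℚ * s * r * ε * (T * (1ℚ - y)) * (1ℚ + a * b + b * E - b) * (H * J)
        ≡⟨ cong (λ t → - 1ℚ * s * r * ε * (T * (1ℚ - y)) * (1ℚ + a * b + b * E - b) * (t * J)) (sym H≡) ⟩
      - 1ℚ * s * r * ε * (T * (1ℚ - y)) * (1ℚ + a * b + b * E - b) * ((1ℚ + E * b) * J)
        ≡⟨ identity s r ε T J a x b y (1ℚ + a * b + b * E - b) (1ℚ + E * b) ⟩
      β * g⁺ + (b * y - 1ℚ) * c₁ + (a * x - 1ℚ) * c₂
        ≡⟨ modulo₂ (β * g⁺) c₁ c₂ b*y a*x ⟩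
      β * g⁺ ∎
      where
      open ≡-Reasoning
      c₁ c₂ : ℚ
      c₁ = Γ * (1ℚ + a * b + b * E - b) * (1ℚ + E * b) * (a * x * (a * x))
      c₂ = Γ * (1ℚ + a * b + b * E - b) * (1ℚ + E * b) * ((1ℚ - y) * (a * x + 1ℚ))
      identity : ∀ s r ε T J a x b y G H →
        - 1ℚ * s * r * ε * (T * (1ℚ - y)) * G * (H * J) ≡
        - (s * r * ε * T * J * y * x * x) * (a * a * (b - 1ℚ) * G * H)
          + (b * y - 1ℚ) * (s * r * ε * T * J * G * H * (a * x * (a * x)))
          + (a * x - 1ℚ) * (s * r * ε * T * J * G * H * ((1ℚ - y) * (a * x + 1ℚ)))
      identity = solve-∀ ℚ-ring
      inverse : inv (pochQ Q k * negPoch (ℤ.- + k) D * (1ℚ + qpow (+ D ℤ.- + 2 ℤ.* + k) * E)) ≡ H * J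
      inverse = inv-factor (pochQ Q k * negPoch (ℤ.- + k) D * (1ℚ + qpow (+ D ℤ.- + 2 ℤ.* + k) * E)) H den (trans
        (cong₂ (λ u v → pochQ Q k * u * (1ℚ + v * E) * H) (trans (negPoch-neg D) (poch-front α)) (qpow-denominator k j k+j≡D))
        (regroup (pochQ Q k) F Z V H)) den≢0
        where
        regroup : ∀ A F Z V H → A * (F * Z) * V * H ≡ A * (F * (Z * H)) * V
        regroup = solve-∀ ℚ-ring

    w±-middle : w± k ≡ β * g±
    w±-middle = begin
      w± k
        ≡⟨ cong₂ (λ u v → - 1ℚ * s * u * ε * pochQ (qpow (+ 1 ℤ.- + D)) k * v) (qpow-w± k j k+j≡D) inverse ⟩
      - 1ℚ * s * (r * b) * ε * pochQ (qpow (+ 1 ℤ.- + D)) k * ((1ℚ - a) * F * H * J)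
        ≡⟨ cong (λ t → - 1ℚ * s * (r * b) * ε * t * ((1ℚ - a) * F * H * J))
             (trans (poch-1-D k) (cong (λ t → T * (1ℚ - t)) p^D′*Q^k′)) ⟩
      - 1ℚ * s * (r * b) * ε * (T * (1ℚ - y)) * ((1ℚ - a) * F * H * J)
        ≡⟨ cong₂ (λ t u → - 1ℚ * s * (r * b) * ε * (T * (1ℚ - y)) * ((1ℚ - a) * t * u * J)) (sym F≡) (sym H≡) ⟩
      - 1ℚ * s * (r * b) * ε * (T * (1ℚ - y)) * ((1ℚ - a) * (1ℚ + E * x) * (1ℚ + E * b) * J)
        ≡⟨ identity s r ε T J a x b y E (1ℚ + E * b) ⟩
      β * g± + (b * y - 1ℚ) * c₁ + (a * x - 1ℚ) * c₂
        ≡⟨ modulo₂ (β * g±) c₁ c₂ b*y a*x ⟩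
      β * g± ∎
      where
      open ≡-Reasoning
      c₁ c₂ : ℚ
      c₁ = Γ * (1ℚ + E * b) * (1ℚ - a) * (b * (1ℚ + E * x))
      c₂ = Γ * (1ℚ + E * b) * (1ℚ - a) * (b * y * (b - 1ℚ) * (a * x + 1ℚ + E * x))
      identity : ∀ s r ε T J a x b y E H →
        - 1ℚ * s * (r * b) * ε * (T * (1ℚ - y)) * ((1ℚ - a) * (1ℚ + E * x) * H * J) ≡
        - (s * r * ε * T * J * y * x * x) * (a * b * (b - 1ℚ) * (1ℚ - a) * (a + E) * H)
          + (b * y - 1ℚ) * (s * r * ε * T * J * H * (1ℚ - a) * (b * (1ℚ + E * x)))
          + (a * x - 1ℚ) * (s * r * ε * T * J * H * (1ℚ - a) * (b * y * (b - 1ℚ) * (a * x + 1ℚ + E * x)))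
      identity = solve-∀ ℚ-ring
      inverse : inv (pochQ Q k′ * negPoch (+ 1 ℤ.- + k) (D ℕ.∸ 1) * (1ℚ + qpow (+ D ℤ.- + 2 ℤ.* + k) * E))
        ≡ (1ℚ - a) * F * H * J
      inverse = inv-factor (pochQ Q k′ * negPoch (+ 1 ℤ.- + k) (D ℕ.∸ 1) * (1ℚ + qpow (+ D ℤ.- + 2 ℤ.* + k) * E))
        ((1ℚ - a) * F * H) den (trans
        (cong₂ (λ u v → pochQ Q k′ * u * (1ℚ + v * E) * ((1ℚ - a) * F * H))
          (trans (negPoch-1- (D ℕ.∸ 1)) (cong (λ t → pochQ α (t ℕ.∸ 1)) (sym D≡))) (qpow-denominator k j k+j≡D))
        (regroup (pochQ Q k′) Z V (1ℚ - a) F H)) den≢0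
        where
        regroup : ∀ A Z V u F H → A * Z * V * (u * F * H) ≡ A * u * (F * (Z * H)) * V
        regroup = solve-∀ ℚ-ring

    w⁻-middle : w⁻ k ≡ β * g⁻
    w⁻-middle = begin
      w⁻ k
        ≡⟨ if-false (trans (cong (k ℕ.≡ᵇ_) (sym k+j≡D)) (≡ᵇ-+-suc k j′)) ⟩
      s * qpow (+ k ℤ.* (+ D ℤ.- + k ℤ.- + 2) ℤ.+ + D) * (E * ε) * pochQ (qpow (+ 1 ℤ.- + D)) k′
        * (1ℚ + powQ Q D + a * e - a)
        * inv (pochQ Q k′ * negPoch (+ 1 ℤ.- + k) D * (1ℚ + qpow (+ D ℤ.- + 2 ℤ.* + k) * E))
        ≡⟨ cong₂ (λ u v → s * u * (E * ε) * pochQ (qpow (+ 1 ℤ.- + D)) k′ * (1ℚ + powQ Q D + a * e - a) * v)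
             (qpow-w⁻ k j k+j≡D) inverse ⟩
      s * (r * b * x) * (E * ε) * pochQ (qpow (+ 1 ℤ.- + D)) k′ * (1ℚ + powQ Q D + a * e - a) * ((1ℚ - a) * F * J)
        ≡⟨ cong₂ (λ u v → s * (r * b * x) * (E * ε) * u * (1ℚ + v + a * e - a) * ((1ℚ - a) * F * J))
             (poch-1-D k′) (Q^D k j k+j≡D) ⟩
      s * (r * b * x) * (E * ε) * T * (1ℚ + a * b + a * e - a) * ((1ℚ - a) * F * J)
        ≡⟨ cong (λ t → s * (r * b * x) * (E * ε) * T * (1ℚ + a * b + a * e - a) * ((1ℚ - a) * t * J)) (sym F≡) ⟩
      s * (r * b * x) * (E * ε) * T * (1ℚ + a * b + a * e - a) * ((1ℚ - a) * (1ℚ + E * x) * J)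
        ≡⟨ identity s r ε T J a x b y E e ⟩
      β * g⁻ + (b * y - 1ℚ) * c₁ + (a * x - 1ℚ) * c₂ + (E * e - 1ℚ) * c₃
        ≡⟨ trans (modulo (β * g⁻ + (b * y - 1ℚ) * c₁ + (a * x - 1ℚ) * c₂) c₃ E*e)
             (modulo₂ (β * g⁻) c₁ c₂ b*y a*x) ⟩
      β * g⁻ ∎
      where
      open ≡-Reasoning
      c₁ c₂ c₃ : ℚ
      c₁ = - (Γ * (1ℚ - a) * (E + a * b * E + a - a * E) * b * x * (a * x + E * x))
      c₂ = - (Γ * (1ℚ - a) * (E + a * b * E + a - a * E) * b * x)
      c₃ = Γ * (1ℚ - a) * a * b * x * (1ℚ + E * x)
      identity : ∀ s r ε T J a x b y E e →
        s * (r * b * x) * (E * ε) * T * (1ℚ + a * b + a * e - a) * ((1ℚ - a) * (1ℚ + E * x) * J) ≡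
        - (s * r * ε * T * J * y * x * x) * - (b * b * (1ℚ - a) * (E + a * b * E + a - a * E) * (a + E))
          + (b * y - 1ℚ) * - (s * r * ε * T * J * (1ℚ - a) * (E + a * b * E + a - a * E) * b * x * (a * x + E * x))
          + (a * x - 1ℚ) * - (s * r * ε * T * J * (1ℚ - a) * (E + a * b * E + a - a * E) * b * x)
          + (E * e - 1ℚ) * (s * r * ε * T * J * (1ℚ - a) * a * b * x * (1ℚ + E * x))
      identity = solve-∀ ℚ-ring
      inverse : inv (pochQ Q k′ * negPoch (+ 1 ℤ.- + k) D * (1ℚ + qpow (+ D ℤ.- + 2 ℤ.* + k) * E))
        ≡ (1ℚ - a) * F * J
      inverse = inv-factor (pochQ Q k′ * negPoch (+ 1 ℤ.- + k) D * (1ℚ + qpow (+ D ℤ.- + 2 ℤ.* + k) * E))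
        ((1ℚ - a) * F) den (trans
        (cong₂ (λ u v → pochQ Q k′ * u * (1ℚ + v * E) * ((1ℚ - a) * F))
          (trans (negPoch-1- D) α-D) (qpow-denominator k j k+j≡D))
        (regroup (pochQ Q k′) Z V (1ℚ - a) F H)) den≢0
        where
        regroup : ∀ A Z V u F H → A * (Z * H) * V * (u * F) ≡ A * u * (F * (Z * H)) * V
        regroup = solve-∀ ℚ-ring

    ω-middle : ω k ≡ β * (a * b * E * (a * b - 1ℚ) * (a + E * b))
    ω-middle = begin
      ω k
        ≡⟨ cong₂ (λ u v → M * (- 1ℚ * s) * powQ Q (k ℕ.* u) * ε * v * inv (pochQ Q k * pochQ (- (E * x)) (suc D)))
             D∸k (trans (cong (λ t → pochQ t k) (cong (powQ p) (sym D≡))) (pochQ-p (powQ p D′) k′)) ⟩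
      M * (- 1ℚ * s) * r * ε * ((1ℚ - powQ p (suc D′)) * T) * inv (pochQ Q k * pochQ (- (E * x)) (suc D))
        ≡⟨ cong₂ (λ u v → u * (- 1ℚ * s) * r * ε * ((1ℚ - powQ p (suc D′)) * T) * v)
             (cong (_* E) (Q^D k j k+j≡D)) inverse ⟩
      a * b * E * (- 1ℚ * s) * r * ε * ((1ℚ - powQ p (suc D′)) * T) * (V * J)
        ≡⟨ cong (λ t → a * b * E * (- 1ℚ * s) * r * ε * ((1ℚ - t) * T) * (V * J)) (powQ-+ p k j) ⟩
      a * b * E * (- 1ℚ * s) * r * ε * ((1ℚ - x * y) * T) * ((1ℚ + b * x * E) * J)
        ≡⟨ identity s r ε T J a x b y E ⟩
      rhs + (b * y - 1ℚ) * c₁ + (a * x - 1ℚ) * c₂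
        ≡⟨ modulo₂ rhs c₁ c₂ b*y a*x ⟩
      rhs ∎
      where
      open ≡-Reasoning
      rhs c₁ c₂ : ℚ
      rhs = β * (a * b * E * (a * b - 1ℚ) * (a + E * b))
      c₁ = Γ * E * (a * x) * (1ℚ + b * x * E + (a * b - 1ℚ) * (a * x + b * x * E))
      c₂ = Γ * E * (1ℚ + b * x * E + (a * b - 1ℚ) * (a * x + b * x * E + 1ℚ))
      identity : ∀ s r ε T J a x b y E →
        a * b * E * (- 1ℚ * s) * r * ε * ((1ℚ - x * y) * T) * ((1ℚ + b * x * E) * J) ≡
        - (s * r * ε * T * J * y * x * x) * (a * b * E * (a * b - 1ℚ) * (a + E * b))
          + (b * y - 1ℚ) * (s * r * ε * T * J * E * (a * x) * (1ℚ + b * x * E + (a * b - 1ℚ) * (a * x + b * x * E)))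
          + (a * x - 1ℚ) * (s * r * ε * T * J * E * (1ℚ + b * x * E + (a * b - 1ℚ) * (a * x + b * x * E + 1ℚ)))
      identity = solve-∀ ℚ-ring
      D∸k : D ℕ.∸ k ≡ j
      D∸k = trans (cong (ℕ._∸ k) (sym k+j≡D)) (ℕ.m+n∸m≡n k j)
      inverse : inv (pochQ Q k * pochQ (- (E * x)) (suc D)) ≡ V * J
      inverse = inv-factor (pochQ Q k * pochQ (- (E * x)) (suc D)) V den 
        (cong (λ t → pochQ Q k * t * V) (trans (cong (λ t → pochQ t (suc D)) (lemma E p (powQ p k′)))
          (trans (pochQ-p α D) (cong (F *_) α-D)))) den≢0
        where
        lemma : ∀ E p x → - (E * (p * x)) ≡ p * - (E * x)
        lemma = solve-∀ ℚ-ring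

    P⁺ P⁻ : ℚ
    P⁺ = - ((1ℚ - x) * y * (x - c))
    P⁻ = x * ((1ℚ - c * y) * (1ℚ - y))

    private
      μ p⁺ p⁻ : ℚ
      μ = x * x * y * y * e
      p⁺ = - (b * (a - 1ℚ) * (a + E))
      p⁻ = a * (b * E + 1ℚ) * (b - 1ℚ)

      P⁺≡ : P⁺ ≡ μ * p⁺
      P⁺≡ = trans (identity x y a b E e)
        (trans (modulo (μ * p⁺ + (b * y - 1ℚ) * c₁ + (a * x - 1ℚ) * c₂) ((1ℚ - x) * y * x) E*e)
          (modulo₂ (μ * p⁺) c₁ c₂ b*y a*x))
        where
        c₁ c₂ : ℚ
        c₁ = (1ℚ - x) * y * (x * e * (a + E))
        c₂ = y * y * b * (x * e * (a + E)) + (1ℚ - x) * y * e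
        identity : ∀ x y a b E e → - ((1ℚ - x) * y * (x - - e)) ≡
          x * x * y * y * e * - (b * (a - 1ℚ) * (a + E))
            + (b * y - 1ℚ) * ((1ℚ - x) * y * (x * e * (a + E)))
            + (a * x - 1ℚ) * (y * y * b * (x * e * (a + E)) + (1ℚ - x) * y * e)
            + (E * e - 1ℚ) * ((1ℚ - x) * y * x)
        identity = solve-∀ ℚ-ring

      P⁻≡ : P⁻ ≡ μ * p⁻
      P⁻≡ = trans (identity x y a b E e)
        (trans (modulo (μ * p⁻ + (b * y - 1ℚ) * c₁ + (a * x - 1ℚ) * c₂) (- (x * (1ℚ - y))) E*e)
          (modulo₂ (μ * p⁻) c₁ c₂ b*y a*x))
        where
        c₁ c₂ : ℚ
        c₁ = - (x * (y * e * (b * E + 1ℚ)) + x * (1ℚ - y) * (E * e))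
        c₂ = - (x * (y * (b - 1ℚ)) * (y * e * (b * E + 1ℚ)))
        identity : ∀ x y a b E e → x * ((1ℚ - - e * y) * (1ℚ - y)) ≡
          x * x * y * y * e * (a * (b * E + 1ℚ) * (b - 1ℚ))
            + (b * y - 1ℚ) * - (x * (y * e * (b * E + 1ℚ)) + x * (1ℚ - y) * (E * e))
            + (a * x - 1ℚ) * - (x * (y * (b - 1ℚ)) * (y * e * (b * E + 1ℚ)))
            + (E * e - 1ℚ) * - (x * (1ℚ - y))
        identity = solve-∀ ℚ-ring

      W≡ : (x - c * y) * ω k ≡ β * ((a + b * E) * (a + b * E) * (a * b - 1ℚ))
      W≡ = trans (cong ((x - c * y) *_) ω-middle) (trans (identity x y a b E e β)
        (trans (modulo (rhs + (b * y - 1ℚ) * c₁ + (a * x - 1ℚ) * c₂) (t * a) E*e)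
          (modulo₂ rhs c₁ c₂ b*y a*x)))
        where
        rhs t c₁ c₂ : ℚ
        t = β * (a * b - 1ℚ) * (a + E * b)
        rhs = β * ((a + b * E) * (a + b * E) * (a * b - 1ℚ))
        c₁ = t * (a * (E * e))
        c₂ = t * (b * E)
        identity : ∀ x y a b E e β →
          (x - - e * y) * (β * (a * b * E * (a * b - 1ℚ) * (a + E * b))) ≡
          β * ((a + b * E) * (a + b * E) * (a * b - 1ℚ))
            + (b * y - 1ℚ) * (β * (a * b - 1ℚ) * (a + E * b) * (a * (E * e)))
            + (a * x - 1ℚ) * (β * (a * b - 1ℚ) * (a + E * b) * (b * E))
            + (E * e - 1ℚ) * (β * (a * b - 1ℚ) * (a + E * b) * a)
        identity = solve-∀ ℚ-ring

      middle-cong : ∀ (f : ℚ → ℚ → ℚ → ℚ) → f (w⁺ k) (w⁻ k) (w± k) ≡ f (β * g⁺) (β * g⁻) (β * g±)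
      middle-cong f = trans (cong (λ u → f u (w⁻ k) (w± k)) w⁺-middle)
        (cong₂ (f (β * g⁺)) w⁻-middle w±-middle)

    even-even : w⁺ k + w⁻ k + (w± k + w± k) ≡ (x - c * y) * ω k
    even-even = trans (middle-cong (λ u v w → u + v + (w + w))) (trans (identity a b E β) (sym W≡))
      where
      identity : ∀ a b E β →
        β * (a * a * (b - 1ℚ) * (1ℚ + a * b + b * E - b) * (1ℚ + E * b))
        + β * - (b * b * (1ℚ - a) * (E + a * b * E + a - a * E) * (a + E))
        + (β * (a * b * (b - 1ℚ) * (1ℚ - a) * (a + E) * (1ℚ + E * b)) + β * (a * b * (b - 1ℚ) * (1ℚ - a) * (a + E) * (1ℚ + E * b)))
        ≡ β * ((a + b * E) * (a + b * E) * (a * b - 1ℚ))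
      identity = solve-∀ ℚ-ring

    even-odd : P⁺ * (w⁺ k + w± k) + P⁻ * (w⁻ k + w± k) ≡ 0ℚ
    even-odd = trans (cong₂ (λ P P′ → P * (w⁺ k + w± k) + P′ * (w⁻ k + w± k)) P⁺≡ P⁻≡)
      (trans (middle-cong (λ u v w → μ * p⁺ * (u + w) + μ * p⁻ * (v + w))) (identity a b E β μ))
      where
      identity : ∀ a b E β μ →
        μ * - (b * (a - 1ℚ) * (a + E)) * (β * (a * a * (b - 1ℚ) * (1ℚ + a * b + b * E - b) * (1ℚ + E * b))
            + β * (a * b * (b - 1ℚ) * (1ℚ - a) * (a + E) * (1ℚ + E * b)))
        + μ * (a * (b * E + 1ℚ) * (b - 1ℚ)) * (β * - (b * b * (1ℚ - a) * (E + a * b * E + a - a * E) * (a + E))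
            + β * (a * b * (b - 1ℚ) * (1ℚ - a) * (a + E) * (1ℚ + E * b))) ≡ 0ℚ
      identity = solve-∀ ℚ-ring

    odd-odd : P⁺ * P⁺ * w⁺ k + P⁻ * P⁻ * w⁻ k + (P⁺ * P⁻ * w± k + P⁺ * P⁻ * w± k) ≡
      (x - c * y) * ω k * ((1ℚ - x) * (1ℚ - c * y) * (1ℚ - y) * (x - c))
    odd-odd = begin
      P⁺ * P⁺ * w⁺ k + P⁻ * P⁻ * w⁻ k + (P⁺ * P⁻ * w± k + P⁺ * P⁻ * w± k)
        ≡⟨ cong₂ (λ P P′ → P * P * w⁺ k + P′ * P′ * w⁻ k + (P * P′ * w± k + P * P′ * w± k)) P⁺≡ P⁻≡ ⟩
      μ * p⁺ * (μ * p⁺) * w⁺ k + μ * p⁻ * (μ * p⁻) * w⁻ k + (μ * p⁺ * (μ * p⁻) * w± k + μ * p⁺ * (μ * p⁻) * w± k)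
        ≡⟨ middle-cong (λ u v w → μ * p⁺ * (μ * p⁺) * u + μ * p⁻ * (μ * p⁻) * v + (μ * p⁺ * (μ * p⁻) * w + μ * p⁺ * (μ * p⁻) * w)) ⟩
      μ * p⁺ * (μ * p⁺) * (β * g⁺) + μ * p⁻ * (μ * p⁻) * (β * g⁻) + (μ * p⁺ * (μ * p⁻) * (β * g±) + μ * p⁺ * (μ * p⁻) * (β * g±))
        ≡⟨ identity a b E β μ ⟩
      β * ((a + b * E) * (a + b * E) * (a * b - 1ℚ)) * - (μ * p⁺ * (μ * p⁻) * a * b)
        ≡⟨ cong₂ _*_ (sym W≡) (cong₂ (λ P P′ → - (P * P′ * a * b)) (sym P⁺≡) (sym P⁻≡)) ⟩
      (x - c * y) * ω k * - (P⁺ * P⁻ * a * b)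
        ≡⟨ cong ((x - c * y) * ω k *_) (trans (identity′ x y a b c) (modulo₂ n (n * (a * x)) n b*y a*x)) ⟩
      (x - c * y) * ω k * n ∎
      where
      open ≡-Reasoning
      n : ℚ
      n = (1ℚ - x) * (1ℚ - c * y) * (1ℚ - y) * (x - c)
      identity′ : ∀ x y a b c → - (- ((1ℚ - x) * y * (x - c)) * (x * ((1ℚ - c * y) * (1ℚ - y))) * a * b) ≡
        (1ℚ - x) * (1ℚ - c * y) * (1ℚ - y) * (x - c)
          + (b * y - 1ℚ) * ((1ℚ - x) * (1ℚ - c * y) * (1ℚ - y) * (x - c) * (a * x))
          + (a * x - 1ℚ) * ((1ℚ - x) * (1ℚ - c * y) * (1ℚ - y) * (x - c))
      identity′ = solve-∀ ℚ-ring
      identity : ∀ a b E β μ →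
        let p⁺ = - (b * (a - 1ℚ) * (a + E))
            p⁻ = a * (b * E + 1ℚ) * (b - 1ℚ) in
        μ * p⁺ * (μ * p⁺) * (β * (a * a * (b - 1ℚ) * (1ℚ + a * b + b * E - b) * (1ℚ + E * b)))
        + μ * p⁻ * (μ * p⁻) * (β * - (b * b * (1ℚ - a) * (E + a * b * E + a - a * E) * (a + E)))
        + (μ * p⁺ * (μ * p⁻) * (β * (a * b * (b - 1ℚ) * (1ℚ - a) * (a + E) * (1ℚ + E * b)))
           + μ * p⁺ * (μ * p⁻) * (β * (a * b * (b - 1ℚ) * (1ℚ - a) * (a + E) * (1ℚ + E * b))))
        ≡ β * ((a + b * E) * (a + b * E) * (a * b - 1ℚ)) * - (μ * p⁺ * (μ * p⁻) * a * b)
      identity = solve-∀ ℚ-ring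

  -- The weight of the polynomials with parameter D - 2, at the point k - 1.
  ω⊥ : ℕ → ℚ
  ω⊥ k′ = p * ω (suc k′) * ((1ℚ - powQ p (suc k′)) * (1ℚ - c * powQ p (D ℕ.∸ suc k′))
          * (1ℚ - powQ p (D ℕ.∸ suc k′)) * (powQ p (suc k′) - c))

  ω⊥-recurrence : ∀ k j → suc k ℕ.+ suc (suc j) ≡ D →
    ω⊥ (suc k) * (c * (powQ p j * powQ p j) * (powQ p (suc k) - c) * (1ℚ - powQ p (suc k))) ≡
    - (ω⊥ k * (powQ p k * powQ p k * (1ℚ - powQ p (suc j)) * (1ℚ - c * powQ p (suc j))))
  ω⊥-recurrence k j k+j≡D = *-cancelˡ (*-≢0 (pos⇒≢0 0<p) (pos⇒≢0 0<p)) (begin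
    p * p * (ω⊥ (suc k) * (c * (y * y) * (p * x - c) * (1ℚ - p * x)))
      ≡⟨ cong (λ t → p * p * (p * ω (suc (suc k)) * ((1ℚ - p * (p * x)) * (1ℚ - c * t) * (1ℚ - t) * (p * (p * x) - c))
           * (c * (y * y) * (p * x - c) * (1ℚ - p * x)))) (cong (powQ p) D∸k+2) ⟩
    p * p * (p * ω (suc (suc k)) * ((1ℚ - p * (p * x)) * (1ℚ - c * (p * y)) * (1ℚ - p * y) * (p * (p * x) - c))
      * (c * (y * y) * (p * x - c) * (1ℚ - p * x)))
      ≡⟨ regroup p (ω (suc (suc k))) x y c ⟩
    ω (suc (suc k)) * (c * (p * y * (p * y)) * (p * (p * x) - c) * (1ℚ - p * (p * x)))
      * (p * ((1ℚ - c * (p * y)) * (1ℚ - p * y) * (p * x - c) * (1ℚ - p * x)))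
      ≡⟨ cong (_* (p * ((1ℚ - c * (p * y)) * (1ℚ - p * y) * (p * x - c) * (1ℚ - p * x)))) (ω-recurrence (suc k) (suc j) k+j≡D) ⟩
    - (ω (suc k) * (p * x * (p * x) * (1ℚ - p * (p * y)) * (1ℚ - c * (p * (p * y)))))
      * (p * ((1ℚ - c * (p * y)) * (1ℚ - p * y) * (p * x - c) * (1ℚ - p * x)))
      ≡⟨ regroup′ p (ω (suc k)) x y c ⟩
    p * p * - (p * ω (suc k) * ((1ℚ - p * x) * (1ℚ - c * (p * (p * y))) * (1ℚ - p * (p * y)) * (p * x - c))
      * (x * x * (1ℚ - p * y) * (1ℚ - c * (p * y))))
      ≡⟨ cong (λ t → p * p * - (p * ω (suc k) * ((1ℚ - p * x) * (1ℚ - c * t) * (1ℚ - t) * (p * x - c))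
           * (x * x * (1ℚ - p * y) * (1ℚ - c * (p * y))))) (cong (powQ p) (sym D∸k+1)) ⟩
    p * p * - (ω⊥ k * (x * x * (1ℚ - p * y) * (1ℚ - c * (p * y)))) ∎)
    where
    open ≡-Reasoning
    x y : ℚ
    x = powQ p k
    y = powQ p j
    D∸k+1 : D ℕ.∸ suc k ≡ suc (suc j)
    D∸k+1 = trans (cong (ℕ._∸ suc k) (sym k+j≡D)) (ℕ.m+n∸m≡n (suc k) (suc (suc j)))
    D∸k+2 : D ℕ.∸ suc (suc k) ≡ suc j
    D∸k+2 = trans (cong (ℕ._∸ suc (suc k)) (trans (sym k+j≡D) (ℕ.+-suc (suc k) (suc j)))) (ℕ.m+n∸m≡n (suc (suc k)) (suc j))
    regroup : ∀ p w x y c →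
      p * p * (p * w * ((1ℚ - p * (p * x)) * (1ℚ - c * (p * y)) * (1ℚ - p * y) * (p * (p * x) - c))
        * (c * (y * y) * (p * x - c) * (1ℚ - p * x))) ≡
      w * (c * (p * y * (p * y)) * (p * (p * x) - c) * (1ℚ - p * (p * x)))
        * (p * ((1ℚ - c * (p * y)) * (1ℚ - p * y) * (p * x - c) * (1ℚ - p * x)))
    regroup = solve-∀ ℚ-ring
    regroup′ : ∀ p w x y c →
      - (w * (p * x * (p * x) * (1ℚ - p * (p * y)) * (1ℚ - c * (p * (p * y)))))
        * (p * ((1ℚ - c * (p * y)) * (1ℚ - p * y) * (p * x - c) * (1ℚ - p * x))) ≡
      p * p * - (p * w * ((1ℚ - p * x) * (1ℚ - c * (p * (p * y))) * (1ℚ - p * (p * y)) * (p * x - c))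
        * (x * x * (1ℚ - p * y) * (1ℚ - c * (p * y))))
    regroup′ = solve-∀ ℚ-ring

  total-weight⊥ : ∀ d → suc (suc d) ≡ D →
    (powQ p d - c * 1ℚ) * ω⊥ d * pochQ c d ≡ - (c * (1ℚ - powQ p D) * (1ℚ - powQ p (suc d)))
  total-weight⊥ d refl = begin
    (x - c * 1ℚ) * ω⊥ d * C
      ≡⟨ cong (λ t → (x - c * 1ℚ) * (p * w * ((1ℚ - p * x) * (1ℚ - c * t) * (1ℚ - t) * (p * x - c))) * C)
           (cong (powQ p) (ℕ.m+n∸n≡m 1 (suc d))) ⟩
    (x - c * 1ℚ) * (p * w * ((1ℚ - p * x) * (1ℚ - c * (p * 1ℚ)) * (1ℚ - p * 1ℚ) * (p * x - c))) * C
      ≡⟨ identity₁ p x X Q c w C ⟩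
    w * (p * x * (p * x) * (1ℚ - p * 1ℚ) * (1ℚ - c * (p * 1ℚ))) * (1ℚ - p * x) * (C * (1ℚ - c * X) * (1ℚ - c * (Q * X)))
      + (X * x - 1ℚ) * c₁ + (Q * p - 1ℚ) * c₂
      ≡⟨ modulo₂ (w * (p * x * (p * x) * (1ℚ - p * 1ℚ) * (1ℚ - c * (p * 1ℚ))) * (1ℚ - p * x) * pochQ c D) c₁ c₂ (Qⁿ*pⁿ d) Q*p ⟩
    w * (p * x * (p * x) * (1ℚ - p * 1ℚ) * (1ℚ - c * (p * 1ℚ))) * (1ℚ - p * x) * pochQ c D
      ≡⟨ regroup (w * (p * x * (p * x) * (1ℚ - p * 1ℚ) * (1ℚ - c * (p * 1ℚ)))) (1ℚ - p * x) (pochQ c D) ⟩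
    - (- (w * (p * x * (p * x) * (1ℚ - p * 1ℚ) * (1ℚ - c * (p * 1ℚ))))) * (1ℚ - p * x) * pochQ c D
      ≡⟨ cong (λ t → - t * (1ℚ - p * x) * pochQ c D) (sym (ω-recurrence (suc d) 0 (ℕ.+-comm (suc d) 1))) ⟩
    - (ω D * (c * (1ℚ * 1ℚ) * (p * (p * x) - c) * (1ℚ - p * (p * x)))) * (1ℚ - p * x) * pochQ c D
      ≡⟨ regroup′ (ω D) c p x (pochQ c D) ⟩
    - (c * (1ℚ - p * (p * x)) * (1ℚ - p * x)) * ((p * (p * x) - c * 1ℚ) * ω D * pochQ c D)
      ≡⟨ trans (cong (- (c * (1ℚ - p * (p * x)) * (1ℚ - p * x)) *_) total-weight) (ℚ.*-identityʳ (- (c * (1ℚ - p * (p * x)) * (1ℚ - p * x)))) ⟩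
    - (c * (1ℚ - powQ p D) * (1ℚ - powQ p (suc d))) ∎
    where
    open ≡-Reasoning
    x X w C c₁ c₂ : ℚ
    x = powQ p d
    X = powQ Q d
    w = ω (suc d)
    C = pochQ c d
    c₁ = p * w * ((1ℚ - p * x) * (1ℚ - c * (p * 1ℚ)) * (1ℚ - p * 1ℚ)) * C * (c * (p * x - c) + x * (1ℚ - c * X) * (c * (Q * p)))
    c₂ = p * w * ((1ℚ - p * x) * (1ℚ - c * (p * 1ℚ)) * (1ℚ - p * 1ℚ)) * C * (x * (1ℚ - c * X) * c)
    regroup : ∀ u v C → u * v * C ≡ - (- u) * v * C
    regroup = solve-∀ ℚ-ring
    regroup′ : ∀ w c p x C → - (w * (c * (1ℚ * 1ℚ) * (p * (p * x) - c) * (1ℚ - p * (p * x)))) * (1ℚ - p * x) * C ≡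
      - (c * (1ℚ - p * (p * x)) * (1ℚ - p * x)) * ((p * (p * x) - c * 1ℚ) * w * C)
    regroup′ = solve-∀ ℚ-ring
    identity₁ : ∀ p x X Q c w C →
      (x - c * 1ℚ) * (p * w * ((1ℚ - p * x) * (1ℚ - c * (p * 1ℚ)) * (1ℚ - p * 1ℚ) * (p * x - c))) * C ≡
      w * (p * x * (p * x) * (1ℚ - p * 1ℚ) * (1ℚ - c * (p * 1ℚ))) * (1ℚ - p * x) * (C * (1ℚ - c * X) * (1ℚ - c * (Q * X)))
        + (X * x - 1ℚ) * (p * w * ((1ℚ - p * x) * (1ℚ - c * (p * 1ℚ)) * (1ℚ - p * 1ℚ)) * C * (c * (p * x - c) + x * (1ℚ - c * X) * (c * (Q * p))))
        + (Q * p - 1ℚ) * (p * w * ((1ℚ - p * x) * (1ℚ - c * (p * 1ℚ)) * (1ℚ - p * 1ℚ)) * C * (x * (1ℚ - c * X) * c))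
    identity₁ = solve-∀ ℚ-ring

-- The Gram matrix in rational coordinates

module Coordinates (q D d : ℕ) (E : ℚ) (1<q : 1 ℕ.< q) (0<E : 0ℚ ℚ.< E) (d+2≡D : suc (suc d) ≡ D) where

  open Dual q D E using (pochQ; M; w⁺; w⁻; Nfac; N) renaming (qQ to Q; c to w±)
  open Krawtchouk q D E 1<q
  open Weights q D E 1<q 0<E

  0<M : 0ℚ ℚ.< M
  0<M = *-pos (powQ-pos D 0<Q) 0<E

  m : ℚ
  m = inv M

  M*m : M * m ≡ 1ℚ
  M*m = *-inv (pos⇒≢0 0<M)

  α ρ : Sign → ℕ → ℚ
  α plus i = powQ (- M) (suc i) * inv ((1ℚ - powQ Q D) * pochQ Q i)
  α minus i = powQ (- M) i * ((powQ Q D - powQ Q i) * inv ((powQ Q D - 1ℚ) * pochQ Q i))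
  ρ plus i = 1ℚ
  ρ minus i = (1ℚ - powQ Q i) * inv (powQ Q D - powQ Q i)

  ι κ : Sign → ℕ → ℕ
  ι plus i = suc i
  ι minus i = i
  κ plus i = i
  κ minus i = ℕ.pred i

  -- λ_k = u k τ⁻¹ and λ_{-k} = v k τ⁻¹.
  u v : ℕ → ℚ
  u k = - m * powQ Q k
  v k = powQ p k

  X : ℕ → ℕ → ℚ
  X i k = pochQ (powQ p D) i * K c D i k (D ℕ.∸ k)

  Y : ℕ → ℕ → ℚ
  Y i k = powQ p i * (pochQ (powQ p d) i * K c d i (ℕ.pred k) (d ℕ.∸ ℕ.pred k))

  π : ℚ → ℚ → ℚ
  π u v = v * (u + m) * - M * (u - powQ p D)

  m-v : ∀ s v → - m * s * v * - M ≡ s * v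
  m-v s v = trans (identity m M s v) (modulo (s * v) (s * v) M*m)
    where
    identity : ∀ m M s v → - m * s * v * - M ≡ s * v + (M * m - 1ℚ) * (s * v)
    identity = solve-∀ ℚ-ring

  u≡ : ∀ k j → k ℕ.+ j ≡ D → u k ≡ c * powQ p j
  u≡ k j k+j≡D = begin
    - m * a
      ≡⟨ identity₁ m a b E e y ⟩
    - (a * b * E * m * (e * y)) + (b * y - 1ℚ) * (m * a * (E * e)) + (E * e - 1ℚ) * (m * a)
      ≡⟨ modulo₂ (- (a * b * E * m * (e * y))) (m * a * (E * e)) (m * a) (Qⁿ*pⁿ j) E*e ⟩
    - (a * b * E * m * (e * y))
      ≡⟨ cong (λ t → - (t * E * m * (e * y))) (sym (Q^D k j k+j≡D)) ⟩
    - (M * m * (e * y))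
      ≡⟨ cong (λ t → - (t * (e * y))) M*m ⟩
    - (1ℚ * (e * y))
      ≡⟨ identity₂ e y ⟩
    c * y ∎
    where
    open ≡-Reasoning
    a b y : ℚ
    a = powQ Q k
    b = powQ Q j
    y = powQ p j
    identity₁ : ∀ m a b E e y → - m * a ≡
      - (a * b * E * m * (e * y)) + (b * y - 1ℚ) * (m * a * (E * e)) + (E * e - 1ℚ) * (m * a)
    identity₁ = solve-∀ ℚ-ring
    identity₂ : ∀ e y → - (1ℚ * (e * y)) ≡ - e * y
    identity₂ = solve-∀ ℚ-ring

  Q*v : ∀ k → Q * v (suc k) ≡ powQ p k
  Q*v k = trans (identity Q p (powQ p k)) (modulo (powQ p k) (powQ p k) Q*p)
    where
    identity : ∀ q p x → q * (p * x) ≡ x + (q * p - 1ℚ) * x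
    identity = solve-∀ ℚ-ring

  Q*u : ∀ k j → k ℕ.+ j ≡ d → Q * u (suc k) ≡ c * powQ p j
  Q*u k j k+j≡d = trans (cong (Q *_) (u≡ (suc k) (suc j) (trans (cong suc (trans (ℕ.+-suc k j) (cong suc k+j≡d))) d+2≡D)))
    (trans (identity Q p c (powQ p j)) (modulo (c * powQ p j) (c * powQ p j) Q*p))
    where
    identity : ∀ q p c x → q * (c * (p * x)) ≡ c * x + (q * p - 1ℚ) * (c * x)
    identity = solve-∀ ℚ-ring

  π-first : π (u 0) (v 0) ≡ 0ℚ
  π-first = identity m M (powQ p D)
    where
    identity : ∀ m M P → 1ℚ * (- m * 1ℚ + m) * - M * (- m * 1ℚ - P) ≡ 0ℚ
    identity = solve-∀ ℚ-ring

  π-last : π (v D) (u D) ≡ 0ℚ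
  π-last = identity (u D * (v D + m) * - M) (powQ p D)
    where
    identity : ∀ x P → x * (P - P) ≡ 0ℚ
    identity = solve-∀ ℚ-ring

  value⁺ value⁻ : Sign → ℕ → ℕ → ℚ
  value⁺ μ i k = α μ i * (X (ι μ i) k - ρ μ i * (π (u k) (v k) * Y (κ μ i) k))
  value⁻ μ i k = α μ i * (X (ι μ i) k - ρ μ i * (π (v k) (u k) * Y (κ μ i) k))


  private
    module Even = Orthogonality c D ω ω-recurrence
    module Odd = Orthogonality c d ω⊥ (λ k j k+j≡d → ω⊥-recurrence k j
      (trans (cong suc (trans (ℕ.+-suc k (suc j)) (cong suc k+j≡d))) d+2≡D))

    X′ Y′ : ℕ → ℕ → ℕ → ℚ
    X′ i k l = pochQ (powQ p D) i * K c D i k l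
    Y′ i k l = pochQ (powQ p d) i * K c d i k l

  form : (F⁺ F⁻ G⁺ G⁻ : ℕ → ℚ) → ℚ
  form F⁺ F⁻ G⁺ G⁻ =
    sumQ D (λ k → F⁺ k * G⁺ k * w⁺ k) +
    sumQ D (λ k → F⁻ (suc k) * G⁻ (suc k) * w⁻ (suc k)) +
    sumQ (D ℕ.∸ 1) (λ k → (F⁺ (suc k) * G⁻ (suc k) + F⁻ (suc k) * G⁺ (suc k)) * w± (suc k))

  form-split : ∀ F⁺ F⁻ G⁺ G⁻ → form F⁺ F⁻ G⁺ G⁻ ≡
    F⁺ 0 * G⁺ 0 * w⁺ 0 +
    sumQ (suc d) (λ k → F⁺ (suc k) * G⁺ (suc k) * w⁺ (suc k) + F⁻ (suc k) * G⁻ (suc k) * w⁻ (suc k) +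
      (F⁺ (suc k) * G⁻ (suc k) + F⁻ (suc k) * G⁺ (suc k)) * w± (suc k)) +
    F⁻ D * G⁻ D * w⁻ D
  form-split F⁺ F⁻ G⁺ G⁻ = begin
    sumQ D t₁ + sumQ D t₂ + sumQ (D ℕ.∸ 1) t₃
      ≡⟨ cong₂ (λ n m → sumQ n t₁ + sumQ n t₂ + sumQ m t₃) (sym d+2≡D) (cong (ℕ._∸ 1) (sym d+2≡D)) ⟩
    sumQ (suc (suc d)) t₁ + (sumQ (suc d) t₂ + t₂ (suc d)) + sumQ (suc d) t₃
      ≡⟨ cong (λ s → s + (sumQ (suc d) t₂ + t₂ (suc d)) + sumQ (suc d) t₃) (sumQ-head (suc d) t₁) ⟩
    t₁ 0 + sumQ (suc d) (λ k → t₁ (suc k)) + (sumQ (suc d) t₂ + t₂ (suc d)) + sumQ (suc d) t₃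
      ≡⟨ regroup (t₁ 0) (sumQ (suc d) (λ k → t₁ (suc k))) (sumQ (suc d) t₂) (t₂ (suc d)) (sumQ (suc d) t₃) ⟩
    t₁ 0 + (sumQ (suc d) (λ k → t₁ (suc k)) + sumQ (suc d) t₂ + sumQ (suc d) t₃) + t₂ (suc d)
      ≡⟨ cong₂ (λ s z → t₁ 0 + s + z)
           (sym (trans (sumQ-+ (suc d) (λ k → t₁ (suc k) + t₂ k) t₃) (cong (_+ sumQ (suc d) t₃) (sumQ-+ (suc d) (λ k → t₁ (suc k)) t₂))))
           (cong (λ n → F⁻ n * G⁻ n * w⁻ n) d+2≡D) ⟩
    t₁ 0 + sumQ (suc d) (λ k → t₁ (suc k) + t₂ k + t₃ k) + F⁻ D * G⁻ D * w⁻ D ∎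
    where
    open ≡-Reasoning
    t₁ t₂ t₃ : ℕ → ℚ
    t₁ k = F⁺ k * G⁺ k * w⁺ k
    t₂ k = F⁻ (suc k) * G⁻ (suc k) * w⁻ (suc k)
    t₃ k = (F⁺ (suc k) * G⁻ (suc k) + F⁻ (suc k) * G⁺ (suc k)) * w± (suc k)
    regroup : ∀ a b c d e → a + b + (c + d) + e ≡ a + (b + c + e) + d
    regroup = solve-∀ ℚ-ring

  private
    index : ∀ k → k ℕ.≤ d → suc k ℕ.+ suc (d ℕ.∸ k) ≡ D
    index k k≤d = trans (cong suc (trans (ℕ.+-suc k (d ℕ.∸ k)) (cong suc (ℕ.m+[n∸m]≡n k≤d)))) d+2≡D

    index-∸ : ∀ k → k ℕ.≤ d → D ℕ.∸ suc k ≡ suc (d ℕ.∸ k)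
    index-∸ k k≤d = trans (cong (ℕ._∸ suc k) (sym (index k k≤d))) (ℕ.m+n∸m≡n (suc k) (suc (d ℕ.∸ k)))

  module _ (k : ℕ) (k≤d : k ℕ.≤ d) where
    open Middle k (d ℕ.∸ k) (index k k≤d)

    π≡P⁺ : π (u (suc k)) (v (suc k)) ≡ P⁺
    π≡P⁺ = trans (cong₂ (λ s t → x * (u (suc k) + m) * - M * (s - t))
        (u≡ (suc k) (suc (d ℕ.∸ k)) (index k k≤d)) (p^D (suc k) (suc (d ℕ.∸ k)) (index k k≤d)))
      (trans (identity x y a c m M) (modulo₂ P⁺ (y * (c - x)) ((a * x - x) * y * (c - x)) a*x M*m))
      where
      identity : ∀ x y a c m M → x * (- m * a + m) * - M * (c * y - x * y) ≡
        - ((1ℚ - x) * y * (x - c)) + (a * x - 1ℚ) * (y * (c - x)) + (M * m - 1ℚ) * ((a * x - x) * y * (c - x))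
      identity = solve-∀ ℚ-ring

    π≡P⁻ : π (v (suc k)) (u (suc k)) ≡ P⁻
    π≡P⁻ = trans (cong (λ t → - m * a * (x + m) * - M * (x - t)) (p^D (suc k) (suc (d ℕ.∸ k)) (index k k≤d)))
      (trans (identity x y a c m M)
        (trans (modulo (P⁻ + (a * x - 1ℚ) * (x * (1ℚ - y)) + (M * m - 1ℚ) * ((a * x + a * m) * x * (1ℚ - y)))
            (- (x * (1ℚ - y))) (u≡ (suc k) (suc (d ℕ.∸ k)) (index k k≤d)))
          (modulo₂ P⁻ (x * (1ℚ - y)) ((a * x + a * m) * x * (1ℚ - y)) a*x M*m)))
      where
      identity : ∀ x y a c m M → - m * a * (x + m) * - M * (x - x * y) ≡
        x * ((1ℚ - c * y) * (1ℚ - y)) + (a * x - 1ℚ) * (x * (1ℚ - y)) + (M * m - 1ℚ) * ((a * x + a * m) * x * (1ℚ - y))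
          + (- m * a - c * y) * - (x * (1ℚ - y))
      identity = solve-∀ ℚ-ring

    odd-weight : (x - c * y) * ω (suc k) * ((1ℚ - x) * (1ℚ - c * y) * (1ℚ - y) * (x - c)) ≡ Odd.W k (d ℕ.∸ k)
    odd-weight = trans (identity p (powQ p k) (powQ p (d ℕ.∸ k)) c (ω (suc k)))
      (cong (λ t → (powQ p k - c * powQ p (d ℕ.∸ k)) * (p * ω (suc k) * ((1ℚ - x) * (1ℚ - c * t) * (1ℚ - t) * (x - c))))
        (cong (powQ p) (sym (index-∸ k k≤d))))
      where
      identity : ∀ p x y c w →
        (p * x - c * (p * y)) * w * ((1ℚ - p * x) * (1ℚ - c * (p * y)) * (1ℚ - p * y) * (p * x - c)) ≡
        (x - c * y) * (p * w * ((1ℚ - p * x) * (1ℚ - c * (p * y)) * (1ℚ - p * y) * (p * x - c)))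
      identity = solve-∀ ℚ-ring

    middle-form : ∀ a₁ X₁ r₁ Y₁ a₂ X₂ r₂ Y₂ →
      let F⁺ = a₁ * (X₁ - r₁ * (π (u (suc k)) (v (suc k)) * Y₁))
          F⁻ = a₁ * (X₁ - r₁ * (π (v (suc k)) (u (suc k)) * Y₁))
          G⁺ = a₂ * (X₂ - r₂ * (π (u (suc k)) (v (suc k)) * Y₂))
          G⁻ = a₂ * (X₂ - r₂ * (π (v (suc k)) (u (suc k)) * Y₂)) in
      F⁺ * G⁺ * w⁺ (suc k) + F⁻ * G⁻ * w⁻ (suc k) + (F⁺ * G⁻ + F⁻ * G⁺) * w± (suc k) ≡
      a₁ * a₂ * (Even.W (suc k) (D ℕ.∸ suc k) * (X₁ * X₂)) + a₁ * a₂ * (r₁ * r₂) * (Odd.W k (d ℕ.∸ k) * (Y₁ * Y₂))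
    middle-form a₁ X₁ r₁ Y₁ a₂ X₂ r₂ Y₂ = begin
      _ ≡⟨ cong₂ (λ s t → G s t) π≡P⁺ π≡P⁻ ⟩
      G P⁺ P⁻
        ≡⟨ identity a₁ X₁ r₁ Y₁ a₂ X₂ r₂ Y₂ P⁺ P⁻ (w⁺ (suc k)) (w⁻ (suc k)) (w± (suc k)) ⟩
      H (w⁺ (suc k) + w⁻ (suc k) + (w± (suc k) + w± (suc k)))
        (P⁺ * (w⁺ (suc k) + w± (suc k)) + P⁻ * (w⁻ (suc k) + w± (suc k)))
        (P⁺ * P⁺ * w⁺ (suc k) + P⁻ * P⁻ * w⁻ (suc k) + (P⁺ * P⁻ * w± (suc k) + P⁺ * P⁻ * w± (suc k)))
        ≡⟨ cong₂ (λ s t → H s t (P⁺ * P⁺ * w⁺ (suc k) + P⁻ * P⁻ * w⁻ (suc k) + (P⁺ * P⁻ * w± (suc k) + P⁺ * P⁻ * w± (suc k)))) even-even even-odd ⟩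
      H ((x - c * y) * ω (suc k)) 0ℚ
        (P⁺ * P⁺ * w⁺ (suc k) + P⁻ * P⁻ * w⁻ (suc k) + (P⁺ * P⁻ * w± (suc k) + P⁺ * P⁻ * w± (suc k)))
        ≡⟨ cong (H ((x - c * y) * ω (suc k)) 0ℚ) (trans odd-odd odd-weight) ⟩
      H ((x - c * y) * ω (suc k)) 0ℚ (Odd.W k (d ℕ.∸ k))
        ≡⟨ cong (λ t → H ((x - c * powQ p t) * ω (suc k)) 0ℚ (Odd.W k (d ℕ.∸ k))) (sym (index-∸ k k≤d)) ⟩
      H (Even.W (suc k) (D ℕ.∸ suc k)) 0ℚ (Odd.W k (d ℕ.∸ k))
        ≡⟨ drop a₁ X₁ r₁ Y₁ a₂ X₂ r₂ Y₂ (Even.W (suc k) (D ℕ.∸ suc k)) (Odd.W k (d ℕ.∸ k)) ⟩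
      a₁ * a₂ * (Even.W (suc k) (D ℕ.∸ suc k) * (X₁ * X₂)) + a₁ * a₂ * (r₁ * r₂) * (Odd.W k (d ℕ.∸ k) * (Y₁ * Y₂)) ∎
      where
      open ≡-Reasoning
      G : ℚ → ℚ → ℚ
      G s t = a₁ * (X₁ - r₁ * (s * Y₁)) * (a₂ * (X₂ - r₂ * (s * Y₂))) * w⁺ (suc k)
        + a₁ * (X₁ - r₁ * (t * Y₁)) * (a₂ * (X₂ - r₂ * (t * Y₂))) * w⁻ (suc k)
        + (a₁ * (X₁ - r₁ * (s * Y₁)) * (a₂ * (X₂ - r₂ * (t * Y₂))) + a₁ * (X₁ - r₁ * (t * Y₁)) * (a₂ * (X₂ - r₂ * (s * Y₂)))) * w± (suc k)
      H : ℚ → ℚ → ℚ → ℚ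
      H s t z = a₁ * a₂ * (s * (X₁ * X₂)) - a₁ * a₂ * (r₂ * (X₁ * Y₂) + r₁ * (Y₁ * X₂)) * t + a₁ * a₂ * (r₁ * r₂) * (z * (Y₁ * Y₂))
      identity : ∀ a₁ X₁ r₁ Y₁ a₂ X₂ r₂ Y₂ s t w⁺ w⁻ w± →
        a₁ * (X₁ - r₁ * (s * Y₁)) * (a₂ * (X₂ - r₂ * (s * Y₂))) * w⁺
        + a₁ * (X₁ - r₁ * (t * Y₁)) * (a₂ * (X₂ - r₂ * (t * Y₂))) * w⁻
        + (a₁ * (X₁ - r₁ * (s * Y₁)) * (a₂ * (X₂ - r₂ * (t * Y₂))) + a₁ * (X₁ - r₁ * (t * Y₁)) * (a₂ * (X₂ - r₂ * (s * Y₂)))) * w± ≡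
        a₁ * a₂ * ((w⁺ + w⁻ + (w± + w±)) * (X₁ * X₂))
        - a₁ * a₂ * (r₂ * (X₁ * Y₂) + r₁ * (Y₁ * X₂)) * (s * (w⁺ + w±) + t * (w⁻ + w±))
        + a₁ * a₂ * (r₁ * r₂) * ((s * s * w⁺ + t * t * w⁻ + (s * t * w± + s * t * w±)) * (Y₁ * Y₂))
      identity = solve-∀ ℚ-ring
      drop : ∀ a₁ X₁ r₁ Y₁ a₂ X₂ r₂ Y₂ s z →
        a₁ * a₂ * (s * (X₁ * X₂)) - a₁ * a₂ * (r₂ * (X₁ * Y₂) + r₁ * (Y₁ * X₂)) * 0ℚ + a₁ * a₂ * (r₁ * r₂) * (z * (Y₁ * Y₂)) ≡
        a₁ * a₂ * (s * (X₁ * X₂)) + a₁ * a₂ * (r₁ * r₂) * (z * (Y₁ * Y₂))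
      drop = solve-∀ ℚ-ring

  private
    even-summand odd-summand : ℕ → ℕ → ℕ → ℚ
    even-summand i j k = Even.W k (D ℕ.∸ k) * (X i k * X j k)
    odd-summand i j k = Odd.W k (d ℕ.∸ k) * (Y′ i k (d ℕ.∸ k) * Y′ j k (d ℕ.∸ k))

  form-first : ∀ a₁ X₁ r₁ Y₁ a₂ X₂ r₂ Y₂ z w w′ → z ≡ 0ℚ → w ≡ w′ →
    a₁ * (X₁ - r₁ * (z * Y₁)) * (a₂ * (X₂ - r₂ * (z * Y₂))) * w ≡ a₁ * a₂ * (w′ * (X₁ * X₂))
  form-first a₁ X₁ r₁ Y₁ a₂ X₂ r₂ Y₂ z w w′ z≡0 w≡ = trans
    (cong₂ (λ z w → a₁ * (X₁ - r₁ * (z * Y₁)) * (a₂ * (X₂ - r₂ * (z * Y₂))) * w) z≡0 w≡)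
    (identity a₁ X₁ r₁ Y₁ a₂ X₂ r₂ Y₂ w′)
    where
    identity : ∀ a₁ X₁ r₁ Y₁ a₂ X₂ r₂ Y₂ w →
      a₁ * (X₁ - r₁ * (0ℚ * Y₁)) * (a₂ * (X₂ - r₂ * (0ℚ * Y₂))) * w ≡ a₁ * a₂ * (w * (X₁ * X₂))
    identity = solve-∀ ℚ-ring

  form-value : ∀ μ ν i j →
    form (value⁺ μ i) (value⁻ μ i) (value⁺ ν j) (value⁻ ν j) ≡
    α μ i * α ν j * (δℕ (ι μ i) (ι ν j) * Even.norm (ι μ i)) +
    α μ i * α ν j * (ρ μ i * ρ ν j) *
      (powQ p (κ μ i) * powQ p (κ ν j) * (δℕ (κ μ i) (κ ν j) * Odd.norm (κ μ i)))
  form-value μ ν i j = begin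
    form (value⁺ μ i) (value⁻ μ i) (value⁺ ν j) (value⁻ ν j)
      ≡⟨ form-split (value⁺ μ i) (value⁻ μ i) (value⁺ ν j) (value⁻ ν j) ⟩
    value⁺ μ i 0 * value⁺ ν j 0 * w⁺ 0 + sumQ (suc d) mid + value⁻ μ i D * value⁻ ν j D * w⁻ D
      ≡⟨ cong₂ (λ s t → s + sumQ (suc d) mid + t)
           (form-first (α μ i) (X (ι μ i) 0) (ρ μ i) (Y (κ μ i) 0) (α ν j) (X (ι ν j) 0) (ρ ν j) (Y (κ ν j) 0)
             (π (u 0) (v 0)) (w⁺ 0) (Even.W 0 D) π-first (sym weight-first))
           (form-first (α μ i) (X (ι μ i) D) (ρ μ i) (Y (κ μ i) D) (α ν j) (X (ι ν j) D) (ρ ν j) (Y (κ ν j) D)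
             (π (v D) (u D)) (w⁻ D) (Even.W D (D ℕ.∸ D)) π-last
             (trans (sym weight-last) (cong (Even.W D) (sym (ℕ.n∸n≡0 D))))) ⟩
    A * f 0 + sumQ (suc d) mid + A * f D
      ≡⟨ cong (λ s → A * f 0 + s + A * f D) (trans
           (sumQ-cong (suc d) {mid} {λ k → A * f (suc k) + B * (C * g k)} middle)
           (trans (sumQ-+ (suc d) (λ k → A * f (suc k)) (λ k → B * (C * g k)))
             (cong₂ _+_ (sumQ-*ˡ (suc d) A (λ k → f (suc k)))
               (trans (sumQ-*ˡ (suc d) B (λ k → C * g k)) (cong (B *_) (sumQ-*ˡ (suc d) C g)))))) ⟩
    A * f 0 + (A * sumQ (suc d) (λ k → f (suc k)) + B * (C * sumQ (suc d) g)) + A * f D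
      ≡⟨ regroup A (f 0) (sumQ (suc d) (λ k → f (suc k))) (B * (C * sumQ (suc d) g)) (f D) ⟩
    A * (f 0 + sumQ (suc d) (λ k → f (suc k)) + f D) + B * (C * sumQ (suc d) g)
      ≡⟨ cong (λ s → A * (s + f D) + B * (C * sumQ (suc d) g))
           (trans (sym (sumQ-head (suc d) f)) (cong (λ n → sumQ n f) d+2≡D)) ⟩
    A * (sumQ D f + f D) + B * (C * sumQ (suc d) g)
      ≡⟨ cong₂ (λ s t → A * s + B * (C * t)) (Even.orthogonality (ι μ i) (ι ν j))
           (Odd.orthogonality (κ μ i) (κ ν j)) ⟩
    A * (δℕ (ι μ i) (ι ν j) * Even.norm (ι μ i)) +
      B * (C * (δℕ (κ μ i) (κ ν j) * Odd.norm (κ μ i))) ∎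
    where
    open ≡-Reasoning
    A B C : ℚ
    A = α μ i * α ν j
    B = α μ i * α ν j * (ρ μ i * ρ ν j)
    C = powQ p (κ μ i) * powQ p (κ ν j)
    f g mid : ℕ → ℚ
    f = even-summand (ι μ i) (ι ν j)
    g = odd-summand (κ μ i) (κ ν j)
    mid k = value⁺ μ i (suc k) * value⁺ ν j (suc k) * w⁺ (suc k) + value⁻ μ i (suc k) * value⁻ ν j (suc k) * w⁻ (suc k) +
      (value⁺ μ i (suc k) * value⁻ ν j (suc k) + value⁻ μ i (suc k) * value⁺ ν j (suc k)) * w± (suc k)
    regroup : ∀ a x y z w → a * x + (a * y + z) + a * w ≡ a * (x + y + w) + z
    regroup = solve-∀ ℚ-ring
    regroup′ : ∀ w s y t z → w * (s * y * (t * z)) ≡ s * t * (w * (y * z))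
    regroup′ = solve-∀ ℚ-ring
    middle : ∀ k → k ℕ.< suc d → mid k ≡ A * f (suc k) + B * (C * g k)
    middle k (ℕ.s≤s k≤d) = trans
      (middle-form k k≤d (α μ i) (X (ι μ i) (suc k)) (ρ μ i) (Y (κ μ i) (suc k))
        (α ν j) (X (ι ν j) (suc k)) (ρ ν j) (Y (κ ν j) (suc k)))
      (cong (λ t → A * f (suc k) + B * t) (regroup′ (Odd.W k (d ℕ.∸ k)) (powQ p (κ μ i)) (Y′ (κ μ i) k (d ℕ.∸ k))
        (powQ p (κ ν j)) (Y′ (κ ν j) k (d ℕ.∸ k))))

  private
    P : ℚ
    P = powQ p D

    θ : ℕ → ℚ
    θ i = pochQ Q i * powQ (c * P) i

  even-norm : ∀ i → Even.norm i ≡ pochQ P i * θ i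
  even-norm i = cong (pochQ P i *_) (trans (cong (θ i *_) total-weight) (ℚ.*-identityʳ (θ i)))

  odd-norm : ∀ i → powQ p i * powQ p i * Odd.norm i ≡ - c * pochQ P (suc (suc i)) * θ i
  odd-norm i = begin
    powQ p i * powQ p i * (pochQ x i * (pochQ Q i * powQ (c * x) i * (Odd.W d 0 * pochQ c d)))
      ≡⟨ cong (λ t → powQ p i * powQ p i * (pochQ x i * (pochQ Q i * powQ (c * x) i * t))) (total-weight⊥ d d+2≡D) ⟩
    powQ p i * powQ p i * (pochQ x i * (pochQ Q i * powQ (c * x) i * - (c * (1ℚ - P) * (1ℚ - p * x))))
      ≡⟨ regroup (powQ p i) (pochQ x i) (pochQ Q i) (powQ (c * x) i) c P (p * x) ⟩
    - c * ((1ℚ - P) * ((1ℚ - p * x) * pochQ x i)) * (pochQ Q i * (powQ p i * powQ p i * powQ (c * x) i))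
      ≡⟨ cong₂ (λ s t → - c * s * (pochQ Q i * t)) poch powers ⟩
    - c * pochQ P (suc (suc i)) * θ i ∎
    where
    open ≡-Reasoning
    x : ℚ
    x = powQ p d
    P≡ : p * (p * x) ≡ P
    P≡ = cong (powQ p) d+2≡D
    poch : (1ℚ - P) * ((1ℚ - p * x) * pochQ x i) ≡ pochQ P (suc (suc i))
    poch = subst (λ t → (1ℚ - t) * ((1ℚ - p * x) * pochQ x i) ≡ pochQ t (suc (suc i))) P≡
      (sym (trans (pochQ-p (p * x) (suc i)) (cong ((1ℚ - p * (p * x)) *_) (pochQ-p x i))))
    powers : powQ p i * powQ p i * powQ (c * x) i ≡ powQ (c * P) i
    powers = trans (cong (_* powQ (c * x) i) (sym (powQ-* p p i))) (trans (sym (powQ-* (p * p) (c * x) i))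
      (cong (λ t → powQ t i) (trans (lemma p c x) (cong (c *_) P≡))))
      where
      lemma : ∀ p c x → p * p * (c * x) ≡ c * (p * (p * x))
      lemma = solve-∀ ℚ-ring
    regroup : ∀ s t u w c P y → s * s * (t * (u * w * - (c * (1ℚ - P) * (1ℚ - y)))) ≡
      - c * ((1ℚ - P) * ((1ℚ - y) * t)) * (u * (s * s * w))
    regroup = solve-∀ ℚ-ring

  private
    Δ : ℕ → ℚ
    Δ i = powQ Q D - powQ Q i

    Q^D*P : powQ Q D * P ≡ 1ℚ
    Q^D*P = Qⁿ*pⁿ D

    Δ≢0 : ∀ i → i ℕ.< D → Δ i ≢ 0ℚ
    Δ≢0 i i<D = subst (_≢ 0ℚ) (trans (lemma (powQ Q i) (powQ Q (suc l))) (cong (_- powQ Q i)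
        (trans (sym (powQ-+ Q i (suc l))) (cong (powQ Q) i+l≡D))))
      (*-≢0 (neg-≢0 (pos⇒≢0 (powQ-pos i 0<Q))) (1-Qⁿ≢0 l))
      where
      l : ℕ
      l = D ℕ.∸ suc i
      i+l≡D : i ℕ.+ suc l ≡ D
      i+l≡D = trans (ℕ.+-suc i l) (ℕ.m+[n∸m]≡n i<D)
      lemma : ∀ a b → - a * (1ℚ - b) ≡ a * b - a
      lemma = solve-∀ ℚ-ring
      neg-≢0 : ∀ {x} → x ≢ 0ℚ → - x ≢ 0ℚ
      neg-≢0 {x} x≢0 eq = x≢0 (trans (neg-neg x) (cong -_ eq))
        where
        neg-neg : ∀ x → x ≡ - - x
        neg-neg = solve-∀ ℚ-ring

    Q^D-1≢0 : powQ Q D - 1ℚ ≢ 0ℚ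
    Q^D-1≢0 = Δ≢0 0 (subst (0 ℕ.<_) d+2≡D (ℕ.s≤s ℕ.z≤n))

    1-Q^D≢0 : 1ℚ - powQ Q D ≢ 0ℚ
    1-Q^D≢0 = subst (λ n → 1ℚ - powQ Q n ≢ 0ℚ) d+2≡D (1-Qⁿ≢0 (suc d))

    Qⁿ-1≢0 : ∀ n → powQ Q (suc n) - 1ℚ ≢ 0ℚ
    Qⁿ-1≢0 n eq = 1-Qⁿ≢0 n (trans (neg (powQ Q (suc n))) (cong -_ eq))
      where
      neg : ∀ x → 1ℚ - x ≡ - (x - 1ℚ)
      neg = solve-∀ ℚ-ring

  norm-cross : ∀ i → suc i ℕ.< D →
    pochQ P (suc i) * θ (suc i) + ρ minus (suc i) * (- c * pochQ P (suc (suc i)) * θ i) ≡ 0ℚ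
  norm-cross i i<D = trans (identity (pochQ P (suc i)) (pochQ Q i) (powQ (c * P) i) c P (Q * powQ Q i) (powQ Q D) (inv (Δ (suc i))))
    (modulo₂ 0ℚ c₁ c₂ Q^D*P (*-inv (Δ≢0 (suc i) i<D)))
    where
    c₁ c₂ : ℚ
    c₁ = c * pochQ P (suc i) * (pochQ Q i * powQ (c * P) i) * (1ℚ - Q * powQ Q i) * inv (Δ (suc i))
    c₂ = - (c * pochQ P (suc i) * (pochQ Q i * powQ (c * P) i) * (1ℚ - Q * powQ Q i) * P)
    identity : ∀ p a w c P y z i →
      p * (a * (1ℚ - y) * (c * P * w)) + (1ℚ - y) * i * (- c * (p * (1ℚ - P * y)) * (a * w)) ≡
      0ℚ + (z * P - 1ℚ) * (c * p * (a * w) * (1ℚ - y) * i) + ((z - y) * i - 1ℚ) * - (c * p * (a * w) * (1ℚ - y) * P)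
    identity = solve-∀ ℚ-ring

  M*c*P : - M * (c * P) ≡ 1ℚ
  M*c*P = trans (identity (powQ Q D) E e P) (modulo₂ 1ℚ (E * e) 1ℚ Q^D*P E*e)
    where
    identity : ∀ z E e P → - (z * E) * (- e * P) ≡ 1ℚ + (z * P - 1ℚ) * (E * e) + (E * e - 1ℚ) * 1ℚ
    identity = solve-∀ ℚ-ring

  Nfac-poch : ∀ i → powQ (- M) (suc i) * pochQ P (suc i) ≡ powQ E (suc i) * (1ℚ - powQ Q D) * (pochQ Q i * Nfac i)
  Nfac-poch zero = trans (identity (powQ Q D) E P) (modulo (E * 1ℚ * (1ℚ - powQ Q D) * (1ℚ * 1ℚ)) E Q^D*P)
    where
    identity : ∀ z E P → - (z * E) * 1ℚ * (1ℚ * (1ℚ - P * 1ℚ)) ≡ E * 1ℚ * (1ℚ - z) * (1ℚ * 1ℚ) + (z * P - 1ℚ) * E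
    identity = solve-∀ ℚ-ring
  Nfac-poch (suc i) = begin
    - M * powQ (- M) (suc i) * (pochQ P (suc i) * (1ℚ - P * y))
      ≡⟨ regroup (- M) (powQ (- M) (suc i)) (pochQ P (suc i)) (1ℚ - P * y) ⟩
    - M * (1ℚ - P * y) * (powQ (- M) (suc i) * pochQ P (suc i))
      ≡⟨ cong (- M * (1ℚ - P * y) *_) (Nfac-poch i) ⟩
    - M * (1ℚ - P * y) * (powQ E (suc i) * (1ℚ - powQ Q D) * (pochQ Q i * Nfac i))
      ≡⟨ identity (powQ Q D) E P y (powQ E (suc i)) (pochQ Q i) (Nfac i) (inv (y - 1ℚ)) ⟩
    rhs + (powQ Q D * P - 1ℚ) * c₁ + ((y - 1ℚ) * inv (y - 1ℚ) - 1ℚ) * c₂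
      ≡⟨ modulo₂ rhs c₁ c₂ Q^D*P (*-inv (Qⁿ-1≢0 i)) ⟩
    rhs ∎
    where
    open ≡-Reasoning
    y rhs t c₁ c₂ : ℚ
    y = powQ Q (suc i)
    t = powQ E (suc i) * (1ℚ - powQ Q D) * (pochQ Q i * Nfac i)
    rhs = powQ E (suc (suc i)) * (1ℚ - powQ Q D) * (pochQ Q (suc i) * Nfac (suc i))
    c₁ = E * y * t
    c₂ = E * t * (powQ Q D - y)
    regroup : ∀ a b c d → a * b * (c * d) ≡ a * d * (b * c)
    regroup = solve-∀ ℚ-ring
    identity : ∀ z E P y ε a n w →
      - (z * E) * (1ℚ - P * y) * (ε * (1ℚ - z) * (a * n)) ≡
      E * ε * (1ℚ - z) * (a * (1ℚ - y) * (n * ((z - y) * w)))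
        + (z * P - 1ℚ) * (E * y * (ε * (1ℚ - z) * (a * n)))
        + ((y - 1ℚ) * w - 1ℚ) * (E * (ε * (1ℚ - z) * (a * n)) * (z - y))
    identity = solve-∀ ℚ-ring

  powers-cancel : ∀ i → powQ (- M) i * powQ (c * P) i ≡ 1ℚ
  powers-cancel i = powQ-inverse i M*c*P

  norm-plus : ∀ i → α plus i * α plus i * (pochQ P (suc i) * θ (suc i) + - c * pochQ P (suc (suc i)) * θ i) ≡ N plus i
  norm-plus i = begin
    - M * s * g * (- M * s * g) * (pochQ P (suc i) * (A * (1ℚ - y) * (c * P * w)) + - c * (pochQ P (suc i) * (1ℚ - P * y)) * (A * w))
      ≡⟨ identity M s g (pochQ P (suc i)) A y c P w ⟩
    - M * s * pochQ P (suc i) * (s * w) * (- M * (c * P) - M * - c) * (A * (g * g))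
      ≡⟨ cong₂ (λ a b → a * b * (- M * (c * P) - M * - c) * (A * (g * g))) (Nfac-poch i) (powers-cancel i) ⟩
    ε * (1ℚ - z) * (A * Nfac i) * 1ℚ * (- M * (c * P) - M * - c) * (A * (g * g))
      ≡⟨ cong₂ (λ a b → ε * (1ℚ - z) * (A * Nfac i) * 1ℚ * (a - b) * (A * (g * g))) M*c*P M*-c ⟩
    ε * (1ℚ - z) * (A * Nfac i) * 1ℚ * (1ℚ - z) * (A * (g * g))
      ≡⟨ identity′ ε z A (Nfac i) g ⟩
    ε * Nfac i + ((1ℚ - z) * A * g - 1ℚ) * (ε * Nfac i * ((1ℚ - z) * A * g + 1ℚ))
      ≡⟨ modulo (ε * Nfac i) (ε * Nfac i * ((1ℚ - z) * A * g + 1ℚ)) (*-inv (*-≢0 1-Q^D≢0 (pochQ-Q≢0 i))) ⟩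
    ε * Nfac i ∎
    where
    open ≡-Reasoning
    s w g y z ε A : ℚ
    s = powQ (- M) i
    w = powQ (c * P) i
    g = inv ((1ℚ - powQ Q D) * pochQ Q i)
    y = Q * powQ Q i
    z = powQ Q D
    ε = powQ E (suc i)
    A = pochQ Q i
    M*-c : M * - c ≡ z
    M*-c = trans (lemma z E e) (modulo z z E*e)
      where
      lemma : ∀ z E e → z * E * - - e ≡ z + (E * e - 1ℚ) * z
      lemma = solve-∀ ℚ-ring
    identity : ∀ M s g p A y c P w →
      - M * s * g * (- M * s * g) * (p * (A * (1ℚ - y) * (c * P * w)) + - c * (p * (1ℚ - P * y)) * (A * w)) ≡
      - M * s * p * (s * w) * (- M * (c * P) - M * - c) * (A * (g * g))
    identity = solve-∀ ℚ-ring
    identity′ : ∀ ε z A n g → ε * (1ℚ - z) * (A * n) * 1ℚ * (1ℚ - z) * (A * (g * g)) ≡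
      ε * n + ((1ℚ - z) * A * g - 1ℚ) * (ε * n * ((1ℚ - z) * A * g + 1ℚ))
    identity′ = solve-∀ ℚ-ring

  norm-minus : ∀ i → suc i ℕ.< D →
    α minus (suc i) * α minus (suc i) *
      (pochQ P (suc i) * θ (suc i) + ρ minus (suc i) * ρ minus (suc i) * (- c * pochQ P (suc (suc i)) * θ i)) ≡ N minus (suc i)
  norm-minus i i<D = begin
    s * (δ * g) * (s * (δ * g)) * (n + r * r * n⊥)
      ≡⟨ identity₀ s δ g n r n⊥ ⟩
    s * (δ * g) * (s * (δ * g)) * (n - r * n + r * (n + r * n⊥))
      ≡⟨ cong (λ t → s * (δ * g) * (s * (δ * g)) * (n - r * n + r * t)) (norm-cross i i<D) ⟩
    s * (δ * g) * (s * (δ * g)) * (n - r * n + r * 0ℚ)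
      ≡⟨ identity₁ s (pochQ P (suc i)) w δ g A y (inv δ) ⟩
    s * pochQ P (suc i) * (s * w) * (δ * (δ - (1ℚ - y) * (δ * inv δ)) * (A * (1ℚ - y)) * (g * g))
      ≡⟨ cong₂ (λ a b → a * b * (δ * (δ - (1ℚ - y) * (δ * inv δ)) * (A * (1ℚ - y)) * (g * g))) (Nfac-poch i) (powers-cancel (suc i)) ⟩
    ε * (1ℚ - z) * (A * Nfac i) * 1ℚ * (δ * (δ - (1ℚ - y) * (δ * inv δ)) * (A * (1ℚ - y)) * (g * g))
      ≡⟨ cong (λ t → ε * (1ℚ - z) * (A * Nfac i) * 1ℚ * (δ * (δ - (1ℚ - y) * t) * (A * (1ℚ - y)) * (g * g))) (*-inv (Δ≢0 (suc i) i<D)) ⟩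
    ε * (1ℚ - z) * (A * Nfac i) * 1ℚ * (δ * (z - y - (1ℚ - y) * 1ℚ) * (A * (1ℚ - y)) * (g * g))
      ≡⟨ identity₂ ε z A (Nfac i) δ y g (inv (y - 1ℚ)) ⟩
    rhs + ((z - 1ℚ) * (A * (1ℚ - y)) * g - 1ℚ) * c₁ + ((y - 1ℚ) * inv (y - 1ℚ) - 1ℚ) * c₂
      ≡⟨ modulo₂ rhs c₁ c₂ (*-inv (*-≢0 Q^D-1≢0 (pochQ-Q≢0 (suc i)))) (*-inv (Qⁿ-1≢0 i)) ⟩
    rhs ∎
    where
    open ≡-Reasoning
    s w g y z ε A δ r n n⊥ rhs c₁ c₂ : ℚ
    s = powQ (- M) (suc i)
    w = powQ (c * P) (suc i)
    g = inv ((powQ Q D - 1ℚ) * pochQ Q (suc i))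
    y = powQ Q (suc i)
    z = powQ Q D
    ε = powQ E (suc i)
    A = pochQ Q i
    δ = Δ (suc i)
    r = ρ minus (suc i)
    n = pochQ P (suc i) * θ (suc i)
    n⊥ = - c * pochQ P (suc (suc i)) * θ i
    rhs = ε * (Nfac i * (δ * inv (y - 1ℚ)))
    c₁ = ε * Nfac i * δ * inv (y - 1ℚ) * ((z - 1ℚ) * (A * (1ℚ - y)) * g + 1ℚ)
    c₂ = ε * Nfac i * δ * ((z - 1ℚ) * A * g) * ((z - 1ℚ) * (A * (1ℚ - y)) * g)
    identity₀ : ∀ s δ g n r n⊥ → s * (δ * g) * (s * (δ * g)) * (n + r * r * n⊥) ≡
      s * (δ * g) * (s * (δ * g)) * (n - r * n + r * (n + r * n⊥))
    identity₀ = solve-∀ ℚ-ring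
    identity₁ : ∀ s p w δ g A y i →
      s * (δ * g) * (s * (δ * g)) * (p * (A * (1ℚ - y) * w) - (1ℚ - y) * i * (p * (A * (1ℚ - y) * w)) + (1ℚ - y) * i * 0ℚ) ≡
      s * p * (s * w) * (δ * (δ - (1ℚ - y) * (δ * i)) * (A * (1ℚ - y)) * (g * g))
    identity₁ = solve-∀ ℚ-ring
    identity₂ : ∀ ε z A n δ y g v →
      ε * (1ℚ - z) * (A * n) * 1ℚ * (δ * (z - y - (1ℚ - y) * 1ℚ) * (A * (1ℚ - y)) * (g * g)) ≡
      ε * (n * (δ * v))
        + ((z - 1ℚ) * (A * (1ℚ - y)) * g - 1ℚ) * (ε * n * δ * v * ((z - 1ℚ) * (A * (1ℚ - y)) * g + 1ℚ))
        + ((y - 1ℚ) * v - 1ℚ) * (ε * n * δ * ((z - 1ℚ) * A * g) * ((z - 1ℚ) * (A * (1ℚ - y)) * g))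
    identity₂ = solve-∀ ℚ-ring

  private
    δ-cong : ∀ i j {x y} → (i ≡ j → x ≡ y) → δℕ i j * x ≡ δℕ i j * y
    δ-cong i j {x} {y} x≡y = cases (i ℕ.≟ j)
      where
      cases : Dec (i ≡ j) → δℕ i j * x ≡ δℕ i j * y
      cases (yes i≡j) = cong (δℕ i j *_) (x≡y i≡j)
      cases (no i≢j) = trans (*-zero-fst x (δℕ-≢ i j i≢j)) (sym (*-zero-fst y (δℕ-≢ i j i≢j)))

    even odd : ℕ → ℚ
    even i = pochQ P i * θ i
    odd i = - c * pochQ P (suc (suc i)) * θ i

    gram : Sign → Sign → ℕ → ℕ → ℚ
    gram μ ν i j = α μ i * α ν j * (δℕ (ι μ i) (ι ν j) * even (ι μ i)) +
      α μ i * α ν j * (ρ μ i * ρ ν j) * (δℕ (κ μ i) (κ ν j) * odd (κ μ i))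

    form-gram : ∀ μ ν i j → form (value⁺ μ i) (value⁻ μ i) (value⁺ ν j) (value⁻ ν j) ≡ gram μ ν i j
    form-gram μ ν i j = trans (form-value μ ν i j)
      (cong₂ (λ s t → α μ i * α ν j * (δℕ (ι μ i) (ι ν j) * s) + α μ i * α ν j * (ρ μ i * ρ ν j) * t)
        (even-norm (ι μ i)) (odd-part (κ μ i) (κ ν j)))
      where
      odd-part : ∀ a b → powQ p a * powQ p b * (δℕ a b * Odd.norm a) ≡ δℕ a b * odd a
      odd-part a b = trans (regroup (powQ p a) (powQ p b) (δℕ a b) (Odd.norm a))
        (δ-cong a b (λ a≡b → trans (cong (λ t → powQ p a * powQ p t * Odd.norm a) (sym a≡b)) (odd-norm a)))
        where
        regroup : ∀ s t u v → s * t * (u * v) ≡ u * (s * t * v)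
        regroup = solve-∀ ℚ-ring

    ρ-zero : ρ minus 0 ≡ 0ℚ
    ρ-zero = ℚ.*-zeroˡ (inv (powQ Q D - 1ℚ))

    vanish : ∀ a x r y → r ≡ 0ℚ → a * (0ℚ * x) + a * r * y ≡ 0ℚ
    vanish a x r y r≡0 = trans (cong (λ r → a * (0ℚ * x) + a * r * y) r≡0) (identity a x y)
      where
      identity : ∀ a x y → a * (0ℚ * x) + a * 0ℚ * y ≡ 0ℚ
      identity = solve-∀ ℚ-ring

    collect : ∀ a δ x r y → a * (δ * x) + a * r * (δ * y) ≡ δ * (a * (x + r * y))
    collect = solve-∀ ℚ-ring

    right-zero : ∀ δ x → 0ℚ ≡ δ * 0ℚ * x
    right-zero = solve-∀ ℚ-ring

    gram-orthogonal : ∀ μ ν i j → i ℕ.< D → j ℕ.< D → gram μ ν i j ≡ δℕ i j * δS μ ν * N μ i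
    gram-orthogonal plus plus i j _ _ = trans
      (collect (α plus i * α plus j) (δℕ i j) (even (suc i)) (1ℚ * 1ℚ) (odd i))
      (trans (δ-cong i j (λ i≡j → trans
          (cong₂ (λ t r → α plus i * α plus t * (even (suc i) + r)) (sym i≡j) (ℚ.*-identityˡ (odd i)))
          (norm-plus i)))
        (cong (_* N plus i) (sym (ℚ.*-identityʳ (δℕ i j)))))
    gram-orthogonal plus minus i zero _ _ = trans
      (vanish (α plus i * α minus 0) (even (suc i)) (1ℚ * ρ minus 0) (δℕ i 0 * odd i) (*-zero-snd 1ℚ ρ-zero))
      (right-zero (δℕ i 0) (N plus i))
    gram-orthogonal plus minus i (suc j) i<D j<D = trans
      (collect (α plus i * α minus (suc j)) (δℕ i j) (even (suc i)) (1ℚ * ρ minus (suc j)) (odd i))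
      (trans (δ-cong i j (λ i≡j → *-zero-snd (α plus i * α minus (suc j)) (trans
          (cong (λ r → even (suc i) + r * odd i) (trans (ℚ.*-identityˡ (ρ minus (suc j))) (cong (λ t → ρ minus (suc t)) (sym i≡j))))
          (norm-cross i (subst (λ t → suc t ℕ.< D) (sym i≡j) j<D)))))
        (trans (ℚ.*-zeroʳ (δℕ i j)) (right-zero (δℕ i (suc j)) (N plus i))))
    gram-orthogonal minus plus zero j _ _ = trans
      (vanish (α minus 0 * α plus j) (even 0) (ρ minus 0 * 1ℚ) (δℕ 0 j * odd 0) (*-zero-fst 1ℚ ρ-zero))
      (right-zero (δℕ 0 j) (N minus 0))
    gram-orthogonal minus plus (suc i) j i<D _ = trans
      (collect (α minus (suc i) * α plus j) (δℕ i j) (even (suc i)) (ρ minus (suc i) * 1ℚ) (odd i))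
      (trans (*-zero-snd (δℕ i j) (*-zero-snd (α minus (suc i) * α plus j) (trans
          (cong (λ r → even (suc i) + r * odd i) (ℚ.*-identityʳ (ρ minus (suc i))))
          (norm-cross i i<D))))
        (right-zero (δℕ (suc i) j) (N minus (suc i))))
    gram-orthogonal minus minus zero zero _ _ = trans
      (cong (λ r → α minus 0 * α minus 0 * (1ℚ * even 0) + α minus 0 * α minus 0 * (r * r) * (1ℚ * odd 0)) ρ-zero)
      (trans (identity (powQ Q D - 1ℚ) (inv ((powQ Q D - 1ℚ) * 1ℚ)) (odd 0))
        (modulo (1ℚ * 1ℚ * (1ℚ * 1ℚ)) ((powQ Q D - 1ℚ) * 1ℚ * inv ((powQ Q D - 1ℚ) * 1ℚ) + 1ℚ) (*-inv (*-≢0 Q^D-1≢0 (λ ())))))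
      where
      identity : ∀ t g o → 1ℚ * (t * g) * (1ℚ * (t * g)) * (1ℚ * (1ℚ * (1ℚ * 1ℚ))) + 1ℚ * (t * g) * (1ℚ * (t * g)) * (0ℚ * 0ℚ) * (1ℚ * o) ≡
        1ℚ * 1ℚ * (1ℚ * 1ℚ) + (t * 1ℚ * g - 1ℚ) * (t * 1ℚ * g + 1ℚ)
      identity = solve-∀ ℚ-ring
    gram-orthogonal minus minus zero (suc j) _ _ = trans
      (vanish (α minus 0 * α minus (suc j)) (even 0) (ρ minus 0 * ρ minus (suc j)) (δℕ 0 j * odd 0) (*-zero-fst (ρ minus (suc j)) ρ-zero))
      (identity (N minus 0))
      where
      identity : ∀ x → 0ℚ ≡ 0ℚ * 1ℚ * x
      identity = solve-∀ ℚ-ring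
    gram-orthogonal minus minus (suc i) zero _ _ = trans
      (vanish (α minus (suc i) * α minus 0) (even (suc i)) (ρ minus (suc i) * ρ minus 0) (δℕ i 0 * odd i) (*-zero-snd (ρ minus (suc i)) ρ-zero))
      (identity (N minus (suc i)))
      where
      identity : ∀ x → 0ℚ ≡ 0ℚ * 1ℚ * x
      identity = solve-∀ ℚ-ring
    gram-orthogonal minus minus (suc i) (suc j) i<D _ = trans
      (collect (α minus (suc i) * α minus (suc j)) (δℕ i j) (even (suc i)) (ρ minus (suc i) * ρ minus (suc j)) (odd i))
      (trans (δ-cong i j (λ i≡j → trans
          (cong (λ t → α minus (suc i) * α minus (suc t) * (even (suc i) + ρ minus (suc i) * ρ minus (suc t) * odd i)) (sym i≡j))
          (norm-minus i i<D)))
        (cong (_* N minus (suc i)) (sym (ℚ.*-identityʳ (δℕ i j)))))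

  form-orthogonal : ∀ μ ν i j → i ℕ.< D → j ℕ.< D →
    form (value⁺ μ i) (value⁻ μ i) (value⁺ ν j) (value⁻ ν j) ≡ δℕ i j * δS μ ν * N μ i
  form-orthogonal μ ν i j i<D j<D = trans (form-gram μ ν i j) (gram-orthogonal μ ν i j i<D j<D)

-- Evaluation in ℚ(i)[ρ]

module RingIdentities {A : Set} (_⊕_ _⊗_ : A → A → A) (⊖_ : A → A) (0# 1# : A)
  (⊕-assoc : ∀ x y z → (x ⊕ y) ⊕ z ≡ x ⊕ (y ⊕ z)) (⊕-comm : ∀ x y → x ⊕ y ≡ y ⊕ x)
  (⊕-identity : ∀ x → 0# ⊕ x ≡ x) (⊕-inverse : ∀ x → (⊖ x) ⊕ x ≡ 0#)
  (⊗-assoc : ∀ x y z → (x ⊗ y) ⊗ z ≡ x ⊗ (y ⊗ z)) (⊗-comm : ∀ x y → x ⊗ y ≡ y ⊗ x)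
  (⊗-identity : ∀ x → 1# ⊗ x ≡ x) (distrib : ∀ x y z → x ⊗ (y ⊕ z) ≡ (x ⊗ y) ⊕ (x ⊗ z)) where

  commutativeRing : CommutativeRing 0ℓ 0ℓ
  commutativeRing = record
    { Carrier = A ; _≈_ = _≡_ ; _+_ = _⊕_ ; _*_ = _⊗_ ; -_ = ⊖_ ; 0# = 0# ; 1# = 1#
    ; isCommutativeRing = record
      { isRing = record
        { +-isAbelianGroup = record
          { isGroup = record
            { isMonoid = record
              { isSemigroup = record
                { isMagma = record { isEquivalence = isEquivalence ; ∙-cong = cong₂ _⊕_ }
                ; assoc = ⊕-assoc }
              ; identity = ⊕-identity , λ x → trans (⊕-comm x 0#) (⊕-identity x) }
            ; inverse = ⊕-inverse , λ x → trans (⊕-comm x (⊖ x)) (⊕-inverse x)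
            ; ⁻¹-cong = cong ⊖_ }
          ; comm = ⊕-comm }
        ; *-cong = cong₂ _⊗_
        ; *-assoc = ⊗-assoc
        ; *-identity = ⊗-identity , λ x → trans (⊗-comm x 1#) (⊗-identity x)
        ; distrib = distrib , λ x y z →
            trans (⊗-comm (y ⊕ z) x) (trans (distrib x y z) (cong₂ _⊕_ (⊗-comm x y) (⊗-comm x z))) }
      ; *-comm = ⊗-comm } }

  open import Algebra.Solver.Ring.NaturalCoefficients.Default
    (CommutativeRing.commutativeSemiring commutativeRing) using (solve; _:=_; _:+_; _:*_)


  -- Multiplication in the quadratic extension by a square root of m.
  assoc-fst : ∀ m a b c d e f → (((a ⊗ c) ⊕ ((b ⊗ d) ⊗ m)) ⊗ e) ⊕ ((((a ⊗ d) ⊕ (b ⊗ c)) ⊗ f) ⊗ m) ≡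
    (a ⊗ ((c ⊗ e) ⊕ ((d ⊗ f) ⊗ m))) ⊕ ((b ⊗ ((c ⊗ f) ⊕ (d ⊗ e))) ⊗ m)
  assoc-fst = solve 7 (λ m a b c d e f →
    (((a :* c) :+ ((b :* d) :* m)) :* e) :+ ((((a :* d) :+ (b :* c)) :* f) :* m) :=
    (a :* ((c :* e) :+ ((d :* f) :* m))) :+ ((b :* ((c :* f) :+ (d :* e))) :* m)) refl

  assoc-snd : ∀ m a b c d e f → (((a ⊗ c) ⊕ ((b ⊗ d) ⊗ m)) ⊗ f) ⊕ (((a ⊗ d) ⊕ (b ⊗ c)) ⊗ e) ≡
    (a ⊗ ((c ⊗ f) ⊕ (d ⊗ e))) ⊕ (b ⊗ ((c ⊗ e) ⊕ ((d ⊗ f) ⊗ m)))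
  assoc-snd = solve 7 (λ m a b c d e f →
    (((a :* c) :+ ((b :* d) :* m)) :* f) :+ (((a :* d) :+ (b :* c)) :* e) :=
    (a :* ((c :* f) :+ (d :* e))) :+ (b :* ((c :* e) :+ ((d :* f) :* m)))) refl

  comm-fst : ∀ m a b c d → (a ⊗ c) ⊕ ((b ⊗ d) ⊗ m) ≡ (c ⊗ a) ⊕ ((d ⊗ b) ⊗ m)
  comm-fst = solve 5 (λ m a b c d → (a :* c) :+ ((b :* d) :* m) := (c :* a) :+ ((d :* b) :* m)) refl

  comm-snd : ∀ a b c d → (a ⊗ d) ⊕ (b ⊗ c) ≡ (c ⊗ b) ⊕ (d ⊗ a)
  comm-snd = solve 4 (λ a b c d → (a :* d) :+ (b :* c) := (c :* b) :+ (d :* a)) refl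

  distrib-fst : ∀ m a b c d e f → (a ⊗ (c ⊕ e)) ⊕ ((b ⊗ (d ⊕ f)) ⊗ m) ≡
    ((a ⊗ c) ⊕ ((b ⊗ d) ⊗ m)) ⊕ ((a ⊗ e) ⊕ ((b ⊗ f) ⊗ m))
  distrib-fst = solve 7 (λ m a b c d e f → (a :* (c :+ e)) :+ ((b :* (d :+ f)) :* m) :=
    ((a :* c) :+ ((b :* d) :* m)) :+ ((a :* e) :+ ((b :* f) :* m))) refl

  distrib-snd : ∀ a b c d e f → (a ⊗ (d ⊕ f)) ⊕ (b ⊗ (c ⊕ e)) ≡ ((a ⊗ d) ⊕ (b ⊗ c)) ⊕ ((a ⊗ f) ⊕ (b ⊗ e))
  distrib-snd = solve 6 (λ a b c d e f → (a :* (d :+ f)) :+ (b :* (c :+ e)) :=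
    ((a :* d) :+ (b :* c)) :+ ((a :* f) :+ (b :* e))) refl

  module Ring = CommutativeRing commutativeRing
  open import Algebra.Properties.Ring Ring.ring using (-‿distribˡ-*; -‿distribʳ-*; -‿involutive)

  swapʳ : ∀ a b c → (a ⊗ b) ⊗ c ≡ (a ⊗ c) ⊗ b
  swapʳ = solve 3 (λ a b c → (a :* b) :* c := (a :* c) :* b) refl

  interchange : ∀ a b c d → (a ⊗ b) ⊗ (c ⊗ d) ≡ (a ⊗ c) ⊗ (b ⊗ d)
  interchange = solve 4 (λ a b c d → (a :* b) :* (c :* d) := (a :* c) :* (b :* d)) refl

  neg-neg : ∀ a b → (⊖ a) ⊗ (⊖ b) ≡ a ⊗ b
  neg-neg a b = trans (sym (-‿distribˡ-* a (⊖ b))) (trans (cong ⊖_ (sym (-‿distribʳ-* a b))) (-‿involutive (a ⊗ b)))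

  factor-difference : ∀ a b t → (a ⊗ t) ⊕ (⊖ (b ⊗ t)) ≡ (a ⊕ (⊖ b)) ⊗ t
  factor-difference a b t = trans (cong ((a ⊗ t) ⊕_) (-‿distribˡ-* b t)) (sym (Ring.distribʳ t a (⊖ b)))

private
  assoc-re : ∀ a b c d e f → (a * c - b * d) * e - (a * d + b * c) * f ≡ a * (c * e - d * f) - b * (c * f + d * e)
  assoc-re = solve-∀ ℚ-ring
  assoc-im : ∀ a b c d e f → (a * c - b * d) * f + (a * d + b * c) * e ≡ a * (c * f + d * e) + b * (c * e - d * f)
  assoc-im = solve-∀ ℚ-ring
  comm-re : ∀ a b c d → a * c - b * d ≡ c * a - d * b
  comm-re = solve-∀ ℚ-ring
  comm-im : ∀ a b c d → a * d + b * c ≡ c * b + d * a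
  comm-im = solve-∀ ℚ-ring
  identity-re : ∀ a b → 1ℚ * a - 0ℚ * b ≡ a
  identity-re = solve-∀ ℚ-ring
  identity-im : ∀ a b → 1ℚ * b + 0ℚ * a ≡ b
  identity-im = solve-∀ ℚ-ring
  distrib-re : ∀ a b c d e f → a * (c + e) - b * (d + f) ≡ (a * c - b * d) + (a * e - b * f)
  distrib-re = solve-∀ ℚ-ring
  distrib-im : ∀ a b c d e f → a * (d + f) + b * (c + e) ≡ (a * d + b * c) + (a * f + b * e)
  distrib-im = solve-∀ ℚ-ring


module ℚi-Identities = RingIdentities _+ᶜ_ _*ᶜ_ -ᶜ_ (0ℚ +i 0ℚ) (1ℚ +i 0ℚ)
  (λ x y z → cong₂ _+i_ (ℚ.+-assoc (re x) (re y) (re z)) (ℚ.+-assoc (im x) (im y) (im z)))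
  (λ x y → cong₂ _+i_ (ℚ.+-comm (re x) (re y)) (ℚ.+-comm (im x) (im y)))
  (λ x → cong₂ _+i_ (ℚ.+-identityˡ (re x)) (ℚ.+-identityˡ (im x)))
  (λ x → cong₂ _+i_ (ℚ.+-inverseˡ (re x)) (ℚ.+-inverseˡ (im x)))
  (λ x y z → cong₂ _+i_ (assoc-re (re x) (im x) (re y) (im y) (re z) (im z)) (assoc-im (re x) (im x) (re y) (im y) (re z) (im z)))
  (λ x y → cong₂ _+i_ (comm-re (re x) (im x) (re y) (im y)) (comm-im (re x) (im x) (re y) (im y)))
  (λ x → cong₂ _+i_ (identity-re (re x) (im x)) (identity-im (re x) (im x)))
  (λ x y z → cong₂ _+i_ (distrib-re (re x) (im x) (re y) (im y) (re z) (im z)) (distrib-im (re x) (im x) (re y) (im y) (re z) (im z)))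

module Extension (q D : ℕ) (E : ℚ) where

  private
    module I = ℚi-Identities
    module R = I.Ring

    m : ℚi
    m = Dual.M q D E +i 0ℚ

    open ℂρ

  ⊕-assoc : Associative (Dual._+_ q D E)
  ⊕-assoc x y z = cong₂ ⟨_,_⟩ (R.+-assoc (fst x) (fst y) (fst z)) (R.+-assoc (snd x) (snd y) (snd z))

  ⊕-comm : Commutative (Dual._+_ q D E)
  ⊕-comm x y = cong₂ ⟨_,_⟩ (R.+-comm (fst x) (fst y)) (R.+-comm (snd x) (snd y))

  ⊕-identity : LeftIdentity (Dual.0R q D E) (Dual._+_ q D E)
  ⊕-identity x = cong₂ ⟨_,_⟩ (R.+-identityˡ (fst x)) (R.+-identityˡ (snd x))

  ⊕-inverse : LeftInverse (Dual.0R q D E) (Dual.-_ q D E) (Dual._+_ q D E)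
  ⊕-inverse x = cong₂ ⟨_,_⟩ (R.-‿inverseˡ (fst x)) (R.-‿inverseˡ (snd x))

  ⊗-assoc : Associative (Dual._*_ q D E)
  ⊗-assoc x y z = cong₂ ⟨_,_⟩ (I.assoc-fst m (fst x) (snd x) (fst y) (snd y) (fst z) (snd z))
    (I.assoc-snd m (fst x) (snd x) (fst y) (snd y) (fst z) (snd z))

  ⊗-comm : Commutative (Dual._*_ q D E)
  ⊗-comm x y = cong₂ ⟨_,_⟩ (I.comm-fst m (fst x) (snd x) (fst y) (snd y)) (I.comm-snd (fst x) (snd x) (fst y) (snd y))

  ⊗-identity : LeftIdentity (Dual.1R q D E) (Dual._*_ q D E)
  ⊗-identity x = cong₂ ⟨_,_⟩
    (trans (cong₂ _+ᶜ_ (R.*-identityˡ (fst x)) (trans (cong (_*ᶜ m) (R.zeroˡ (snd x))) (R.zeroˡ m))) (R.+-identityʳ (fst x)))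
    (trans (cong₂ _+ᶜ_ (R.*-identityˡ (snd x)) (R.zeroˡ (fst x))) (R.+-identityʳ (snd x)))

  ⊗-distrib : _DistributesOverˡ_ (Dual._*_ q D E) (Dual._+_ q D E)
  ⊗-distrib x y z = cong₂ ⟨_,_⟩ (I.distrib-fst m (fst x) (snd x) (fst y) (snd y) (fst z) (snd z))
    (I.distrib-snd (fst x) (snd x) (fst y) (snd y) (fst z) (snd z))

  emb-* : ∀ x y → Dual._*_ q D E (Dual.emb q D E x) (Dual.emb q D E y) ≡ Dual.emb q D E (x * y)
  emb-* x y = cong₂ ⟨_,_⟩ (cong₂ _+i_ (re-fst x y (Dual.M q D E)) (im-fst x y (Dual.M q D E)))
    (cong₂ _+i_ (re-snd x y) (im-snd x y))
    where
    re-fst : ∀ x y M → (x * y - 0ℚ) + (0ℚ * M - 0ℚ) ≡ x * y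
    re-fst = solve-∀ ℚ-ring
    im-fst : ∀ x y M → (x * 0ℚ + 0ℚ * y) + (0ℚ + 0ℚ * M) ≡ 0ℚ
    im-fst = solve-∀ ℚ-ring
    re-snd : ∀ x y → (x * 0ℚ + 0ℚ) + (0ℚ * y + 0ℚ) ≡ 0ℚ
    re-snd = solve-∀ ℚ-ring
    im-snd : ∀ x y → (x * 0ℚ + 0ℚ) + (0ℚ + 0ℚ * y) ≡ 0ℚ
    im-snd = solve-∀ ℚ-ring

  iR*iR : Dual._*_ q D E (Dual.iR q D E) (Dual.iR q D E) ≡ Dual.emb q D E (- 1ℚ)
  iR*iR = cong₂ ⟨_,_⟩ (cong₂ _+i_ (re-fst (Dual.M q D E)) (im-fst (Dual.M q D E))) refl
    where
    re-fst : ∀ M → - 1ℚ + (0ℚ * M - 0ℚ) ≡ - 1ℚ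
    re-fst = solve-∀ ℚ-ring
    im-fst : ∀ M → 0ℚ + (0ℚ + 0ℚ * M) ≡ 0ℚ
    im-fst = solve-∀ ℚ-ring

  ρR*ρR : Dual._*_ q D E (Dual.ρR q D E) (Dual.ρR q D E) ≡ Dual.emb q D E (Dual.M q D E)
  ρR*ρR = cong₂ ⟨_,_⟩ (cong₂ _+i_ (re-fst (Dual.M q D E)) (im-fst (Dual.M q D E))) refl
    where
    re-fst : ∀ M → 0ℚ + (1ℚ * M - 0ℚ) ≡ M
    re-fst = solve-∀ ℚ-ring
    im-fst : ∀ M → 0ℚ + (0ℚ + 0ℚ * M) ≡ 0ℚ
    im-fst = solve-∀ ℚ-ring

  module ℂ = RingIdentities (Dual._+_ q D E) (Dual._*_ q D E) (Dual.-_ q D E) (Dual.0R q D E) (Dual.1R q D E)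
    ⊕-assoc ⊕-comm ⊕-identity ⊕-inverse ⊗-assoc ⊗-comm ⊗-identity ⊗-distrib

  τ⁻¹*τ⁻¹ : Dual._*_ q D E (Dual.τ⁻¹ q D E) (Dual.τ⁻¹ q D E) ≡ Dual.emb q D E (- Dual.M q D E)
  τ⁻¹*τ⁻¹ = trans (ℂ.neg-neg iρ iρ) (trans (ℂ.interchange (Dual.iR q D E) (Dual.ρR q D E) (Dual.iR q D E) (Dual.ρR q D E))
    (trans (cong₂ (Dual._*_ q D E) iR*iR ρR*ρR) (trans (emb-* (- 1ℚ) (Dual.M q D E))
      (cong (Dual.emb q D E) (lemma (Dual.M q D E))))))
    where
    iρ : ℂρ
    iρ = Dual._*_ q D E (Dual.iR q D E) (Dual.ρR q D E)
    lemma : ∀ M → - 1ℚ * M ≡ - M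
    lemma = solve-∀ ℚ-ring

  τ-lin : Dual.τ q D E ≡ Dual._*_ q D E (Dual.emb q D E (- inv (Dual.M q D E))) (Dual.τ⁻¹ q D E)
  τ-lin = trans (⊗-comm iρ (Dual.emb q D E (inv (Dual.M q D E)))) (sym (ℂ.neg-neg (Dual.emb q D E (inv (Dual.M q D E))) iρ))
    where
    iρ : ℂρ
    iρ = Dual._*_ q D E (Dual.iR q D E) (Dual.ρR q D E)

-- The evaluation takes place in an abstract ring: unfolding nested products
-- of ℂρ into coordinates would take exponential time.
module Evaluation (q D d : ℕ) (E : ℚ) (1<q : 1 ℕ.< q) (0<E : 0ℚ ℚ.< E) (d+2≡D : suc (suc d) ≡ D)
  {C : Set} (_⊕_ _⊝_ _⊗_ : C → C → C) (⊖_ : C → C) (0R 1R : C)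
  (⊕-assoc : ∀ x y z → (x ⊕ y) ⊕ z ≡ x ⊕ (y ⊕ z)) (⊕-comm : ∀ x y → x ⊕ y ≡ y ⊕ x)
  (⊕-identity : ∀ x → 0R ⊕ x ≡ x) (⊕-inverse : ∀ x → (⊖ x) ⊕ x ≡ 0R)
  (⊗-assoc : ∀ x y z → (x ⊗ y) ⊗ z ≡ x ⊗ (y ⊗ z)) (⊗-comm : ∀ x y → x ⊗ y ≡ y ⊗ x)
  (⊗-identity : ∀ x → 1R ⊗ x ≡ x) (⊗-distrib : ∀ x y z → x ⊗ (y ⊕ z) ≡ (x ⊗ y) ⊕ (x ⊗ z))
  (⊝-def : ∀ x y → x ⊝ y ≡ x ⊕ (⊖ y))
  (emb : ℚ → C) (conj : C → C)
  (emb-0 : emb 0ℚ ≡ 0R) (emb-1 : emb 1ℚ ≡ 1R)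
  (emb-+ : ∀ x y → emb x ⊕ emb y ≡ emb (x + y)) (emb-neg : ∀ x → ⊖ emb x ≡ emb (- x))
  (emb-* : ∀ x y → emb x ⊗ emb y ≡ emb (x * y)) (conj-emb : ∀ x → conj (emb x) ≡ emb x)
  (pow : C → ℕ → C) (pow-zero : ∀ x → pow x 0 ≡ 1R) (pow-suc : ∀ x n → pow x (suc n) ≡ x ⊗ pow x n)
  (sumR : ℕ → (ℕ → C) → C)
  (sumR-zero : ∀ f → sumR 0 f ≡ 0R) (sumR-suc : ∀ n f → sumR (suc n) f ≡ sumR n f ⊕ f n)
  (prodR : ℕ → (ℕ → C) → C) (prodR-suc : ∀ n f → prodR (suc n) f ≡ prodR n f ⊗ f n)
  (poch : C → ℕ → C) (poch-zero : ∀ r → poch r 0 ≡ 1R)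
  (poch-suc : ∀ r n → poch r (suc n) ≡ poch r n ⊗ (1R ⊝ (r ⊗ emb (powQ (Dual.qQ q D E) n))))
  (τ τ⁻¹ : C) (τ⁻¹*τ⁻¹ : τ⁻¹ ⊗ τ⁻¹ ≡ emb (- Dual.M q D E))
  (τ-def : τ ≡ emb (- inv (Dual.M q D E)) ⊗ τ⁻¹)
  (h : C → C → C → C → ℕ → ℕ → C)
  (h-def : ∀ η η′ s s′ d i → h η η′ s s′ d i ≡
    (emb (Dual.pochQ q D E (Dual.qpow q D E (ℤ.- (+ d))) i) ⊗ pow s′ i) ⊗ sumR (suc i) (λ n →
      ((emb (Dual.pochQ q D E (Dual.qpow q D E (ℤ.- (+ i))) n) ⊗ poch (s ⊗ η′) n) ⊗ poch (s ⊗ η) n) ⊗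
      emb (inv (Dual.pochQ q D E (Dual.qpow q D E (ℤ.- (+ d))) n * Dual.pochQ q D E (Dual.qQ q D E) n)
           * powQ (Dual.qQ q D E) n)))
  (hD hperp hperp₋₁ : C → C → ℕ → C) (pperp : C → C → C)
  (hD-def : ∀ η η′ i → hD η η′ i ≡ h η η′ τ τ⁻¹ D i)
  (hperp-def : ∀ η η′ i → hperp η η′ i ≡
    (if suc i ℕ.≡ᵇ D
     then pow η′ (D ℕ.∸ 1) ⊗ prodR (D ℕ.∸ 1) (λ k →
            (η ⊝ (τ ⊗ emb (powQ (Dual.qQ q D E) (suc k)))) ⊗
            (η ⊝ (τ⁻¹ ⊗ emb (Dual.qpow q D E (ℤ.- (+ suc k))))))
     else h η η′ (τ ⊗ emb (Dual.qQ q D E)) (τ⁻¹ ⊗ emb (inv (Dual.qQ q D E))) (D ℕ.∸ 2) i))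
  (hperp₋₁-zero : ∀ η η′ → hperp₋₁ η η′ 0 ≡ 0R) (hperp₋₁-suc : ∀ η η′ i → hperp₋₁ η η′ (suc i) ≡ hperp η η′ i)
  (pperp-def : ∀ η η′ → pperp η η′ ≡ (η′ ⊗ (η ⊝ τ)) ⊗ (η ⊝ (τ⁻¹ ⊗ emb (Dual.qpow q D E (ℤ.- (+ D))))))
  (ℓ : Sign → ℕ → C → C → C)
  (ℓ-plus : ∀ i η η′ → ℓ plus i η η′ ≡
    ((hD η η′ (suc i) ⊝ (pperp η η′ ⊗ hperp η η′ i)) ⊗ pow τ⁻¹ (suc i)) ⊗
    emb (inv ((1ℚ - powQ (Dual.qQ q D E) D) * Dual.pochQ q D E (Dual.qQ q D E) i)))
  (ℓ-minus : ∀ i η η′ → ℓ minus i η η′ ≡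
    (emb ((powQ (Dual.qQ q D E) D - powQ (Dual.qQ q D E) i) *
       inv ((powQ (Dual.qQ q D E) D - 1ℚ) * Dual.pochQ q D E (Dual.qQ q D E) i)) ⊗ pow τ⁻¹ i) ⊗
    (hD η η′ i ⊝
      ((emb ((1ℚ - powQ (Dual.qQ q D E) i) * inv (powQ (Dual.qQ q D E) D - powQ (Dual.qQ q D E) i))
        ⊗ pperp η η′) ⊗ hperp₋₁ η η′ i)))
  (λ⁺ λ⁺' λ⁻ λ⁻' : ℕ → C)
  (λ⁺-def : ∀ k → λ⁺ k ≡ τ ⊗ emb (powQ (Dual.qQ q D E) k))
  (λ⁺'-def : ∀ k → λ⁺' k ≡ τ⁻¹ ⊗ emb (Dual.qpow q D E (ℤ.- (+ k))))
  (λ⁻-def : ∀ k → λ⁻ k ≡ τ⁻¹ ⊗ emb (Dual.qpow q D E (ℤ.- (+ k))))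
  (λ⁻'-def : ∀ k → λ⁻' k ≡ τ ⊗ emb (powQ (Dual.qQ q D E) k))
  (inner : (f g : C → C → C) → C)
  (inner-def : ∀ f g → inner f g ≡
    (sumR D (λ i → (f (λ⁺ i) (λ⁺' i) ⊗ conj (g (λ⁺ i) (λ⁺' i))) ⊗ emb (Dual.w⁺ q D E i)) ⊕
     sumR D (λ k → (f (λ⁻ (suc k)) (λ⁻' (suc k)) ⊗ conj (g (λ⁻ (suc k)) (λ⁻' (suc k)))) ⊗ emb (Dual.w⁻ q D E (suc k)))) ⊕
    sumR (D ℕ.∸ 1) (λ k →
      ((f (λ⁺ (suc k)) (λ⁺' (suc k)) ⊗ conj (g (λ⁻ (suc k)) (λ⁻' (suc k)))) ⊕
       (f (λ⁻ (suc k)) (λ⁻' (suc k)) ⊗ conj (g (λ⁺ (suc k)) (λ⁺' (suc k))))) ⊗ emb (Dual.c q D E (suc k))))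
  where

  infixl 6 _⊞_ _⊟_
  infixl 7 _·_

  private
    _⊞_ _⊟_ _·_ : C → C → C
    _⊞_ = _⊕_
    _⊟_ = _⊝_
    _·_ = _⊗_

  open Dual q D E using (pochQ; qpow; M; w⁺; w⁻) renaming (qQ to Q; c to w±)
  open Krawtchouk q D E 1<q
  open Weights q D E 1<q 0<E
  open Coordinates q D d E 1<q 0<E d+2≡D
  module ℂ = RingIdentities _⊕_ _⊗_ ⊖_ 0R 1R
    ⊕-assoc ⊕-comm ⊕-identity ⊕-inverse ⊗-assoc ⊗-comm ⊗-identity ⊗-distrib

  lin : ℚ → C
  lin u = emb u · τ⁻¹

  emb-⊞ : ∀ x y → emb x ⊞ (⊖ emb y) ≡ emb (x - y)
  emb-⊞ x y = trans (cong (emb x ⊞_) (emb-neg y)) (emb-+ x (- y))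

  emb-⊟ : ∀ x y → emb x ⊟ emb y ≡ emb (x - y)
  emb-⊟ x y = trans (⊝-def (emb x) (emb y)) (emb-⊞ x y)

  -- τ and all the points λ_{±k} lie on the line ℚ τ⁻¹.
  lin-* : ∀ u v → lin u · lin v ≡ emb (u * v * - M)
  lin-* u v = trans (ℂ.interchange (emb u) τ⁻¹ (emb v) τ⁻¹)
    (trans (cong₂ _·_ (emb-* u v) τ⁻¹*τ⁻¹) (emb-* (u * v) (- M)))

  emb-lin : ∀ u v → emb u · lin v ≡ lin (u * v)
  emb-lin u v = trans (sym (ℂ.Ring.*-assoc (emb u) (emb v) τ⁻¹)) (cong (_· τ⁻¹) (emb-* u v))

  lin-emb : ∀ u v → lin u · emb v ≡ lin (u * v)
  lin-emb u v = trans (ℂ.swapʳ (emb u) τ⁻¹ (emb v)) (cong (_· τ⁻¹) (emb-* u v))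

  lin-difference : ∀ u v → lin u ⊟ lin v ≡ lin (u - v)
  lin-difference u v = trans (⊝-def (lin u) (lin v)) (trans (ℂ.factor-difference (emb u) (emb v) τ⁻¹)
    (cong (_· τ⁻¹) (emb-⊞ u v)))

  τ⁻¹-emb : ∀ u → τ⁻¹ · emb u ≡ lin u
  τ⁻¹-emb u = ℂ.Ring.*-comm τ⁻¹ (emb u)

  τ≡lin : τ ≡ lin (- m)
  τ≡lin = τ-def

  τ-emb : ∀ u → τ · emb u ≡ lin (- m * u)
  τ-emb u = trans (cong (_· emb u) τ≡lin) (lin-emb (- m) u)

  pow-lin : ∀ u i → pow (lin u) i ≡ emb (powQ u i) · pow τ⁻¹ i
  pow-lin u zero = trans (pow-zero (lin u)) (sym (trans (cong₂ _·_ emb-1 (pow-zero τ⁻¹)) (⊗-identity 1R)))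
  pow-lin u (suc i) = begin
    pow (lin u) (suc i)
      ≡⟨ trans (pow-suc (lin u) i) (cong (lin u ·_) (pow-lin u i)) ⟩
    lin u · (emb (powQ u i) · pow τ⁻¹ i)
      ≡⟨ ℂ.interchange (emb u) τ⁻¹ (emb (powQ u i)) (pow τ⁻¹ i) ⟩
    emb u · emb (powQ u i) · (τ⁻¹ · pow τ⁻¹ i)
      ≡⟨ cong₂ _·_ (emb-* u (powQ u i)) (sym (pow-suc τ⁻¹ i)) ⟩
    emb (powQ u (suc i)) · pow τ⁻¹ (suc i) ∎
    where open ≡-Reasoning

  pow-square : ∀ i → pow τ⁻¹ i · pow τ⁻¹ i ≡ emb (powQ (- M) i)
  pow-square zero = trans (cong₂ _·_ (pow-zero τ⁻¹) (pow-zero τ⁻¹)) (trans (⊗-identity 1R) (sym emb-1))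
  pow-square (suc i) = begin
    pow τ⁻¹ (suc i) · pow τ⁻¹ (suc i)
      ≡⟨ cong₂ _·_ (pow-suc τ⁻¹ i) (pow-suc τ⁻¹ i) ⟩
    (τ⁻¹ · pow τ⁻¹ i) · (τ⁻¹ · pow τ⁻¹ i)
      ≡⟨ ℂ.interchange τ⁻¹ (pow τ⁻¹ i) τ⁻¹ (pow τ⁻¹ i) ⟩
    (τ⁻¹ · τ⁻¹) · (pow τ⁻¹ i · pow τ⁻¹ i)
      ≡⟨ cong₂ _·_ τ⁻¹*τ⁻¹ (pow-square i) ⟩
    emb (- M) · emb (powQ (- M) i)
      ≡⟨ emb-* (- M) (powQ (- M) i) ⟩
    emb (powQ (- M) (suc i)) ∎
    where open ≡-Reasoning

  poch-emb : ∀ {r} x n → r ≡ emb x → poch r n ≡ emb (pochQ x n)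
  poch-emb {r} x zero _ = trans (poch-zero r) (sym emb-1)
  poch-emb {r} x (suc n) r≡ = begin
    poch r (suc n)
      ≡⟨ poch-suc r n ⟩
    poch r n · (1R ⊟ r · emb (powQ Q n))
      ≡⟨ cong₂ (λ s t → s · (1R ⊟ t)) (poch-emb x n r≡) (trans (cong (_· emb (powQ Q n)) r≡) (emb-* x (powQ Q n))) ⟩
    emb (pochQ x n) · (1R ⊟ emb (x * powQ Q n))
      ≡⟨ cong (λ t → emb (pochQ x n) · (t ⊟ emb (x * powQ Q n))) (sym emb-1) ⟩
    emb (pochQ x n) · (emb 1ℚ ⊟ emb (x * powQ Q n))
      ≡⟨ cong (emb (pochQ x n) ·_) (emb-⊟ 1ℚ (x * powQ Q n)) ⟩
    emb (pochQ x n) · emb (1ℚ - x * powQ Q n)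
      ≡⟨ emb-* (pochQ x n) (1ℚ - x * powQ Q n) ⟩
    emb (pochQ x (suc n)) ∎
    where open ≡-Reasoning

  sumR-emb : ∀ n {f} g → (∀ k → k ℕ.< n → f k ≡ emb (g k)) → sumR n f ≡ emb (sumQ n g)
  sumR-emb zero {f} g _ = trans (sumR-zero f) (sym emb-0)
  sumR-emb (suc n) {f} g eq = trans (sumR-suc n f) (trans
    (cong₂ _⊞_ (sumR-emb n g (λ k k<n → eq k (ℕ.m<n⇒m<1+n k<n))) (eq n ℕ.≤-refl)) (emb-+ (sumQ n g) (g n)))

  prodR-zero : ∀ n f k → k ℕ.< n → f k ≡ 0R → prodR n f ≡ 0R
  prodR-zero (suc n) f k (ℕ.s≤s k≤n) eq = trans (prodR-suc n f) (cases (ℕ.m≤n⇒m<n∨m≡n k≤n))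
    where
    cases : k ℕ.< n ⊎ k ≡ n → prodR n f · f n ≡ 0R
    cases (inj₁ k<n) = trans (cong (_· f n) (prodR-zero n f k k<n eq)) (ℂ.Ring.zeroˡ (f n))
    cases (inj₂ k≡n) = trans (cong (prodR n f ·_) (trans (cong f (sym k≡n)) eq)) (ℂ.Ring.zeroʳ (prodR n f))

  h-value : ∀ η η′ s s′ d i k j x y z → z ≡ pochQ (powQ p d) i * K c d i k j → i ℕ.≤ d → s · η′ ≡ emb x → s · η ≡ emb y →
    (∀ n → pochQ x n * pochQ y n ≡ basis c d n k j) →
    h η η′ s s′ d i ≡ emb z · pow s′ i
  h-value η η′ s s′ d i k j x y z z≡ i≤d sη′ sη xy = begin
    h η η′ s s′ d i
      ≡⟨ h-def η η′ s s′ d i ⟩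
    emb (pochQ (qpow (ℤ.- + d)) i) · pow s′ i · sumR (suc i) f
      ≡⟨ cong₂ (λ u v → emb u · pow s′ i · v) (cong (λ u → pochQ u i) (qpow-neg d)) (sumR-emb (suc i) {f} g (λ n _ → term n)) ⟩
    emb (pochQ (powQ p d) i) · pow s′ i · emb (sumQ (suc i) g)
      ≡⟨ ℂ.swapʳ (emb (pochQ (powQ p d) i)) (pow s′ i) (emb (sumQ (suc i) g)) ⟩
    emb (pochQ (powQ p d) i) · emb (sumQ (suc i) g) · pow s′ i
      ≡⟨ cong (_· pow s′ i) (emb-* (pochQ (powQ p d) i) (sumQ (suc i) g)) ⟩
    emb (pochQ (powQ p d) i * sumQ (suc i) g) · pow s′ i
      ≡⟨ cong (λ u → emb (pochQ (powQ p d) i * u) · pow s′ i) (sym (sumQ-truncate (suc i) (suc d) {g} vanish (ℕ.s≤s i≤d))) ⟩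
    emb (pochQ (powQ p d) i * K c d i k j) · pow s′ i
      ≡⟨ cong (λ u → emb u · pow s′ i) (sym z≡) ⟩
    emb z · pow s′ i ∎
    where
    open ≡-Reasoning
    f : ℕ → C
    f n = emb (pochQ (qpow (ℤ.- + i)) n) · poch (s · η′) n · poch (s · η) n
          · emb (inv (pochQ (qpow (ℤ.- + d)) n * pochQ Q n) * powQ Q n)
    g : ℕ → ℚ
    g n = coeff c d i n * basis c d n k j
    vanish : ∀ n → suc i ℕ.≤ n → g n ≡ 0ℚ
    vanish n i<n = *-zero-fst (basis c d n k j)
      (*-zero-fst (inv (pochQ (powQ p d) n * pochQ Q n) * powQ Q n) (pochQ-vanish i n i<n))
    regroup : ∀ a x y w → a * x * y * w ≡ a * w * (x * y)
    regroup = solve-∀ ℚ-ring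
    term : ∀ n → f n ≡ emb (g n)
    term n = begin
      f n
        ≡⟨ cong₂ _·_ (cong₂ _·_ (cong₂ _·_ (cong (λ u → emb (pochQ u n)) (qpow-neg i))
             (poch-emb x n sη′)) (poch-emb y n sη))
             (cong (λ u → emb (inv (pochQ u n * pochQ Q n) * powQ Q n)) (qpow-neg d)) ⟩
      emb a · emb Xₙ · emb Yₙ · emb w
        ≡⟨ cong (λ u → u · emb Yₙ · emb w) (emb-* a Xₙ) ⟩
      emb (a * Xₙ) · emb Yₙ · emb w
        ≡⟨ cong (_· emb w) (emb-* (a * Xₙ) Yₙ) ⟩
      emb (a * Xₙ * Yₙ) · emb w
        ≡⟨ emb-* (a * Xₙ * Yₙ) w ⟩
      emb (a * Xₙ * Yₙ * w)
        ≡⟨ cong emb (trans (regroup a Xₙ Yₙ w) (cong (a * w *_) (xy n))) ⟩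
      emb (g n) ∎
      where
      a Xₙ Yₙ w : ℚ
      a = pochQ (powQ p i) n
      Xₙ = pochQ x n
      Yₙ = pochQ y n
      w = inv (pochQ (powQ p d) n * pochQ Q n) * powQ Q n

  pperp-lin : ∀ u v → pperp (lin u) (lin v) ≡ lin (v * (u + m) * - M * (u - powQ p D))
  pperp-lin u v = begin
    pperp (lin u) (lin v)
      ≡⟨ pperp-def (lin u) (lin v) ⟩
    lin v · (lin u ⊟ τ) · (lin u ⊟ τ⁻¹ · emb (qpow (ℤ.- + D)))
      ≡⟨ cong₂ (λ s t → lin v · (lin u ⊟ s) · (lin u ⊟ t)) τ≡lin
           (trans (cong (λ t → τ⁻¹ · emb t) (qpow-neg D)) (τ⁻¹-emb (powQ p D))) ⟩
    lin v · (lin u ⊟ lin (- m)) · (lin u ⊟ lin (powQ p D))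
      ≡⟨ cong₂ (λ s t → lin v · s · t) (lin-difference u (- m)) (lin-difference u (powQ p D)) ⟩
    lin v · lin (u - - m) · lin (u - powQ p D)
      ≡⟨ cong (_· lin (u - powQ p D)) (lin-* v (u - - m)) ⟩
    emb (v * (u - - m) * - M) · lin (u - powQ p D)
      ≡⟨ emb-lin (v * (u - - m) * - M) (u - powQ p D) ⟩
    lin (v * (u - - m) * - M * (u - powQ p D))
      ≡⟨ cong lin (lemma v u m M (powQ p D)) ⟩
    lin (v * (u + m) * - M * (u - powQ p D)) ∎
    where
    open ≡-Reasoning
    lemma : ∀ v u m M P → v * (u - - m) * - M * (u - P) ≡ v * (u + m) * - M * (u - P)
    lemma = solve-∀ ℚ-ring

  assemble⁺ : ∀ H G i (x y g z : ℚ) → H ≡ emb x · pow τ⁻¹ i → G ≡ emb y · pow τ⁻¹ i →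
    z ≡ powQ (- M) i * g * (x - 1ℚ * y) → (H ⊟ G) · pow τ⁻¹ i · emb g ≡ emb z
  assemble⁺ H G i x y g z H≡ G≡ z≡ = begin
    (H ⊟ G) · T · emb g
      ≡⟨ cong₂ (λ u v → (u ⊟ v) · T · emb g) H≡ G≡ ⟩
    (emb x · T ⊟ emb y · T) · T · emb g
      ≡⟨ cong (λ u → u · T · emb g) (trans (⊝-def (emb x · T) (emb y · T))
           (trans (ℂ.factor-difference (emb x) (emb y) T) (cong (_· T) (emb-⊞ x y)))) ⟩
    emb (x - y) · T · T · emb g
      ≡⟨ cong (_· emb g) (trans (ℂ.Ring.*-assoc (emb (x - y)) T T)
           (trans (cong (emb (x - y) ·_) (pow-square i)) (emb-* (x - y) (powQ (- M) i)))) ⟩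
    emb ((x - y) * powQ (- M) i) · emb g
      ≡⟨ emb-* ((x - y) * powQ (- M) i) g ⟩
    emb ((x - y) * powQ (- M) i * g)
      ≡⟨ cong emb (trans (lemma x y (powQ (- M) i) g) (sym z≡)) ⟩
    emb z ∎
    where
    open ≡-Reasoning
    T : C
    T = pow τ⁻¹ i
    lemma : ∀ x y t g → (x - y) * t * g ≡ t * g * (x - 1ℚ * y)
    lemma = solve-∀ ℚ-ring

  assemble⁻ : ∀ H p h i (x y r g z : ℚ) → H ≡ emb x · pow τ⁻¹ i → emb r · p · h ≡ emb (r * y) · pow τ⁻¹ i →
    z ≡ powQ (- M) i * g * (x - r * y) → emb g · pow τ⁻¹ i · (H ⊟ emb r · p · h) ≡ emb z
  assemble⁻ H p h i x y r g z H≡ G≡ z≡ = begin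
    emb g · T · (H ⊟ emb r · p · h)
      ≡⟨ cong₂ (λ u v → emb g · T · (u ⊟ v)) H≡ G≡ ⟩
    emb g · T · (emb x · T ⊟ emb (r * y) · T)
      ≡⟨ cong (emb g · T ·_) (trans (⊝-def (emb x · T) (emb (r * y) · T))
           (trans (ℂ.factor-difference (emb x) (emb (r * y)) T) (cong (_· T) (emb-⊞ x (r * y))))) ⟩
    emb g · T · (emb (x - r * y) · T)
      ≡⟨ ℂ.interchange (emb g) T (emb (x - r * y)) T ⟩
    emb g · emb (x - r * y) · (T · T)
      ≡⟨ cong₂ _·_ (emb-* g (x - r * y)) (pow-square i) ⟩
    emb (g * (x - r * y)) · emb (powQ (- M) i)
      ≡⟨ emb-* (g * (x - r * y)) (powQ (- M) i) ⟩
    emb (g * (x - r * y) * powQ (- M) i)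
      ≡⟨ cong emb (trans (lemma (x - r * y) (powQ (- M) i) g) (sym z≡)) ⟩
    emb z ∎
    where
    open ≡-Reasoning
    T : C
    T = pow τ⁻¹ i
    lemma : ∀ x t g → g * x * t ≡ t * g * x
    lemma = solve-∀ ℚ-ring

  emb0-· : ∀ z T → z ≡ 0ℚ → emb z · T ≡ 0R
  emb0-· z T z≡0 = trans (cong (_· T) (trans (cong emb z≡0) emb-0)) (ℂ.Ring.zeroˡ T)

  emb-absorb : ∀ r y p h T → p · h ≡ emb y · T → emb r · p · h ≡ emb (r * y) · T
  emb-absorb r y p h T eq = trans (ℂ.Ring.*-assoc (emb r) p h) (trans (cong (emb r ·_) eq)
    (trans (sym (ℂ.Ring.*-assoc (emb r) (emb y) T)) (cong (_· T) (emb-* r y))))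

  emb-zero : ∀ r y p T → r ≡ 0ℚ → emb r · p · 0R ≡ emb (r * y) · T
  emb-zero r y p T r≡0 = trans (ℂ.Ring.zeroʳ (emb r · p))
    (sym (emb0-· (r * y) T (*-zero-fst y r≡0)))

  ℓ-value : ∀ η η′ (X Y : ℕ → ℚ) →
    (∀ i → i ℕ.≤ D → hD η η′ i ≡ emb (X i) · pow τ⁻¹ i) →
    (∀ i → i ℕ.< D → pperp η η′ · hperp η η′ i ≡ emb (Y i) · pow τ⁻¹ (suc i)) →
    ∀ μ i → i ℕ.< D → ℓ μ i η η′ ≡ emb (α μ i * (X (ι μ i) - ρ μ i * Y (κ μ i)))
  ℓ-value η η′ X Y hX hY plus i i<D = trans (ℓ-plus i η η′)
    (assemble⁺ (hD η η′ (suc i)) (pperp η η′ · hperp η η′ i) (suc i) (X (suc i)) (Y i)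
      (inv ((1ℚ - powQ Q D) * pochQ Q i)) (α plus i * (X (suc i) - 1ℚ * Y i)) (hX (suc i) i<D) (hY i i<D) refl)
  ℓ-value η η′ X Y hX hY minus i i<D = trans (ℓ-minus i η η′)
    (assemble⁻ (hD η η′ i) (pperp η η′) (hperp₋₁ η η′ i) i (X i) (Y (ℕ.pred i))
      (ρ minus i) ((powQ Q D - powQ Q i) * inv ((powQ Q D - 1ℚ) * pochQ Q i))
      (α minus i * (X i - ρ minus i * Y (ℕ.pred i))) (hX i (ℕ.<⇒≤ i<D)) (odd i i<D) refl)
    where
    odd : ∀ i → i ℕ.< D → emb (ρ minus i) · pperp η η′ · hperp₋₁ η η′ i ≡ emb (ρ minus i * Y (ℕ.pred i)) · pow τ⁻¹ i
    odd zero _ = trans (cong (emb (ρ minus 0) · pperp η η′ ·_) (hperp₋₁-zero η η′))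
      (emb-zero (ρ minus 0) (Y 0) (pperp η η′) (pow τ⁻¹ 0) (ℚ.*-zeroˡ (inv (powQ Q D - powQ Q 0))))
    odd (suc i) i<D = trans (cong (emb (ρ minus (suc i)) · pperp η η′ ·_) (hperp₋₁-suc η η′ i))
      (emb-absorb (ρ minus (suc i)) (Y i) (pperp η η′) (hperp η η′ i) (pow τ⁻¹ (suc i)) (hY i (ℕ.<⇒≤ i<D)))

  τ⁻¹-qpow : ∀ k → τ⁻¹ · emb (qpow (ℤ.- (+ k))) ≡ lin (v k)
  τ⁻¹-qpow k = trans (cong (λ t → τ⁻¹ · emb t) (qpow-neg k)) (τ⁻¹-emb (powQ p k))

  λ⁺≡ : ∀ k → λ⁺ k ≡ lin (u k)
  λ⁺≡ k = trans (λ⁺-def k) (τ-emb (powQ Q k))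

  λ⁺'≡ : ∀ k → λ⁺' k ≡ lin (v k)
  λ⁺'≡ k = trans (λ⁺'-def k) (τ⁻¹-qpow k)

  λ⁻≡ : ∀ k → λ⁻ k ≡ lin (v k)
  λ⁻≡ k = trans (λ⁻-def k) (τ⁻¹-qpow k)

  λ⁻'≡ : ∀ k → λ⁻' k ≡ lin (u k)
  λ⁻'≡ k = trans (λ⁻'-def k) (τ-emb (powQ Q k))

  τ-lin : ∀ v → τ · lin v ≡ emb v
  τ-lin v = trans (cong (_· lin v) τ≡lin) (trans (lin-* (- m) v) (cong emb (trans
    (cong (λ t → t * v * - M) (sym (ℚ.*-identityʳ (- m)))) (trans (m-v 1ℚ v) (ℚ.*-identityˡ v)))))

  τQ-lin : ∀ v → (τ · emb Q) · lin v ≡ emb (Q * v)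
  τQ-lin v = trans (cong (_· lin v) (τ-emb Q)) (trans (lin-* (- m * Q) v) (cong emb (m-v Q v)))


  hD-plus : ∀ k → k ℕ.≤ D → ∀ i → i ℕ.≤ D → hD (lin (u k)) (lin (v k)) i ≡ emb (X i k) · pow τ⁻¹ i
  hD-plus k k≤D i i≤D = trans (hD-def (lin (u k)) (lin (v k)) i) (h-value (lin (u k)) (lin (v k)) τ τ⁻¹ D i k (D ℕ.∸ k) (v k) (c * powQ p (D ℕ.∸ k)) (X i k) refl i≤D
    (τ-lin (v k)) (trans (τ-lin (u k)) (cong emb (u≡ k (D ℕ.∸ k) (ℕ.m+[n∸m]≡n k≤D)))) (λ n → refl))

  hD-minus : ∀ k → k ℕ.≤ D → ∀ i → i ℕ.≤ D → hD (lin (v k)) (lin (u k)) i ≡ emb (X i k) · pow τ⁻¹ i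
  hD-minus k k≤D i i≤D = trans (hD-def (lin (v k)) (lin (u k)) i) (h-value (lin (v k)) (lin (u k)) τ τ⁻¹ D i k (D ℕ.∸ k) (c * powQ p (D ℕ.∸ k)) (v k) (X i k) refl i≤D
    (trans (τ-lin (u k)) (cong emb (u≡ k (D ℕ.∸ k) (ℕ.m+[n∸m]≡n k≤D)))) (τ-lin (v k))
    (λ n → ℚ.*-comm (pochQ (c * powQ p (D ℕ.∸ k)) n) (pochQ (powQ p k) n)))

  private
    branch : (η η′ : C) (i : ℕ) → Bool → C
    branch η η′ i b =
      if b
      then pow η′ (D ℕ.∸ 1) · prodR (D ℕ.∸ 1) (λ k →
             (η ⊟ τ · emb (powQ Q (suc k))) · (η ⊟ τ⁻¹ · emb (qpow (ℤ.- (+ suc k)))))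
      else h η η′ (τ · emb Q) (τ⁻¹ · emb (inv Q)) (D ℕ.∸ 2) i

    hperp-branch : ∀ η η′ i b → (suc i ℕ.≡ᵇ D) ≡ b → hperp η η′ i ≡ branch η η′ i b
    hperp-branch η η′ i b eq = trans (hperp-def η η′ i) (cong (branch η η′ i) eq)

    hperp-inner : ∀ k → k ℕ.≤ d → ∀ i → i ℕ.≤ d → ∀ a b x y →
      Q * b ≡ x → Q * a ≡ y → (∀ n → pochQ x n * pochQ y n ≡ basis c d n k (d ℕ.∸ k)) →
      hperp (lin a) (lin b) i ≡ emb (Y i (suc k)) · pow τ⁻¹ i
    hperp-inner k k≤d i i≤d a b x y Qb Qa xy = begin
      hperp (lin a) (lin b) i
        ≡⟨ hperp-branch (lin a) (lin b) i false (trans (cong (suc i ℕ.≡ᵇ_) (sym d+2≡D)) (≡ᵇ-< i d i≤d)) ⟩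
      h (lin a) (lin b) (τ · emb Q) (τ⁻¹ · emb (inv Q)) (D ℕ.∸ 2) i
        ≡⟨ cong (λ t → h (lin a) (lin b) (τ · emb Q) (τ⁻¹ · emb (inv Q)) t i) (cong (ℕ._∸ 2) (sym d+2≡D)) ⟩
      h (lin a) (lin b) (τ · emb Q) (τ⁻¹ · emb (inv Q)) d i
        ≡⟨ h-value (lin a) (lin b) (τ · emb Q) (τ⁻¹ · emb (inv Q)) d i k (d ℕ.∸ k) x y B refl i≤d
             (trans (τQ-lin b) (cong emb Qb)) (trans (τQ-lin a) (cong emb Qa)) xy ⟩
      emb B · pow (τ⁻¹ · emb (inv Q)) i
        ≡⟨ cong (emb B ·_) (trans (cong (λ t → pow t i) (τ⁻¹-emb (inv Q))) (pow-lin (inv Q) i)) ⟩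
      emb B · (emb (powQ (inv Q) i) · pow τ⁻¹ i)
        ≡⟨ sym (ℂ.Ring.*-assoc (emb B) (emb (powQ (inv Q) i)) (pow τ⁻¹ i)) ⟩
      emb B · emb (powQ (inv Q) i) · pow τ⁻¹ i
        ≡⟨ cong (_· pow τ⁻¹ i) (trans (emb-* B (powQ (inv Q) i)) (cong emb Y≡)) ⟩
      emb (Y i (suc k)) · pow τ⁻¹ i ∎
      where
      open ≡-Reasoning
      B : ℚ
      B = pochQ (powQ p d) i * K c d i k (d ℕ.∸ k)
      Y≡ : B * powQ (inv Q) i ≡ Y i (suc k)
      Y≡ = ℚ.*-comm B (powQ (inv Q) i)
      ≡ᵇ-< : ∀ i d → i ℕ.≤ d → (i ℕ.≡ᵇ suc d) ≡ false
      ≡ᵇ-< zero d _ = refl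
      ≡ᵇ-< (suc i) (suc d) (ℕ.s≤s i≤d) = ≡ᵇ-< i d i≤d

    hperp-last : ∀ η η′ k → k ℕ.≤ d → (η ⊟ τ · emb (powQ Q (suc k))) · (η ⊟ τ⁻¹ · emb (qpow (ℤ.- (+ suc k)))) ≡ 0R →
      hperp η η′ (suc d) ≡ emb (Y (suc d) (suc k)) · pow τ⁻¹ (suc d)
    hperp-last η η′ k k≤d factor = begin
      hperp η η′ (suc d)
        ≡⟨ hperp-branch η η′ (suc d) true (trans (cong (suc (suc d) ℕ.≡ᵇ_) (sym d+2≡D)) (≡ᵇ-refl d)) ⟩
      pow η′ (D ℕ.∸ 1) · prodR (D ℕ.∸ 1) (λ k →
         (η ⊟ τ · emb (powQ Q (suc k))) · (η ⊟ τ⁻¹ · emb (qpow (ℤ.- (+ suc k)))))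
        ≡⟨ cong (pow η′ (D ℕ.∸ 1) ·_) (prodR-zero (D ℕ.∸ 1) (λ k →
             (η ⊟ τ · emb (powQ Q (suc k))) · (η ⊟ τ⁻¹ · emb (qpow (ℤ.- (+ suc k)))))
             k (subst (k ℕ.<_) (cong (ℕ._∸ 1) d+2≡D) (ℕ.s≤s k≤d)) factor) ⟩
      pow η′ (D ℕ.∸ 1) · 0R
        ≡⟨ ℂ.Ring.zeroʳ (pow η′ (D ℕ.∸ 1)) ⟩
      0R
        ≡⟨ sym (emb0-· (Y (suc d) (suc k)) (pow τ⁻¹ (suc d)) Y≡0) ⟩
      emb (Y (suc d) (suc k)) · pow τ⁻¹ (suc d) ∎
      where
      open ≡-Reasoning
      Y≡0 : Y (suc d) (suc k) ≡ 0ℚ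
      Y≡0 = *-zero-snd (powQ p (suc d))
        (*-zero-fst (K c d (suc d) k (d ℕ.∸ k)) (pochQ-vanish d (suc d) ℕ.≤-refl))

    lin-self : ∀ a → lin a ⊟ lin a ≡ 0R
    lin-self a = trans (⊝-def (lin a) (lin a)) (ℂ.Ring.-‿inverseʳ (lin a))

    hperp-plus : ∀ k → k ℕ.≤ d → ∀ i → i ℕ.≤ d ⊎ i ≡ suc d →
      hperp (lin (u (suc k))) (lin (v (suc k))) i ≡ emb (Y i (suc k)) · pow τ⁻¹ i
    hperp-plus k k≤d i (inj₁ i≤d) = hperp-inner k k≤d i i≤d (u (suc k)) (v (suc k))
      (powQ p k) (c * powQ p (d ℕ.∸ k)) (Q*v k) (Q*u k (d ℕ.∸ k) (ℕ.m+[n∸m]≡n k≤d)) (λ n → refl)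
    hperp-plus k k≤d i (inj₂ refl) = hperp-last (lin (u (suc k))) (lin (v (suc k))) k k≤d
      (trans (cong (_· (lin (u (suc k)) ⊟ τ⁻¹ · emb (qpow (ℤ.- (+ suc k)))))
          (trans (cong (lin (u (suc k)) ⊟_) (τ-emb (powQ Q (suc k)))) (lin-self (u (suc k)))))
        (ℂ.Ring.zeroˡ (lin (u (suc k)) ⊟ τ⁻¹ · emb (qpow (ℤ.- (+ suc k))))))

    hperp-minus : ∀ k → k ℕ.≤ d → ∀ i → i ℕ.≤ d ⊎ i ≡ suc d →
      hperp (lin (v (suc k))) (lin (u (suc k))) i ≡ emb (Y i (suc k)) · pow τ⁻¹ i
    hperp-minus k k≤d i (inj₁ i≤d) = hperp-inner k k≤d i i≤d (v (suc k)) (u (suc k))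
      (c * powQ p (d ℕ.∸ k)) (powQ p k) (Q*u k (d ℕ.∸ k) (ℕ.m+[n∸m]≡n k≤d)) (Q*v k)
      (λ n → ℚ.*-comm (pochQ (c * powQ p (d ℕ.∸ k)) n) (pochQ (powQ p k) n))
    hperp-minus k k≤d i (inj₂ refl) = hperp-last (lin (v (suc k))) (lin (u (suc k))) k k≤d
      (trans (cong ((lin (v (suc k)) ⊟ τ · emb (powQ Q (suc k))) ·_)
          (trans (cong (lin (v (suc k)) ⊟_) (τ⁻¹-qpow (suc k))) (lin-self (v (suc k)))))
        (ℂ.Ring.zeroʳ (lin (v (suc k)) ⊟ τ · emb (powQ Q (suc k)))))

    pperp-hperp : ∀ a b i y → hperp (lin a) (lin b) i ≡ emb y · pow τ⁻¹ i →
      pperp (lin a) (lin b) · hperp (lin a) (lin b) i ≡ emb (π a b * y) · pow τ⁻¹ (suc i)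
    pperp-hperp a b i y eq = trans (cong₂ _·_ (pperp-lin a b) eq)
      (trans (ℂ.interchange (emb (π a b)) τ⁻¹ (emb y) (pow τ⁻¹ i))
        (cong₂ _·_ (emb-* (π a b) y) (sym (pow-suc τ⁻¹ i))))

    pperp-zero : ∀ a b i y → π a b ≡ 0ℚ →
      pperp (lin a) (lin b) · hperp (lin a) (lin b) i ≡ emb (π a b * y) · pow τ⁻¹ (suc i)
    pperp-zero a b i y π≡0 = trans
      (cong (_· hperp (lin a) (lin b) i) (trans (pperp-lin a b) (emb0-· (π a b) τ⁻¹ π≡0)))
      (trans (ℂ.Ring.zeroˡ (hperp (lin a) (lin b) i)) (sym (emb0-· (π a b * y) (pow τ⁻¹ (suc i)) (*-zero-fst y π≡0))))

    split : ∀ i → i ℕ.< D → i ℕ.≤ d ⊎ i ≡ suc d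
    split i i<D = cases (ℕ.m≤n⇒m<n∨m≡n (ℕ.s≤s⁻¹ (subst (i ℕ.<_) (sym d+2≡D) i<D)))
      where
      cases : i ℕ.< suc d ⊎ i ≡ suc d → i ℕ.≤ d ⊎ i ≡ suc d
      cases (inj₁ (ℕ.s≤s i≤d)) = inj₁ i≤d
      cases (inj₂ eq) = inj₂ eq

  ℓ-λ⁺ : ∀ μ i k → i ℕ.< D → k ℕ.< D → ℓ μ i (λ⁺ k) (λ⁺' k) ≡ emb (value⁺ μ i k)
  ℓ-λ⁺ μ i k i<D k<D = trans (cong₂ (ℓ μ i) (λ⁺≡ k) (λ⁺'≡ k))
    (ℓ-value (lin (u k)) (lin (v k)) (λ i → X i k) (λ i → π (u k) (v k) * Y i k) (hD-plus k (ℕ.<⇒≤ k<D)) (odd k k<D) μ i i<D)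
    where
    odd : ∀ k → k ℕ.< D → ∀ i → i ℕ.< D →
      pperp (lin (u k)) (lin (v k)) · hperp (lin (u k)) (lin (v k)) i ≡ emb (π (u k) (v k) * Y i k) · pow τ⁻¹ (suc i)
    odd zero _ i _ = pperp-zero (u 0) (v 0) i (Y i 0) π-first
    odd (suc k) k<D i i<D = pperp-hperp (u (suc k)) (v (suc k)) i (Y i (suc k))
      (hperp-plus k (ℕ.s≤s⁻¹ (ℕ.s≤s⁻¹ (subst (suc k ℕ.<_) (sym d+2≡D) k<D))) i (split i i<D))

  ℓ-λ⁻ : ∀ μ i k → i ℕ.< D → k ℕ.< D → ℓ μ i (λ⁻ (suc k)) (λ⁻' (suc k)) ≡ emb (value⁻ μ i (suc k))
  ℓ-λ⁻ μ i k i<D k<D = trans (cong₂ (ℓ μ i) (λ⁻≡ (suc k)) (λ⁻'≡ (suc k)))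
    (ℓ-value (lin (v (suc k))) (lin (u (suc k))) (λ i → X i (suc k)) (λ i → π (v (suc k)) (u (suc k)) * Y i (suc k))
      (hD-minus (suc k) k<D) (odd (split k k<D)) μ i i<D)
    where
    odd : k ℕ.≤ d ⊎ k ≡ suc d → ∀ i → i ℕ.< D →
      pperp (lin (v (suc k))) (lin (u (suc k))) · hperp (lin (v (suc k))) (lin (u (suc k))) i
        ≡ emb (π (v (suc k)) (u (suc k)) * Y i (suc k)) · pow τ⁻¹ (suc i)
    odd (inj₂ k≡) i _ = pperp-zero (v (suc k)) (u (suc k)) i (Y i (suc k))
      (subst (λ t → π (v t) (u t) ≡ 0ℚ) (trans (sym d+2≡D) (cong suc (sym k≡))) π-last)
    odd (inj₁ k≤d) i i<D = pperp-hperp (v (suc k)) (u (suc k)) i (Y i (suc k)) (hperp-minus k k≤d i (split i i<D))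

  inner-value : ∀ f g F⁺ F⁻ G⁺ G⁻ →
    (∀ k → k ℕ.< D → f (λ⁺ k) (λ⁺' k) ≡ emb (F⁺ k)) →
    (∀ k → k ℕ.< D → f (λ⁻ (suc k)) (λ⁻' (suc k)) ≡ emb (F⁻ (suc k))) →
    (∀ k → k ℕ.< D → g (λ⁺ k) (λ⁺' k) ≡ emb (G⁺ k)) →
    (∀ k → k ℕ.< D → g (λ⁻ (suc k)) (λ⁻' (suc k)) ≡ emb (G⁻ (suc k))) →
    inner f g ≡ emb (form F⁺ F⁻ G⁺ G⁻)
  inner-value f g F⁺ F⁻ G⁺ G⁻ f⁺ f⁻ g⁺ g⁻ = trans (inner-def f g) (trans
    (cong₂ _⊞_ (cong₂ _⊞_
      (sumR-emb D (λ k → F⁺ k * G⁺ k * w⁺ k) (λ k k<D →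
        trans (cong (_· emb (w⁺ k)) (product (f⁺ k k<D) (g⁺ k k<D))) (emb-* (F⁺ k * G⁺ k) (w⁺ k))))
      (sumR-emb D (λ k → F⁻ (suc k) * G⁻ (suc k) * w⁻ (suc k)) (λ k k<D →
        trans (cong (_· emb (w⁻ (suc k))) (product (f⁻ k k<D) (g⁻ k k<D))) (emb-* (F⁻ (suc k) * G⁻ (suc k)) (w⁻ (suc k))))))
      (sumR-emb (D ℕ.∸ 1) (λ k → (F⁺ (suc k) * G⁻ (suc k) + F⁻ (suc k) * G⁺ (suc k)) * w± (suc k)) (λ k k<D-1 →
        trans (cong (_· emb (w± (suc k))) (trans
            (cong₂ _⊞_ (product (f⁺ (suc k) (k+1<D k<D-1)) (g⁻ k (ℕ.<⇒≤ (k+1<D k<D-1))))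
              (product (f⁻ k (ℕ.<⇒≤ (k+1<D k<D-1))) (g⁺ (suc k) (k+1<D k<D-1))))
            (emb-+ (F⁺ (suc k) * G⁻ (suc k)) (F⁻ (suc k) * G⁺ (suc k)))))
          (emb-* (F⁺ (suc k) * G⁻ (suc k) + F⁻ (suc k) * G⁺ (suc k)) (w± (suc k))))))
    (trans (cong (_⊞ emb s₃) (emb-+ s₁ s₂)) (emb-+ (s₁ + s₂) s₃)))
    where
    s₁ s₂ s₃ : ℚ
    s₁ = sumQ D (λ k → F⁺ k * G⁺ k * w⁺ k)
    s₂ = sumQ D (λ k → F⁻ (suc k) * G⁻ (suc k) * w⁻ (suc k))
    s₃ = sumQ (D ℕ.∸ 1) (λ k → (F⁺ (suc k) * G⁻ (suc k) + F⁻ (suc k) * G⁺ (suc k)) * w± (suc k))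
    product : ∀ {a b x y} → a ≡ emb x → b ≡ emb y → a · conj b ≡ emb (x * y)
    product {x = x} {y} a≡ b≡ = trans (cong₂ _·_ a≡ (trans (cong conj b≡) (conj-emb y))) (emb-* x y)
    k+1<D : ∀ {k} → k ℕ.< D ℕ.∸ 1 → suc k ℕ.< D
    k+1<D {k} k< = subst (suc k ℕ.<_) d+2≡D (ℕ.s≤s (subst (k ℕ.<_) (cong (ℕ._∸ 1) (sym d+2≡D)) k<))

  inner-ℓ : ∀ μ ν i j → i ℕ.< D → j ℕ.< D →
    inner (ℓ μ i) (ℓ ν j) ≡ emb (δℕ i j * δS μ ν * Dual.N q D E μ i)
  inner-ℓ μ ν i j i<D j<D = trans
    (inner-value (ℓ μ i) (ℓ ν j) (value⁺ μ i) (value⁻ μ i) (value⁺ ν j) (value⁻ ν j)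
      (λ k → ℓ-λ⁺ μ i k i<D) (λ k → ℓ-λ⁻ μ i k i<D) (λ k → ℓ-λ⁺ ν j k j<D) (λ k → ℓ-λ⁻ ν j k j<D))
    (cong emb (form-orthogonal μ ν i j i<D j<D))

primePower>1 : ∀ {q} → IsPrimePower q → 1 < q
primePower>1 (p , k , p-prime , refl) = ℕ.≤-trans (ℕ.nonTrivial⇒n>1 p {{prime⇒nonTrivial p-prime}})
  (ℕ.m≤m*n p (p ℕ.^ k) {{ℕ.m^n≢0 p k {{ℕ.nonTrivial⇒nonZero p {{prime⇒nonTrivial p-prime}}}}}})

qᵉ-pos : ∀ {q} → 1 < q → (ed : EData q) → 0ℚ ℚ.< qᵉ ed
qᵉ-pos _ e0 = 0<1
qᵉ-pos {q} 1<q e1 = ℕ→ℚ-mono-< {0} {q} (ℕ.<⇒≤ 1<q)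
qᵉ-pos {q} 1<q e2 = ℕ→ℚ-mono-< {0} {q ℕ.* q} (ℕ.*-mono-< (ℕ.<⇒≤ 1<q) (ℕ.<⇒≤ 1<q))
qᵉ-pos 1<q (eHalf (suc r) _) = ℕ→ℚ-mono-< {0} {suc r} (ℕ.s≤s ℕ.z≤n)
qᵉ-pos 1<q (eThreeHalf (suc r) _) = ℕ→ℚ-mono-< {0} {suc r ℕ.* suc r ℕ.* suc r} (ℕ.s≤s ℕ.z≤n)
qᵉ-pos () (eHalf zero refl)
qᵉ-pos () (eThreeHalf zero refl)

inner-ℓ : (q D : ℕ) (E : ℚ) → 1 < q → 0ℚ ℚ.< E → ∀ d → suc (suc d) ≡ D →
  ∀ μ ν i j → i < D → j < D →
  Dual.inner q D E (Dual.ℓ q D E μ i) (Dual.ℓ q D E ν j) ≡ Dual.emb q D E (δℕ i j * δS μ ν * Dual.N q D E μ i)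
inner-ℓ q D E 1<q 0<E d d+2≡D = Evaluation.inner-ℓ q D d E 1<q 0<E d+2≡D
  (Dual._+_ q D E) (Dual._-_ q D E) (Dual._*_ q D E) (Dual.-_ q D E) (Dual.0R q D E) (Dual.1R q D E)
  ⊕-assoc ⊕-comm ⊕-identity ⊕-inverse ⊗-assoc ⊗-comm ⊗-identity ⊗-distrib (λ _ _ → refl)
  (Dual.emb q D E) (Dual.conj q D E) refl refl (λ _ _ → refl) (λ _ → refl) emb-* (λ _ → refl)
  (Dual.pow q D E) (λ _ → refl) (λ _ _ → refl)
  (Dual.sumR q D E) (λ _ → refl) (λ _ _ → refl)
  (Dual.prodR q D E) (λ _ _ → refl)
  (Dual.poch q D E) (λ _ → refl) (λ _ _ → refl)
  (Dual.τ q D E) (Dual.τ⁻¹ q D E) τ⁻¹*τ⁻¹ τ-lin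
  (Dual.h q D E) (λ _ _ _ _ _ _ → refl)
  (Dual.hD q D E) (Dual.hperp q D E) (Dual.hperp₋₁ q D E) (Dual.pperp q D E)
  (λ _ _ _ → refl) (λ _ _ _ → refl) (λ _ _ → refl) (λ _ _ _ → refl) (λ _ _ → refl)
  (Dual.ℓ q D E) (λ _ _ _ → refl) (λ _ _ _ → refl)
  (Dual.λ⁺ q D E) (Dual.λ⁺' q D E) (Dual.λ⁻ q D E) (Dual.λ⁻' q D E)
  (λ _ → refl) (λ _ → refl) (λ _ → refl) (λ _ → refl)
  (Dual.inner q D E) (λ _ _ → refl)
  where open Extension q D E

theorem10p7 : (q D : ℕ) → IsPrimePower q → 3 ≤ D → (ed : EData q) →
    (i j : ℕ) → i < D → j < D → (μ ν : Sign) →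
    Dual.inner q D (qᵉ ed) (Dual.ℓ q D (qᵉ ed) μ i) (Dual.ℓ q D (qᵉ ed) ν j)
      ≡ Dual.emb q D (qᵉ ed) (δℕ i j * δS μ ν * Dual.N q D (qᵉ ed) μ i)
theorem10p7 _ (suc zero) _ (ℕ.s≤s ())
theorem10p7 q (suc (suc d)) prime-power _ ed i j i<D j<D μ ν =
  inner-ℓ q (suc (suc d)) (qᵉ ed) 1<q (qᵉ-pos 1<q ed) d refl μ ν i j i<D j<D
  where
  1<q : 1 < q
  1<q = primePower>1 prime-power
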